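{- For all integers $p,q,r\ge 1$, the tree $T_{p,q,r}$ is $(2(p+q+r)+1)$-$\gamma_g$-critical; that is, $\gamma_g(T_{p,q,r}) = 2(p+q+r)+1$ and $\gamma_g(T_{p,q,r}|v) < \gamma_g(T_{p,q,r})$ for every vertex $v$ of $T_{p,q,r}$.
   Context: $T_{p,q,r}$ is the tree obtained from disjoint paths $P_{4p+1}$, $P_{4q+1}$, $P_{4r+1}$ (on $4p+1$, $4q+1$, $4r+1$ vertices) by identifying three end-vertices, one from each path. Domination game: Dominator and Staller alternately choose vertices, each chosen vertex must dominate at least one vertex not dominated by previously chosen vertices; the game ends when no such move exists; Dominator minimizes and Staller maximizes the number of moves. $\gamma_g(G)$ is the number of moves under optimal play when Dominator starts. For a vertex $v$, $G|v$ is $G$ with $v$ declared already dominated, and $\gamma_g(G|v)$ the number of moves under optimal play on it with Dominator starting. A graph $G$ is $\gamma_g$-critical if $\gamma_g(G|v)<\gamma_g(G)$ for every $v\in V(G)$, and $k$-$\gamma_g$-critical if moreover $\gamma_g(G)=k$. -}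

module Defs where

open import Data.Nat using (ℕ; zero; suc; _+_; _*_; _⊓_; _⊔_; _≡ᵇ_; _<ᵇ_)
open import Data.Bool using (Bool; true; false; _∧_; _∨_; not; if_then_else_)
open import Data.Fin using (Fin; toℕ; _≟_)
open import Data.List using (List; []; _∷_; foldr; filterᵇ; map)
open import Data.Bool.ListAction using (any)
open import Data.List using (allFin)
open import Relation.Nullary.Decidable using (⌊_⌋)

record Graph : Set where
  field
    n   : ℕ
    adj : Fin n → Fin n → Bool
open Graph public

closedNbr : (G : Graph) → Fin (n G) → Fin (n G) → Bool
closedNbr G v u = ⌊ v ≟ u ⌋ ∨ adj G v u

VSet : Graph → Set
VSet G = Fin (n G) → Bool

legal : (G : Graph) → VSet G → Fin (n G) → Bool
legal G D v = any (λ u → closedNbr G v u ∧ not (D u)) (allFin (n G))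

legalMoves : (G : Graph) → VSet G → List (Fin (n G))
legalMoves G D = filterᵇ (legal G D) (allFin (n G))

play : (G : Graph) → VSet G → Fin (n G) → VSet G
play G D v u = D u ∨ closedNbr G v u

data Player : Set where
  dominator staller : Player

minList : List ℕ → ℕ
minList []       = 0
minList (x ∷ xs) = foldr _⊓_ x xs

maxList : List ℕ → ℕ
maxList = foldr _⊔_ 0

-- Minimax value (number of moves under optimal play) of the domination game
-- from dominated-set D with player `who` to move, computed with a fuel bound.
-- Every legal move dominates a new vertex, so the game lasts at most n G moves;
-- hence with fuel ≥ n G the value is exact.
value : (G : Graph) → ℕ → Player → VSet G → ℕ
value G zero     who       D = 0
value G (suc f)  dominator D with legalMoves G D
... | []       = 0
... | (m ∷ ms) = suc (minList (map (λ v → value G f staller (play G D v)) (m ∷ ms)))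
value G (suc f)  staller   D with legalMoves G D
... | []       = 0
... | (m ∷ ms) = suc (maxList (map (λ v → value G f dominator (play G D v)) (m ∷ ms)))

γg : Graph → ℕ
γg G = value G (n G) dominator (λ _ → false)

γg∣ : (G : Graph) → Fin (n G) → ℕ
γg∣ G v = value G (n G) dominator (λ u → ⌊ u ≟ v ⌋)

-- The tree T_{p,q,r}: vertices 0 .. 4p+4q+4r. Vertex 0 is the common end
-- vertex (centre). Branch 1 is 1..4p, branch 2 is 4p+1..4p+4q, branch 3 is
-- 4p+4q+1..4p+4q+4r; each vertex i ≥ 1 has parent i-1, except the first
-- vertex of each branch, whose parent is 0. So each branch together with
-- the centre is a path on 4p+1, 4q+1, 4r+1 vertices respectively.
parentT : ℕ → ℕ → ℕ → ℕ
parentT p q zero    = 0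
parentT p q (suc i) =
  if (i ≡ᵇ 0) ∨ (i ≡ᵇ 4 * p) ∨ (i ≡ᵇ 4 * p + 4 * q) then 0 else i

childOf : ℕ → ℕ → ℕ → ℕ → Bool
childOf p q i j = (0 <ᵇ i) ∧ (parentT p q i ≡ᵇ j)

T : ℕ → ℕ → ℕ → Graph
T p q r = record
  { n   = suc (4 * p + 4 * q + 4 * r)
  ; adj = λ a b → childOf p q (toℕ a) (toℕ b) ∨ childOf p q (toℕ b) (toℕ a)
  }

{-# OPTIONS --safe #-}
-- While the centre or one of its neighbours is dominated, Dominator's moves
-- dominate at most three new vertices and Staller can (almost always) answer by
-- dominating one, so 4m+1 undominated vertices cost at least 2m+1 moves. Only
-- playing the centre can dominate four vertices; Staller pays for that by
-- keeping the lengths of the undominated runs, reduced mod 4, large in sum, so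
-- that Dominator must later make a move dominating fewer than three.
--
-- For the upper bounds, a run of 4m+s undominated vertices (s < 4) is charged
-- 8m + 0, 4, 6, 7 respectively. With the centre dominated every move of Staller
-- lowers the total charge, and Dominator can lower it by 7, by 6 if it is even,
-- and by 4 if it is a multiple of 4; hence the number of moves is at most the
-- charge over 4, rounded down if Dominator is to move and up otherwise. With
-- the centre undominated the same holds at the extra charge 4, provided that
-- Dominator keeps the runs next to the centre of length divisible by 4.
-- A predominated vertex at distance d from the centre is answered by playing
-- the centre (d ≡ 0, 2 mod 4), its neighbour on the same arm (d ≡ 3), or by the
-- strategy with undominated centre (d ≡ 1).
module Submission where

open import Defs
open import Data.Bool using (Bool; true; false; _∧_; _∨_; not)
open import Data.Bool.ListAction using (any)
open import Data.Bool.Properties using (∨-identityʳ; ∨-zeroʳ)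
open import Data.Empty using (⊥; ⊥-elim)
open import Data.Fin using (Fin; zero; suc; toℕ; _↑ˡ_; _↑ʳ_; splitAt)
import Data.Fin as Fin
open import Data.Fin.Properties using (toℕ-↑ˡ; toℕ-↑ʳ; toℕ<n; splitAt⁻¹-↑ˡ; splitAt⁻¹-↑ʳ; toℕ-injective)
open import Data.List using (List; []; _∷_; _++_; map; length; replicate; tabulate; foldr; filterᵇ; allFin)
open import Data.List.Membership.Propositional using (_∈_)
open import Data.List.Membership.Propositional.Properties using (∈-map⁺; ∈-map⁻; ∈-allFin; ∈-++⁻)
open import Data.List.Properties using (map-++; ∷-injectiveˡ; ∷-injectiveʳ)
open import Data.List.Relation.Unary.Any using (here; there)
open import Data.Nat using (ℕ; zero; suc; _+_; _*_; _∸_; _⊓_; _⊔_; _≤_; _<_; _≥_; _≡ᵇ_; z≤n; s≤s)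
open import Data.Nat.Divisibility using (_∣_; divides; ∣m∣n⇒∣m+n; m∣m*n; ∣-trans; _∣0)
open import Data.Nat.ListAction using (sum)
open import Data.Nat.ListAction.Properties using (sum-++)
open import Data.Nat.Properties
open import Data.Nat.Tactic.RingSolver using (solve-∀)
open import Data.Product using (Σ; ∃-syntax; _×_; _,_; proj₁; proj₂)
open import Data.Sum using (_⊎_; inj₁; inj₂)
open import Data.Unit using (⊤; tt)
open import Function using (_∘_; id)
open import Relation.Binary.PropositionalEquality
open import Relation.Nullary using (¬_; yes; no)
open import Relation.Nullary.Decidable using (⌊_⌋)

-- Staller's reply of a single vertex needs two adjacent dominated vertices next to an undominated
-- one; hence the invariant that no dominated vertex is isolated in a position reached by play. The
-- reply can still fail when every arm is either finished or untouched. Untouched arms have a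
-- multiple of 4 vertices, so this happens only at sizes where Staller can afford to dominate more
-- than one vertex.
--
-- The hard case of the lower bound is Dominator taking four vertices with the centre. From
-- `1 + 4 * K` undominated vertices, threes and ones afterwards would give only `2 * K` moves, one
-- too few, so Dominator must be forced into a later move of at most two vertices. The measure for
-- this is the sum of `n / 4`, rounded down, over the run lengths `n`: the size minus four times
-- this sum is the sum of the residues mod 4. The conditions imposed on it survive every exchange of
-- a three and a one, yet cannot hold when no such exchange is left; so the weak move must occur.

-- Minimax values through single moves

minList-≤ : ∀ {x} xs → x ∈ xs → minList xs ≤ x
minList-≤ (x ∷ xs) = go x xs
  where
  go : ∀ y zs {x} → x ∈ y ∷ zs → foldr _⊓_ y zs ≤ x
  go y []       (here refl)         = ≤-refl
  go y (z ∷ zs) (here refl)         = ≤-trans (m⊓n≤n z _) (go y zs (here refl))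
  go y (z ∷ zs) (there (here refl)) = m⊓n≤m z _
  go y (z ∷ zs) (there (there i))   = ≤-trans (m⊓n≤n z _) (go y zs (there i))

minList-glb : ∀ {b} x xs → (∀ {y} → y ∈ x ∷ xs → b ≤ y) → b ≤ minList (x ∷ xs)
minList-glb x []       h = h (here refl)
minList-glb x (z ∷ zs) h =
  ⊓-glb (h (there (here refl))) (minList-glb x zs λ { (here p) → h (here p) ; (there i) → h (there (there i)) })

maxList-≥ : ∀ {x} xs → x ∈ xs → x ≤ maxList xs
maxList-≥ (x ∷ xs) (here refl) = m≤m⊔n x _
maxList-≥ (x ∷ xs) (there i)   = ≤-trans (maxList-≥ xs i) (m≤n⊔m x _)

maxList-lub : ∀ {b} xs → (∀ {y} → y ∈ xs → y ≤ b) → maxList xs ≤ b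
maxList-lub []       h = z≤n
maxList-lub (x ∷ xs) h = ⊔-lub (h (here refl)) (maxList-lub xs (λ i → h (there i)))

∈-filterᵇ⁺ : ∀ {A : Set} (p : A → Bool) {x} xs → x ∈ xs → p x ≡ true → x ∈ filterᵇ p xs
∈-filterᵇ⁺ p (x ∷ xs) (here refl) e rewrite e = here refl
∈-filterᵇ⁺ p (y ∷ xs) (there i)   e with p y
... | true  = there (∈-filterᵇ⁺ p xs i e)
... | false = ∈-filterᵇ⁺ p xs i e

∈-filterᵇ⁻ : ∀ {A : Set} (p : A → Bool) {x} xs → x ∈ filterᵇ p xs → p x ≡ true
∈-filterᵇ⁻ p (y ∷ xs) i with p y in e
∈-filterᵇ⁻ p (y ∷ xs) (here refl) | true  = e
∈-filterᵇ⁻ p (y ∷ xs) (there i)   | true  = ∈-filterᵇ⁻ p xs i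
∈-filterᵇ⁻ p (y ∷ xs) i           | false = ∈-filterᵇ⁻ p xs i

any-true⁻ : ∀ {A : Set} (p : A → Bool) xs → any p xs ≡ true → ∃[ x ] p x ≡ true
any-true⁻ p (x ∷ xs) e with p x in eq
... | true  = x , eq
... | false = any-true⁻ p xs e

any-false⁻ : ∀ {A : Set} (p : A → Bool) {x} xs → any p xs ≡ false → x ∈ xs → p x ≡ false
any-false⁻ p (x ∷ xs) e (here refl) with p x
... | false = refl
any-false⁻ p (y ∷ xs) e (there i) with p y
... | false = any-false⁻ p xs e i

module Values (G : Graph) where

  Legal : VSet G → Fin (n G) → Set
  Legal D v = legal G D v ≡ true

  private
    moves⁺ : ∀ {D v} → Legal D v → v ∈ legalMoves G D
    moves⁺ {D} {v} l = ∈-filterᵇ⁺ (legal G D) (allFin (n G)) (∈-allFin v) l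

    moves⁻ : ∀ {D v} → v ∈ legalMoves G D → Legal D v
    moves⁻ {D} = ∈-filterᵇ⁻ (legal G D) (allFin (n G))

  illegal⇒unchanged : ∀ {D v} → legal G D v ≡ false → ∀ u → play G D v u ≡ D u
  illegal⇒unchanged {D} {v} e u
    with D u | closedNbr G v u | any-false⁻ (λ u → closedNbr G v u ∧ not (D u)) (allFin (n G)) e (∈-allFin u)
  ... | true  | _     | _  = refl
  ... | false | false | _  = refl

  legal⇒changed : ∀ {D v} → Legal D v → ¬ (∀ u → play G D v u ≡ D u)
  legal⇒changed {D} {v} l same with any-true⁻ (λ u → closedNbr G v u ∧ not (D u)) (allFin (n G)) l
  ... | u , e with D u | closedNbr G v u | same u
  ... | false | true  | ()
  legal⇒changed l same | u , () | true | true | _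
  legal⇒changed l same | u , () | _ | false | _

  dominator-≤ : ∀ {f b D} v → Legal D v → value G f staller (play G D v) ≤ b → value G (suc f) dominator D ≤ suc b
  dominator-≤ {f} {b} {D} v l h with legalMoves G D | moves⁺ {D} l
  ... | m ∷ ms | i = s≤s (≤-trans (minList-≤ _ (∈-map⁺ (λ v → value G f staller (play G D v)) i)) h)

  dominator-end : ∀ {f D} → (∀ v → ¬ Legal D v) → value G f dominator D ≤ 0
  dominator-end {zero}      h = z≤n
  dominator-end {suc f} {D} h with legalMoves G D | moves⁻ {D}
  ... | []     | _ = z≤n
  ... | m ∷ ms | g = ⊥-elim (h m (g (here refl)))

  staller-end : ∀ {f D} → (∀ v → ¬ Legal D v) → value G f staller D ≤ 0
  staller-end {zero}      h = z≤n
  staller-end {suc f} {D} h with legalMoves G D | moves⁻ {D}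
  ... | []     | _ = z≤n
  ... | m ∷ ms | g = ⊥-elim (h m (g (here refl)))

  staller-≤ : ∀ {f b D} → (∀ v → Legal D v → value G f dominator (play G D v) ≤ b) → value G (suc f) staller D ≤ suc b
  staller-≤ {f} {b} {D} h with legalMoves G D | moves⁻ {D}
  ... | []     | _ = z≤n
  ... | m ∷ ms | g = s≤s (maxList-lub (map val (m ∷ ms)) λ i → bound (∈-map⁻ val i))
    where
    val : Fin (n G) → ℕ
    val v = value G f dominator (play G D v)
    bound : ∀ {y} → (∃[ v ] (v ∈ m ∷ ms × y ≡ val v)) → y ≤ b
    bound (v , i , refl) = h v (g i)

  staller-≥ : ∀ {f b D} v → Legal D v → b ≤ value G f dominator (play G D v) → suc b ≤ value G (suc f) staller D
  staller-≥ {f} {b} {D} v l h with legalMoves G D | moves⁺ {D} l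
  ... | m ∷ ms | i = s≤s (≤-trans h (maxList-≥ _ (∈-map⁺ (λ v → value G f dominator (play G D v)) i)))

  dominator-≥ : ∀ {f b D} v → Legal D v → (∀ v → Legal D v → b ≤ value G f staller (play G D v)) →
                suc b ≤ value G (suc f) dominator D
  dominator-≥ {f} {b} {D} v l h with legalMoves G D | moves⁺ {D} l | moves⁻ {D}
  ... | m ∷ ms | _ | g = s≤s (minList-glb (val m) (map val ms) λ i → bound (∈-map⁻ val i))
    where
    val : Fin (n G) → ℕ
    val v = value G f staller (play G D v)
    bound : ∀ {y} → (∃[ v ] (v ∈ m ∷ ms × y ≡ val v)) → b ≤ y
    bound (v , i , refl) = h v (g i)

-- The game on a centre and three lists

infix 4 _⇝_ _⟶_

-- Playing a vertex dominates three consecutive entries of the list of an arm.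
data _⇝_ : List Bool → List Bool → Set where
  here  : ∀ {a b d xs} → a ∧ b ∧ d ≡ false → a ∷ b ∷ d ∷ xs ⇝ true ∷ true ∷ true ∷ xs
  there : ∀ {a xs ys} → xs ⇝ ys → a ∷ xs ⇝ a ∷ ys

-- Each arm is listed from the neighbour of the centre outwards (true means
-- dominated) and is padded by a final true, so that playing the leaf is also
-- a move on three consecutive entries.
record Position : Set where
  constructor ⟨_,_,_,_⟩
  field
    centreOf            : Bool
    armOf₁ armOf₂ armOf₃ : List Bool

open Position public using (centreOf)

top : List Bool → Bool
top []      = true
top (b ∷ _) = b

cover : List Bool → List Bool
cover []       = []
cover (_ ∷ xs) = true ∷ xs

data _⟶_ : Position → Position → Set where
  centre : ∀ {c X Y Z} → c ∧ top X ∧ top Y ∧ top Z ≡ false →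
           ⟨ c , X , Y , Z ⟩ ⟶ ⟨ true , cover X , cover Y , cover Z ⟩
  arm₁   : ∀ {c c′ X X′ Y Z} → c ∷ X ⇝ c′ ∷ X′ → ⟨ c , X , Y , Z ⟩ ⟶ ⟨ c′ , X′ , Y , Z ⟩
  arm₂   : ∀ {c c′ X Y Y′ Z} → c ∷ Y ⇝ c′ ∷ Y′ → ⟨ c , X , Y , Z ⟩ ⟶ ⟨ c′ , X , Y′ , Z ⟩
  arm₃   : ∀ {c c′ X Y Z Z′} → c ∷ Z ⇝ c′ ∷ Z′ → ⟨ c , X , Y , Z ⟩ ⟶ ⟨ c′ , X , Y , Z′ ⟩

arm-move : ∀ {c c′ X X′} → c ∷ X ⇝ c′ ∷ X′ → (c′ ≡ true × top X′ ≡ true) ⊎ (c ≡ c′ × X ⇝ X′)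
arm-move (here _)  = inj₁ (refl , refl)
arm-move (there m) = inj₂ (refl , m)

-- AtMostD b s: Dominator, to move, can end the game within b further moves;
-- the other three are analogous (the suffix names the player to move).
AtMostD AtMostS AtLeastD AtLeastS : ℕ → Position → Set
AtMostD zero    s = ∀ t → ¬ (s ⟶ t)
AtMostD (suc b) s = (∀ t → ¬ (s ⟶ t)) ⊎ ∃[ t ] (s ⟶ t × AtMostS b t)
AtMostS zero    s = ∀ t → ¬ (s ⟶ t)
AtMostS (suc b) s = ∀ t → s ⟶ t → AtMostD b t
AtLeastD zero    s = ⊤
AtLeastD (suc b) s = (∃[ t ] s ⟶ t) × (∀ t → s ⟶ t → AtLeastS b t)
AtLeastS zero    s = ⊤
AtLeastS (suc b) s = ∃[ t ] (s ⟶ t × AtLeastD b t)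

module Symmetry (σ : Position → Position) (invol : ∀ s → σ (σ s) ≡ s) (σ-step : ∀ {s t} → s ⟶ t → σ s ⟶ σ t) where

  private
    σ-step⁻ : ∀ {s t} → σ s ⟶ t → s ⟶ σ t
    σ-step⁻ {s} {t} m = subst (_⟶ σ t) (invol s) (σ-step m)

  -- An involution that preserves steps also reflects them, so a strategy found for one arm carries
  -- over to the others.
  σ-AtMostD : ∀ b {s} → AtMostD b s → AtMostD b (σ s)
  σ-AtMostS : ∀ b {s} → AtMostS b s → AtMostS b (σ s)
  σ-AtMostD zero    h t m                = h (σ t) (σ-step⁻ m)
  σ-AtMostD (suc b) (inj₁ h)             = inj₁ λ t m → h (σ t) (σ-step⁻ m)
  σ-AtMostD (suc b) (inj₂ (t , m , h))   = inj₂ (σ t , σ-step m , σ-AtMostS b h)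
  σ-AtMostS zero    h t m                = h (σ t) (σ-step⁻ m)
  σ-AtMostS (suc b) h t m                = subst (AtMostD b) (invol t) (σ-AtMostD b (h (σ t) (σ-step⁻ m)))

swap₁₂ swap₁₃ : Position → Position
swap₁₂ ⟨ c , X , Y , Z ⟩ = ⟨ c , Y , X , Z ⟩
swap₁₃ ⟨ c , X , Y , Z ⟩ = ⟨ c , Z , Y , X ⟩

∧-swap₁₂ : ∀ c x y z → c ∧ x ∧ y ∧ z ≡ c ∧ y ∧ x ∧ z
∧-swap₁₂ false x     y     z = refl
∧-swap₁₂ true  false false z = refl
∧-swap₁₂ true  false true  z = refl
∧-swap₁₂ true  true  false z = refl
∧-swap₁₂ true  true  true  z = refl

∧-swap₁₃ : ∀ c x y z → c ∧ x ∧ y ∧ z ≡ c ∧ z ∧ y ∧ x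
∧-swap₁₃ c x y z = trans (∧-swap₁₂ c x y z) (trans (cong (c ∧_) (swap y x z)) (∧-swap₁₂ c y z x))
  where
  swap : ∀ y x z → y ∧ x ∧ z ≡ y ∧ z ∧ x
  swap false x     z     = refl
  swap true  false false = refl
  swap true  false true  = refl
  swap true  true  false = refl
  swap true  true  true  = refl

swap₁₂-step : ∀ {s t} → s ⟶ t → swap₁₂ s ⟶ swap₁₂ t
swap₁₂-step (centre {c} {X} {Y} {Z} e) = centre (trans (sym (∧-swap₁₂ c (top X) (top Y) (top Z))) e)
swap₁₂-step (arm₁ m) = arm₂ m
swap₁₂-step (arm₂ m) = arm₁ m
swap₁₂-step (arm₃ m) = arm₃ m

swap₁₃-step : ∀ {s t} → s ⟶ t → swap₁₃ s ⟶ swap₁₃ t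
swap₁₃-step (centre {c} {X} {Y} {Z} e) = centre (trans (sym (∧-swap₁₃ c (top X) (top Y) (top Z))) e)
swap₁₃-step (arm₁ m) = arm₃ m
swap₁₃-step (arm₂ m) = arm₂ m
swap₁₃-step (arm₃ m) = arm₁ m

module Swap₁₂ = Symmetry swap₁₂ (λ _ → refl) swap₁₂-step
module Swap₁₃ = Symmetry swap₁₃ (λ _ → refl) swap₁₃-step

-- Run lengths of an arm

-- The sum of φ over the lengths of the runs of false, where k further
-- undominated vertices precede the list; empty runs are counted as well.
weigh : (ℕ → ℕ) → ℕ → List Bool → ℕ
weigh φ k []           = φ k
weigh φ k (false ∷ xs) = weigh φ (suc k) xs
weigh φ k (true ∷ xs)  = φ k + weigh φ 0 xs

weight : (ℕ → ℕ) → Position → ℕ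
weight φ ⟨ _ , X , Y , Z ⟩ = weigh φ 0 X + weigh φ 0 Y + weigh φ 0 Z

lead : List Bool → ℕ
lead []           = 0
lead (true ∷ xs)  = 0
lead (false ∷ xs) = suc (lead xs)

-- The remainder `C φ` does not depend on `k`, so a change just in front of `xs` affects a single
-- term. Choosing `C` before `φ` lets one decomposition serve several weights at once.
weigh-lead : ∀ xs → Σ ((ℕ → ℕ) → ℕ) λ C → ∀ φ k → weigh φ k xs ≡ φ (k + lead xs) + C φ
weigh-lead []           = (λ _ → 0) , λ φ k → trans (cong φ (sym (+-identityʳ k))) (sym (+-identityʳ _))
weigh-lead (false ∷ xs) with weigh-lead xs
... | C , e = C , λ φ k → trans (e φ (suc k)) (cong (λ i → φ i + C φ) (sym (+-suc k (lead xs))))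
weigh-lead (true ∷ xs)  = (λ φ → weigh φ 0 xs) , λ φ k → cong (λ i → φ i + weigh φ 0 xs) (sym (+-identityʳ k))

-- The last run of the block stays open: `j` is the length of the run with which the list behind the
-- block begins.
weighBlock : (ℕ → ℕ) → ℕ → List Bool → ℕ → ℕ
weighBlock φ k []           j = φ (k + j)
weighBlock φ k (false ∷ xs) j = weighBlock φ (suc k) xs j
weighBlock φ k (true ∷ xs)  j = φ k + weighBlock φ 0 xs j

weigh-block : ∀ {φ j C} ys → (∀ k → weigh φ k ys ≡ φ (k + j) + C) →
              ∀ xs k → weigh φ k (xs ++ ys) ≡ weighBlock φ k xs j + C
weigh-block ys e []           k = e k
weigh-block ys e (false ∷ xs) k = weigh-block ys e xs (suc k)
weigh-block {φ} ys e (true ∷ xs)  k = trans (cong (φ k +_) (weigh-block ys e xs 0)) (sym (+-assoc (φ k) _ _))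

bits : List ℕ → List Bool
bits []       = []
bits (l ∷ ls) = replicate l false ++ true ∷ bits ls

weigh-false : ∀ φ l xs k → weigh φ k (replicate l false ++ xs) ≡ weigh φ (l + k) xs
weigh-false φ zero    xs k = refl
weigh-false φ (suc l) xs k = trans (weigh-false φ l xs (suc k)) (cong (λ i → weigh φ i xs) (+-suc l k))

weigh-bits : ∀ φ → φ 0 ≡ 0 → ∀ ls → weigh φ 0 (bits ls) ≡ sum (map φ ls)
weigh-bits φ e []       = e
weigh-bits φ e (l ∷ ls) = trans (weigh-false φ l (true ∷ bits ls) 0)
  (cong₂ _+_ (cong φ (+-identityʳ l)) (weigh-bits φ e ls))

Padded : Bool → List Bool → Set
Padded b []       = b ≡ true
Padded b (x ∷ xs) = Padded x xs

padded-true : ∀ {b} xs → Padded b xs → Padded true xs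
padded-true []       _ = refl
padded-true (x ∷ xs) p = p

padded-⇝ : ∀ {b xs ys} → xs ⇝ ys → Padded b xs → Padded b ys
padded-⇝ (here {xs = xs} _) p = padded-true xs p
padded-⇝ (there m)          p = padded-⇝ m p

padded-cover : ∀ {b} xs → Padded b xs → Padded b (cover xs)
padded-cover []       p = p
padded-cover (x ∷ xs) p = padded-true xs p

-- Behind an undominated entry the closing `true` is still to come, so the list is nonempty and its
-- first run absorbs that entry; behind a dominated entry the list may end. The induction passes
-- between the two versions.
parse : ∀ xs → (Padded true xs → ∃[ ls ] xs ≡ bits ls) × (Padded false xs → ∃[ l ] ∃[ ls ] xs ≡ bits (l ∷ ls))
parse [] = (λ _ → [] , refl) , λ ()
parse (true ∷ xs) = (λ p → let ls , e = proj₁ (parse xs) p in 0 ∷ ls , cong (true ∷_) e)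
                  , (λ p → let ls , e = proj₁ (parse xs) p in 0 , ls , cong (true ∷_) e)
parse (false ∷ xs) = (λ p → let l , ls , e = proj₂ (parse xs) p in suc l ∷ ls , cong (false ∷_) e)
                   , (λ p → let l , ls , e = proj₂ (parse xs) p in suc l , ls , cong (false ∷_) e)

prefix-⇝ : ∀ l {xs ys} → xs ⇝ ys → replicate l false ++ xs ⇝ replicate l false ++ ys
prefix-⇝ zero    m = m
prefix-⇝ (suc l) m = there (prefix-⇝ l m)

-- The equation says `R - L = B - A`; this replaces subtraction by a single ring identity.
from-≤ : ∀ {A B} L R → A ≤ B → L + B ≡ R + A → L ≤ R
from-≤ {A} {B} L R h e = +-cancelʳ-≤ B L R (≤-trans (≤-reflexive e) (+-monoʳ-≤ R h))

-- Upper bounds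

-- One move is worth 4. Taking three vertices from residue 3 frees 7, which with the least loss of 1
-- in Staller's move makes the 8 of two moves. Drops of 6 and 4 suffice only where rounding the
-- total to a multiple of 4 absorbs the difference.
cost : ℕ → ℕ
cost 0 = 0
cost 1 = 4
cost 2 = 6
cost 3 = 7
cost (suc (suc (suc (suc n)))) = 8 + cost n

cost-suc : ∀ n → cost n < cost (suc n)
cost-suc 0 = ≤ᵇ⇒≤ _ _ tt
cost-suc 1 = ≤ᵇ⇒≤ _ _ tt
cost-suc 2 = ≤ᵇ⇒≤ _ _ tt
cost-suc 3 = ≤ᵇ⇒≤ _ _ tt
cost-suc (suc (suc (suc (suc n)))) = +-monoʳ-< 8 (cost-suc n)

cost-2suc : ∀ n → cost n < cost (2 + n)
cost-2suc n = <-trans (cost-suc n) (cost-suc (suc n))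

-- A move inside a run cuts it into `i` and `j`; periodicity in both arguments leaves sixteen pairs
-- of residues.
cost-split : ∀ i j → cost i + cost j < cost (3 + i + j)
cost-split 0 0 = ≤ᵇ⇒≤ _ _ tt
cost-split 0 1 = ≤ᵇ⇒≤ _ _ tt
cost-split 0 2 = ≤ᵇ⇒≤ _ _ tt
cost-split 0 3 = ≤ᵇ⇒≤ _ _ tt
cost-split 1 0 = ≤ᵇ⇒≤ _ _ tt
cost-split 1 1 = ≤ᵇ⇒≤ _ _ tt
cost-split 1 2 = ≤ᵇ⇒≤ _ _ tt
cost-split 1 3 = ≤ᵇ⇒≤ _ _ tt
cost-split 2 0 = ≤ᵇ⇒≤ _ _ tt
cost-split 2 1 = ≤ᵇ⇒≤ _ _ tt
cost-split 2 2 = ≤ᵇ⇒≤ _ _ tt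
cost-split 2 3 = ≤ᵇ⇒≤ _ _ tt
cost-split 3 0 = ≤ᵇ⇒≤ _ _ tt
cost-split 3 1 = ≤ᵇ⇒≤ _ _ tt
cost-split 3 2 = ≤ᵇ⇒≤ _ _ tt
cost-split 3 3 = ≤ᵇ⇒≤ _ _ tt
cost-split 0 (suc (suc (suc (suc j)))) = +-monoʳ-< 8 (cost-split 0 j)
cost-split 1 (suc (suc (suc (suc j)))) = +-monoʳ-< 8 (cost-split 1 j)
cost-split 2 (suc (suc (suc (suc j)))) = +-monoʳ-< 8 (cost-split 2 j)
cost-split 3 (suc (suc (suc (suc j)))) = +-monoʳ-< 8 (cost-split 3 j)
cost-split (suc (suc (suc (suc i)))) j = +-monoʳ-< 8 (cost-split i j)

cost-block : ∀ a b d → a ∧ b ∧ d ≡ false → ∀ i j →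
          weighBlock cost i (true ∷ true ∷ true ∷ []) j < weighBlock cost i (a ∷ b ∷ d ∷ []) j
cost-block false false false _ i j = cost-split i j
cost-block false false true  _ i j = +-monoˡ-< (cost j) (cost-2suc i)
cost-block false true  false _ i j = +-mono-< (cost-suc i) (cost-suc j)
cost-block false true  true  _ i j = +-monoˡ-< (cost j) (cost-suc i)
cost-block true  false false _ i j = +-monoʳ-< (cost i) (cost-2suc j)
cost-block true  false true  _ i j = +-monoʳ-< (cost i) (m<n+m (cost j) {4} (s≤s z≤n))
cost-block true  true  false _ i j = +-monoʳ-< (cost i) (cost-suc j)

cost-⇝ : ∀ {xs ys} → xs ⇝ ys → ∀ k → weigh cost k ys < weigh cost k xs
cost-⇝ (here {a} {b} {d} {xs} nt) k with weigh-lead xs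
... | C , e = subst₂ _<_ (sym (weigh-block xs (e cost) (true ∷ true ∷ true ∷ []) k))
  (sym (weigh-block xs (e cost) (a ∷ b ∷ d ∷ []) k)) (+-monoˡ-< (C cost) (cost-block a b d nt k (lead xs)))
cost-⇝ (there {false} m) k = cost-⇝ m (suc k)
cost-⇝ (there {true} m)  k = +-monoʳ-< (cost k) (cost-⇝ m 0)

cost-cover< : ∀ X → top X ≡ false → weigh cost 0 (cover X) < weigh cost 0 X
cost-cover< (false ∷ xs) _ with weigh-lead xs
... | C , e rewrite e cost 0 | e cost 1 = +-monoˡ-< (C cost) (cost-suc (lead xs))

cost-cover : ∀ X → weigh cost 0 (cover X) ≤ weigh cost 0 X
cost-cover []           = ≤-refl
cost-cover (false ∷ xs) = <⇒≤ (cost-cover< (false ∷ xs) refl)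
cost-cover (true ∷ xs)  = ≤-refl

cost-arm : ∀ {c c′ X X′} → c ∷ X ⇝ c′ ∷ X′ → weigh cost 0 X′ ≤ weigh cost 0 X
-- The window starts at the centre, which carries no charge; reading the centre as dominated turns
-- the move into an instance of `cost-⇝`.
cost-arm (here {b = false} {d} {xs} _)    = <⇒≤ (cost-⇝ (here {true} {false} {d} {xs} refl) 0)
cost-arm (here {b = true} {false} {xs} _) = <⇒≤ (cost-⇝ (here {true} {true} {false} {xs} refl) 0)
cost-arm (here {b = true} {true} _)       = ≤-refl
cost-arm (there m)                        = <⇒≤ (cost-⇝ m 0)

data Padded₃ : Position → Set where
  padded₃ : ∀ {c X Y Z} → Padded true X → Padded true Y → Padded true Z → Padded₃ ⟨ c , X , Y , Z ⟩

padded-arm : ∀ {c c′ X X′} → c ∷ X ⇝ c′ ∷ X′ → Padded true X → Padded true X′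
padded-arm (here {xs = xs} _) p = padded-true xs p
padded-arm (there m)          p = padded-⇝ m p

padded₃-step : ∀ {s t} → s ⟶ t → Padded₃ s → Padded₃ t
padded₃-step (centre {X = X} {Y} {Z} _) (padded₃ x y z) =
  padded₃ (padded-cover X x) (padded-cover Y y) (padded-cover Z z)
padded₃-step (arm₁ m) (padded₃ x y z) = padded₃ (padded-arm m x) y z
padded₃-step (arm₂ m) (padded₃ x y z) = padded₃ x (padded-arm m y) z
padded₃-step (arm₃ m) (padded₃ x y z) = padded₃ x y (padded-arm m z)

step-centre : ∀ {s t} → s ⟶ t → centreOf s ≡ true → centreOf t ≡ true
step-centre (centre _)       e = refl
step-centre (arm₁ (here _))  e = refl
step-centre (arm₁ (there _)) e = e
step-centre (arm₂ (here _))  e = refl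
step-centre (arm₂ (there _)) e = e
step-centre (arm₃ (here _))  e = refl
step-centre (arm₃ (there _)) e = e

cost-step : ∀ {s t} → s ⟶ t → weight cost t ≤ weight cost s
cost-step (centre {c} {X} {Y} {Z} _) = +-mono-≤ (+-mono-≤ (cost-cover X) (cost-cover Y)) (cost-cover Z)
cost-step (arm₁ {Y = Y} {Z} m)       = +-monoˡ-≤ (weigh cost 0 Z) (+-monoˡ-≤ (weigh cost 0 Y) (cost-arm m))
cost-step (arm₂ {X = X} {Z = Z} m)   = +-monoˡ-≤ (weigh cost 0 Z) (+-monoʳ-≤ (weigh cost 0 X) (cost-arm m))
cost-step (arm₃ {X = X} {Y = Y} m)   = +-monoʳ-≤ (weigh cost 0 X + weigh cost 0 Y) (cost-arm m)

cost-arm< : ∀ {c′ X X′} → true ∷ X ⇝ c′ ∷ X′ → weigh cost 0 X′ < weigh cost 0 X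
cost-arm< m@(here _)  = cost-⇝ m 0
cost-arm< m@(there _) = cost-⇝ m 0

-- With the centre dominated, a move cannot gain the centre alone, so some arm vertex is gained and
-- its charge drops.
cost-step< : ∀ {s t} → s ⟶ t → centreOf s ≡ true → weight cost t < weight cost s
cost-step< (centre {X = X} {Y} {Z} e) refl = go (top X) (top Y) (top Z) refl refl refl e
  where
  go : ∀ x y z → top X ≡ x → top Y ≡ y → top Z ≡ z → x ∧ y ∧ z ≡ false →
       weigh cost 0 (cover X) + weigh cost 0 (cover Y) + weigh cost 0 (cover Z) < weigh cost 0 X + weigh cost 0 Y + weigh cost 0 Z
  go false y z ex ey ez _          = +-mono-<-≤ (+-mono-<-≤ (cost-cover< X ex) (cost-cover Y)) (cost-cover Z)
  go true false z ex ey ez _       = +-mono-<-≤ (+-mono-≤-< (cost-cover X) (cost-cover< Y ey)) (cost-cover Z)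
  go true true false ex ey ez _    = +-mono-≤-< (+-mono-≤ (cost-cover X) (cost-cover Y)) (cost-cover< Z ez)
cost-step< (arm₁ {Y = Y} {Z} m) refl       = +-monoˡ-< (weigh cost 0 Z) (+-monoˡ-< (weigh cost 0 Y) (cost-arm< m))
cost-step< (arm₂ {X = X} {Z = Z} m) refl   = +-monoˡ-< (weigh cost 0 Z) (+-monoʳ-< (weigh cost 0 X) (cost-arm< m))
cost-step< (arm₃ {X = X} {Y = Y} m) refl   = +-monoʳ-< (weigh cost 0 X + weigh cost 0 Y) (cost-arm< m)

-- Dominator's moves with the centre dominated

Taken : ℕ → List ℕ → List ℕ → Set
Taken r ls ls′ = sum (map cost ls′) + cost r ≡ sum (map cost ls) + cost (r ∸ 3)

-- The run is attacked at its near end. Runs of length 1 and 2 are swallowed whole by a window that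
-- begins with the dominated entry before them, which is why truncated subtraction describes the
-- result.
take-run : ∀ {r ls} → r ∈ ls → 1 ≤ r → ∃[ ls′ ] (true ∷ bits ls ⇝ true ∷ bits ls′ × Taken r ls ls′)
take-run {1} {_ ∷ ls} (here refl) _ = 0 ∷ 0 ∷ ls , here refl , trans (+-comm (sum (map cost ls)) 4) (sym (+-identityʳ _))
take-run {2} {_ ∷ ls} (here refl) _ = 0 ∷ 0 ∷ 0 ∷ ls , here refl , trans (+-comm (sum (map cost ls)) 6) (sym (+-identityʳ _))
take-run {suc (suc (suc m))} {_ ∷ ls} (here refl) _ =
  0 ∷ 0 ∷ 0 ∷ m ∷ ls , there (here refl) , lemma (cost m) (sum (map cost ls)) (cost (3 + m))
  where
  lemma : ∀ a s c → (a + s) + c ≡ (c + s) + a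
  lemma = solve-∀
take-run {r} {l ∷ ls} (there i) p with take-run i p
... | ls′ , m , e = l ∷ ls′ , there (prefix-⇝ l m) ,
  trans (+-assoc (cost l) _ _) (trans (cong (cost l +_) e) (sym (+-assoc (cost l) _ _)))

Drops : ℕ → List ℕ → Set
Drops δ ls = ∃[ r ] (r ∈ ls × 1 ≤ r × δ + cost (r ∸ 3) ≤ cost r)

data Best (ls : List ℕ) : Set where
  seven : Drops 7 ls → Best ls
  six   : 2 ∣ sum (map cost ls) → Drops 6 ls → Best ls
  four  : 4 ∣ sum (map cost ls) → Drops 4 ls → Best ls
  none  : sum (map cost ls) ≡ 0 → Best ls

data Class (r : ℕ) : Set where
  seven : 1 ≤ r → 7 + cost (r ∸ 3) ≤ cost r → Class r
  six   : 2 ∣ cost r → 1 ≤ r → 6 + cost (r ∸ 3) ≤ cost r → Class r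
  four  : 4 ∣ cost r → 1 ≤ r → 4 + cost (r ∸ 3) ≤ cost r → Class r
  none  : cost r ≡ 0 → Class r

-- Residue 3 is filed under `seven`, residue 2 under `six`, residue 1 and positive multiples of 4
-- under `four`; the actual drop may exceed the one recorded.
classify : ∀ r → Class r
classify 0 = none refl
classify 1 = four (divides 1 refl) (s≤s z≤n) (≤ᵇ⇒≤ _ _ tt)
classify 2 = six (divides 3 refl) (s≤s z≤n) (≤ᵇ⇒≤ _ _ tt)
classify 3 = seven (s≤s z≤n) (≤ᵇ⇒≤ _ _ tt)
classify 4 = four (divides 2 refl) (s≤s z≤n) (≤ᵇ⇒≤ _ _ tt)
classify 5 = four (divides 3 refl) (s≤s z≤n) (≤ᵇ⇒≤ _ _ tt)
classify 6 = six (divides 7 refl) (s≤s z≤n) (≤ᵇ⇒≤ _ _ tt)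
-- Periodicity of the drop starts at length 3, where `r ∸ 3` no longer truncates; hence seven base
-- cases.
classify (suc (suc (suc (suc r@(suc (suc (suc n))))))) with classify r
... | seven p h   = seven (s≤s z≤n) (+-monoʳ-≤ 8 h)
... | six e p h   = six (∣m∣n⇒∣m+n (divides 4 refl) e) (s≤s z≤n) (+-monoʳ-≤ 8 h)
... | four e p h  = four (∣m∣n⇒∣m+n (divides 2 refl) e) (s≤s z≤n) (+-monoʳ-≤ 8 h)
... | none e      = ⊥-elim (n≮0 (subst (0 <_) e (≤-<-trans z≤n (cost-suc (2 + n)))))

-- A smaller drop always comes with the divisibility that makes it sufficient: without residue 3 the
-- total is even, and without residues 2 and 3 it is a multiple of 4.
best : ∀ ls → Best ls
best [] = none refl
best (r ∷ ls) = combine (classify r) (best ls)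
  where
  later : ∀ {δ} → Drops δ ls → Drops δ (r ∷ ls)
  later (r′ , i , h) = r′ , there i , h
  even : 4 ∣ sum (map cost ls) → 2 ∣ sum (map cost ls)
  even = ∣-trans (divides 2 refl)
  zero-even : ∀ {n k} → n ≡ 0 → k ∣ n
  zero-even refl = _ ∣0
  combine : Class r → Best ls → Best (r ∷ ls)
  combine (seven p h)  _          = seven (r , here refl , p , h)
  combine _            (seven d)  = seven (later d)
  combine (six e p h)  (six f _)  = six (∣m∣n⇒∣m+n e f) (r , here refl , p , h)
  combine (six e p h)  (four f _) = six (∣m∣n⇒∣m+n e (even f)) (r , here refl , p , h)
  combine (six e p h)  (none f)   = six (∣m∣n⇒∣m+n e (zero-even f)) (r , here refl , p , h)
  combine (four e p h) (six f d)  = six (∣m∣n⇒∣m+n (∣-trans (divides 2 refl) e) f) (later d)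
  combine (four e p h) (four f _) = four (∣m∣n⇒∣m+n e f) (r , here refl , p , h)
  combine (four e p h) (none f)   = four (∣m∣n⇒∣m+n e (zero-even f)) (r , here refl , p , h)
  combine (none e)     (six f d)  = six (∣m∣n⇒∣m+n (zero-even e) f) (later d)
  combine (none e)     (four f d) = four (∣m∣n⇒∣m+n (zero-even e) f) (later d)
  combine (none e)     (none f)   = none (trans (cong (_+ sum (map cost ls)) e) f)

even-bound : ∀ {Q} b → 2 ∣ Q → Q ≤ 4 * b + 3 → Q ≤ 4 * b + 2
even-bound b (divides k refl) h = ≤-trans (*-monoˡ-≤ 2 (≤-pred (*-cancelʳ-< 2 k (2 + 2 * b) lt))) (≤-reflexive (e₂ b))
  where
  e₁ : ∀ b → 1 + (4 * b + 3) ≡ (2 + 2 * b) * 2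
  e₁ = solve-∀
  e₂ : ∀ b → (1 + 2 * b) * 2 ≡ 4 * b + 2
  e₂ = solve-∀
  lt : k * 2 < (2 + 2 * b) * 2
  lt = subst (k * 2 <_) (e₁ b) (s≤s h)

quad-bound : ∀ {Q} b → 4 ∣ Q → Q ≤ 4 * b + 3 → Q ≤ 4 * b
quad-bound b (divides k refl) h = ≤-trans (*-monoˡ-≤ 4 (≤-pred (*-cancelʳ-< 4 k (1 + b) lt))) (≤-reflexive (*-comm b 4))
  where
  e₁ : ∀ b → 1 + (4 * b + 3) ≡ (1 + b) * 4
  e₁ = solve-∀
  lt : k * 4 < (1 + b) * 4
  lt = subst (k * 4 <_) (e₁ b) (s≤s h)

bits-cost : ∀ ls → weigh cost 0 (bits ls) ≡ sum (map cost ls)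
bits-cost = weigh-bits cost refl

taken-drop : ∀ {δ r} ls ls′ → Taken r ls ls′ → δ + cost (r ∸ 3) ≤ cost r → δ + weigh cost 0 (bits ls′) ≤ weigh cost 0 (bits ls)
taken-drop {δ} {r} ls ls′ e h rewrite bits-cost ls | bits-cost ls′ = from-≤ (δ + sum (map cost ls′)) (sum (map cost ls)) h
  (trans (+-assoc δ _ _) (trans (cong (δ +_) e) (lemma δ (sum (map cost ls)) (cost (r ∸ 3)))))
  where
  lemma : ∀ δ v b → δ + (v + b) ≡ v + (δ + b)
  lemma = solve-∀

sum-map-++₃ : ∀ (φ : ℕ → ℕ) xs ys zs → sum (map φ (xs ++ ys ++ zs)) ≡ sum (map φ xs) + sum (map φ ys) + sum (map φ zs)
sum-map-++₃ φ xs ys zs = begin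
  sum (map φ (xs ++ ys ++ zs))                              ≡⟨ two xs (ys ++ zs) ⟩
  sum (map φ xs) + sum (map φ (ys ++ zs))                   ≡⟨ cong (sum (map φ xs) +_) (two ys zs) ⟩
  sum (map φ xs) + (sum (map φ ys) + sum (map φ zs))        ≡⟨ sym (+-assoc (sum (map φ xs)) _ _) ⟩
  sum (map φ xs) + sum (map φ ys) + sum (map φ zs)          ∎
  where
  open ≡-Reasoning
  two : ∀ xs ys → sum (map φ (xs ++ ys)) ≡ sum (map φ xs) + sum (map φ ys)
  two xs ys = trans (cong sum (map-++ φ xs ys)) (sum-++ (map φ xs) (map φ ys))

∈-++₃ : ∀ {r : ℕ} xs ys {zs} → r ∈ xs ++ ys ++ zs → r ∈ xs ⊎ r ∈ ys ⊎ r ∈ zs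
∈-++₃ xs ys i with ∈-++⁻ xs i
... | inj₁ j = inj₁ j
... | inj₂ j = inj₂ (∈-++⁻ ys j)

drop-arm₁ : ∀ δ {a′ a} b c → δ + a′ ≤ a → δ + (a′ + b + c) ≤ a + b + c
drop-arm₁ δ {a′} b c h = ≤-trans (≤-reflexive (lemma δ a′ b c)) (+-monoˡ-≤ c (+-monoˡ-≤ b h))
  where
  lemma : ∀ δ a b c → δ + (a + b + c) ≡ δ + a + b + c
  lemma = solve-∀

drop-arm₂ : ∀ δ {a′ a} b c → δ + a′ ≤ a → δ + (b + a′ + c) ≤ b + a + c
drop-arm₂ δ {a′} b c h = ≤-trans (≤-reflexive (lemma δ a′ b c)) (+-monoˡ-≤ c (+-monoʳ-≤ b h))
  where
  lemma : ∀ δ a b c → δ + (b + a + c) ≡ b + (δ + a) + c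
  lemma = solve-∀

drop-arm₃ : ∀ δ {a′ a} b c → δ + a′ ≤ a → δ + (b + c + a′) ≤ b + c + a
drop-arm₃ δ {a′} b c h = ≤-trans (≤-reflexive (lemma δ a′ b c)) (+-monoʳ-≤ (b + c) h)
  where
  lemma : ∀ δ a b c → δ + (b + c + a) ≡ b + c + (δ + a)
  lemma = solve-∀

flat-take : ∀ xs ys zs {δ} → Drops δ (xs ++ ys ++ zs) →
  ∃[ t ] (⟨ true , bits xs , bits ys , bits zs ⟩ ⟶ t × δ + weight cost t ≤ weight cost ⟨ true , bits xs , bits ys , bits zs ⟩)
flat-take xs ys zs {δ} (r , i , p , h) with ∈-++₃ xs ys i
... | inj₁ j with take-run j p
...   | xs′ , m , e = _ , arm₁ m , drop-arm₁ δ (weigh cost 0 (bits ys)) (weigh cost 0 (bits zs)) (taken-drop {r = r} xs xs′ e h)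
flat-take xs ys zs {δ} (r , i , p , h) | inj₂ (inj₁ j) with take-run j p
...   | ys′ , m , e = _ , arm₂ m , drop-arm₂ δ (weigh cost 0 (bits xs)) (weigh cost 0 (bits zs)) (taken-drop {r = r} ys ys′ e h)
flat-take xs ys zs {δ} (r , i , p , h) | inj₂ (inj₂ j) with take-run j p
...   | zs′ , m , e = _ , arm₃ m , drop-arm₃ δ (weigh cost 0 (bits xs)) (weigh cost 0 (bits ys)) (taken-drop {r = r} zs zs′ e h)

drop7 : ∀ {u v} b → 7 + u ≤ v → v ≤ 4 * b + 3 → u + 4 ≤ 4 * b
drop7 {u} b h k = from-≤ (u + 4) (4 * b) (≤-trans h k) (lemma u (4 * b))
  where
  lemma : ∀ u c → u + 4 + (c + 3) ≡ c + (7 + u)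
  lemma = solve-∀

drop6 : ∀ {u v} b → 6 + u ≤ v → v ≤ 4 * b + 2 → u + 4 ≤ 4 * b
drop6 {u} b h k = from-≤ (u + 4) (4 * b) (≤-trans h k) (lemma u (4 * b))
  where
  lemma : ∀ u c → u + 4 + (c + 2) ≡ c + (6 + u)
  lemma = solve-∀

drop4 : ∀ {u v} b → 4 + u ≤ v → v ≤ 4 * b → u + 4 ≤ 4 * b
drop4 {u} b h k = ≤-trans (≤-reflexive (+-comm u 4)) (≤-trans h k)

four-suc : ∀ {u} b → u + 4 ≤ 4 * suc b → u ≤ 4 * b
four-suc {u} b h = +-cancelʳ-≤ 4 u (4 * b) (≤-trans h (≤-reflexive (trans (*-suc 4 b) (+-comm 4 (4 * b)))))

-- A bound of the form `u + 4 ≤ 4 * b` says both that a move is left and that the charge `u` fits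
-- into the moves after it.
four-pos : ∀ {u} b → u + 4 ≤ 4 * b → ∃[ b′ ] b ≡ suc b′
four-pos {u} zero h = ⊥-elim (n≮0 (≤-trans (≤-trans (s≤s z≤n) (m≤n+m 4 u)) h))
four-pos (suc b) h = b , refl

flat-move : ∀ b X Y Z → Padded₃ ⟨ true , X , Y , Z ⟩ → weight cost ⟨ true , X , Y , Z ⟩ ≤ 4 * b + 3 →
  weight cost ⟨ true , X , Y , Z ⟩ ≡ 0 ⊎ ∃[ t ] (⟨ true , X , Y , Z ⟩ ⟶ t × weight cost t + 4 ≤ 4 * b)
flat-move b X Y Z (padded₃ x y z) h with proj₁ (parse X) x | proj₁ (parse Y) y | proj₁ (parse Z) z
... | xs , refl | ys , refl | zs , refl = pick (best (xs ++ ys ++ zs))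
  where
  w = weight cost ⟨ true , bits xs , bits ys , bits zs ⟩
  w-sum : sum (map cost (xs ++ ys ++ zs)) ≡ w
  w-sum = trans (sum-map-++₃ cost xs ys zs) (sym (cong₂ _+_ (cong₂ _+_ (bits-cost xs) (bits-cost ys)) (bits-cost zs)))
  pick : Best (xs ++ ys ++ zs) → w ≡ 0 ⊎ ∃[ t ] (⟨ true , bits xs , bits ys , bits zs ⟩ ⟶ t × weight cost t + 4 ≤ 4 * b)
  pick (seven d) with flat-take xs ys zs d
  ... | t , m , k = inj₂ (t , m , drop7 b k h)
  pick (six e d) with flat-take xs ys zs d
  ... | t , m , k = inj₂ (t , m , drop6 b k (even-bound b (subst (2 ∣_) w-sum e) h))
  pick (four e d) with flat-take xs ys zs d
  ... | t , m , k = inj₂ (t , m , drop4 b k (quad-bound b (subst (4 ∣_) w-sum e) h))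
  pick (none e) = inj₁ (trans (sym w-sum) e)

Flat : Position → Set
Flat s = centreOf s ≡ true × Padded₃ s

flat-step : ∀ {s t} → s ⟶ t → Flat s → Flat t
flat-step m (c , p) = step-centre m c , padded₃-step m p

flat-end : ∀ {s} → Flat s → weight cost s ≡ 0 → ∀ t → ¬ (s ⟶ t)
flat-end (c , _) e t m = n≮0 (subst (weight cost t <_) e (cost-step< m c))

-- The remainder 3 granted on Dominator's turn matches Staller's loss of at least 1: `4 * suc b`
-- minus 1 is `4 * b + 3`.
flatD : ∀ b {s} → Flat s → weight cost s ≤ 4 * b + 3 → AtMostD b s
flatS : ∀ b {s} → Flat s → weight cost s ≤ 4 * b → AtMostS b s
flatD b {⟨ true , X , Y , Z ⟩} F@(refl , p) h with flat-move b X Y Z p h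
flatD zero    F h | inj₁ e = flat-end F e
flatD (suc b) F h | inj₁ e = inj₁ (flat-end F e)
flatD b F h | inj₂ (t , m , k) with four-pos b k
... | b , refl = inj₂ (t , m , flatS b (flat-step m F) (four-suc b k))
flatS zero    F h = flat-end F (n≤0⇒n≡0 h)
flatS (suc b) {s} F@(c , _) h t m = flatD b (flat-step m F) (≤-pred (≤-trans (cost-step< m c) (≤-trans h (≤-reflexive (lemma b)))))
  where
  lemma : ∀ b → 4 * suc b ≡ suc (4 * b + 3)
  lemma = solve-∀

-- Dominator's moves with the centre undominated

cost-4* : ∀ x → cost (4 * x) ≡ 8 * x
cost-4* zero = refl
cost-4* (suc x) = trans (cong cost (*-suc 4 x)) (trans (cong (8 +_) (cost-4* x)) (sym (*-suc 8 x)))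

cost-3+4* : ∀ x → cost (3 + 4 * x) ≡ 7 + 8 * x
cost-3+4* zero = refl
cost-3+4* (suc x) = trans (cong (λ m → cost (3 + m)) (*-suc 4 x)) (trans (cong (8 +_) (cost-3+4* x)) (cong (7 +_) (sym (*-suc 8 x))))

lead-bits : ∀ l ls → lead (bits (l ∷ ls)) ≡ l
lead-bits zero    ls = refl
lead-bits (suc l) ls = cong suc (lead-bits l ls)

suc-≢-4* : ∀ {k} x → suc k ≡ 4 * x → ∃[ y ] k ≡ 3 + 4 * y
suc-≢-4* (suc x) e = x , suc-injective (trans e (*-suc 4 x))

cost-pred-2 : ∀ k x → 2 + k ≡ 4 * x → cost (k ∸ 1) + 4 ≤ cost (2 + k)
cost-pred-2 k (suc x) e with suc-injective (suc-injective (trans e (*-suc 4 x)))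
... | refl = go x
  where
  go : ∀ x → cost (1 + 4 * x) + 4 ≤ 8 + cost (4 * x)
  go zero = ≤ᵇ⇒≤ _ _ tt
  go (suc x) rewrite *-suc 4 x = +-monoʳ-≤ 8 (go x)

-- Cutting a multiple of 4 in two raises the charge by at most one move; residues 2 and 2 attain
-- this, residues 1 and 3 give 11 against 12.
cost-pair : ∀ i j x → i + j ≡ 4 * x → cost i + cost j ≤ 4 + cost (i + j)
cost-pair 0 j x e = m≤n+m (cost j) 4
cost-pair 1 0 x e = ≤ᵇ⇒≤ _ _ tt
cost-pair 1 1 (suc x) e with () ← trans e (*-suc 4 x)
cost-pair 1 2 (suc x) e with () ← trans e (*-suc 4 x)
cost-pair 1 3 x e = ≤ᵇ⇒≤ _ _ tt
cost-pair 2 0 x e = ≤ᵇ⇒≤ _ _ tt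
cost-pair 2 1 (suc x) e with () ← trans e (*-suc 4 x)
cost-pair 2 2 x e = ≤ᵇ⇒≤ _ _ tt
cost-pair 2 3 (suc (suc x)) e with () ← trans e (trans (*-suc 4 (suc x)) (cong (4 +_) (*-suc 4 x)))
cost-pair 2 3 1 ()
cost-pair 3 0 x e = ≤ᵇ⇒≤ _ _ tt
cost-pair 3 1 x e = ≤ᵇ⇒≤ _ _ tt
cost-pair 3 2 (suc (suc x)) e with () ← trans e (trans (*-suc 4 (suc x)) (cong (4 +_) (*-suc 4 x)))
cost-pair 3 2 1 ()
cost-pair 3 3 (suc (suc x)) e with () ← trans e (trans (*-suc 4 (suc x)) (cong (4 +_) (*-suc 4 x)))
cost-pair 3 3 1 ()
cost-pair 1 (suc (suc (suc (suc j)))) (suc x) e =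
  +-monoʳ-≤ 8 (cost-pair 1 j x (+-cancelˡ-≡ 4 _ _ (trans e (*-suc 4 x))))
cost-pair 2 (suc (suc (suc (suc j)))) (suc x) e =
  +-monoʳ-≤ 8 (cost-pair 2 j x (+-cancelˡ-≡ 4 _ _ (trans e (*-suc 4 x))))
cost-pair 3 (suc (suc (suc (suc j)))) (suc x) e =
  +-monoʳ-≤ 8 (cost-pair 3 j x (+-cancelˡ-≡ 4 _ _ (trans e (*-suc 4 x))))
cost-pair (suc (suc (suc (suc i)))) j (suc x) e =
  +-monoʳ-≤ 8 (cost-pair i j x (+-cancelˡ-≡ 4 _ _ (trans e (*-suc 4 x))))

-- This counts a cut by Staller together with the reply at the centre, which takes one more vertex
-- off the part `k`. For positive `k` the parts `k ∸ 1` and `l` again add up to a multiple of 4, so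
-- `cost-pair` applies.
cost-split-4* : ∀ k l x → 3 + k + l ≡ 4 * x → cost l + cost (k ∸ 1) + 4 ≤ cost (3 + k + l)
cost-split-4* zero l (suc x) e with suc-injective (suc-injective (suc-injective (trans e (*-suc 4 x))))
... | refl = go x
  where
  go : ∀ x → cost (1 + 4 * x) + 0 + 4 ≤ 8 + cost (4 * x)
  go zero = ≤ᵇ⇒≤ _ _ tt
  go (suc x) rewrite *-suc 4 x = +-monoʳ-≤ 8 (go x)
cost-split-4* (suc k) l (suc x) e =
  ≤-trans (≤-reflexive (lemma (cost l) (cost k))) (+-monoʳ-≤ 4 (cost-pair k l x (+-cancelˡ-≡ 4 _ _ (trans e (*-suc 4 x)))))
  where
  lemma : ∀ a b → a + b + 4 ≡ 4 + (b + a)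
  lemma = solve-∀

-- The effect on a run of length 4m next to an undominated centre when Staller
-- leaves k of its vertices there, the cost of the arm dropping from x to y. If the
-- run is broken, Dominator plays the centre; the term cost (k ∸ 1) accounts for this.
data Shortened (k x y : ℕ) : Set where
  whole  : ∀ m → k ≡ 4 * m → Shortened k x y
  bitten : ∀ m → k ≡ 3 + 4 * m → Shortened k x y
  broken : y + cost (k ∸ 1) + 4 ≤ x + cost k → Shortened k x y

-- The cases are the number of vertices in which the window meets the run beside the centre: none is
-- `whole`, its last vertex alone is `bitten`, two or three are `broken`.
shorten : ∀ {xs ys} → xs ⇝ ys → ∀ k m → k + lead xs ≡ 4 * m → Shortened (k + lead ys) (weigh cost k xs) (weigh cost k ys)
shorten (here {true} _) k m e = whole m e
shorten (here {false} {true} _) k m e rewrite +-identityʳ k =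
  let y , f = suc-≢-4* m (trans (+-comm 1 k) e) in bitten y f
shorten (here {false} {false} {true} {xs} _) k m e rewrite +-identityʳ k =
  broken (≤-trans (≤-reflexive (lemma (cost k) (weigh cost 0 xs) (cost (k ∸ 1))))
    (≤-trans (+-monoˡ-≤ (cost k + weigh cost 0 xs) (cost-pred-2 k m (trans (+-comm 2 k) e)))
             (≤-reflexive (lemma′ (cost (2 + k)) (cost k) (weigh cost 0 xs)))))
  where
  lemma : ∀ a w c → a + w + c + 4 ≡ c + 4 + (a + w)
  lemma = solve-∀
  lemma′ : ∀ b a w → b + (a + w) ≡ b + w + a
  lemma′ = solve-∀
shorten (here {false} {false} {false} {xs} _) k m e with weigh-lead xs
... | C , w rewrite w cost 0 | w cost (3 + k) | +-identityʳ k =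
  broken (≤-trans (≤-reflexive (lemma (cost k) (cost (lead xs)) (C cost) (cost (k ∸ 1))))
    (≤-trans (+-monoˡ-≤ (cost k + C cost) (cost-split-4* k (lead xs) m (trans (arith k (lead xs)) e)))
             (≤-reflexive (lemma′ (cost (3 + k + lead xs)) (cost k) (C cost)))))
  where
  arith : ∀ k l → 3 + k + l ≡ k + (3 + l)
  arith = solve-∀
  lemma : ∀ a l c d → a + (l + c) + d + 4 ≡ l + d + 4 + (a + c)
  lemma = solve-∀
  lemma′ : ∀ b a w → b + (a + w) ≡ b + w + a
  lemma′ = solve-∀
shorten (there {true} m) k x e = whole x e
shorten (there {false} {xs} {ys} m) k x e with shorten m (suc k) x (trans (sym (+-suc k (lead xs))) e)
... | whole y f  = whole y (trans (+-suc k (lead ys)) f)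
... | bitten y f = bitten y (trans (+-suc k (lead ys)) f)
... | broken h rewrite +-suc k (lead ys) = broken h

weigh-cover : ∀ φ → φ 0 ≡ 0 → ∀ X → weigh φ 0 (cover X) + φ (lead X) ≡ weigh φ 0 X + φ (lead X ∸ 1)
weigh-cover φ z [] = refl
weigh-cover φ z (true ∷ xs) = refl
weigh-cover φ z (false ∷ xs) with weigh-lead xs
... | C , e rewrite e φ 0 | e φ 1 | z = lemma (φ (lead xs)) (C φ) (φ (suc (lead xs)))
  where
  lemma : ∀ a c b → a + c + b ≡ b + c + a
  lemma = solve-∀

data Star : Position → Set where
  star : ∀ x xs y ys z zs → Star ⟨ false , bits (4 * x ∷ xs) , bits (4 * y ∷ ys) , bits (4 * z ∷ zs) ⟩

padded-bits-∷ : ∀ b l ls → Padded b (bits (l ∷ ls))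
padded-bits   : ∀ ls → Padded true (bits ls)
padded-bits-∷ b zero    ls = padded-bits ls
padded-bits-∷ b (suc l) ls = padded-bits-∷ false l ls
padded-bits []       = refl
padded-bits (l ∷ ls) = padded-bits-∷ true l ls

star-padded : ∀ {s} → Star s → Padded₃ s
star-padded (star x xs y ys z zs) = padded₃ (padded-bits (4 * x ∷ xs)) (padded-bits (4 * y ∷ ys)) (padded-bits (4 * z ∷ zs))

play-centre : Position → Position
play-centre ⟨ c , X , Y , Z ⟩ = ⟨ true , cover X , cover Y , cover Z ⟩

taken-drop-∷ : ∀ {δ r} l ls ls′ → Taken r ls ls′ → δ + cost (r ∸ 3) ≤ cost r →
               δ + weigh cost 0 (bits (l ∷ ls′)) ≤ weigh cost 0 (bits (l ∷ ls))
taken-drop-∷ {r = r} l ls ls′ e = taken-drop {r = r} (l ∷ ls) (l ∷ ls′)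
  (trans (+-assoc (cost l) _ _) (trans (cong (cost l +_) e) (sym (+-assoc (cost l) _ _))))

star-take : ∀ x xs y ys z zs {δ} → Drops δ (xs ++ ys ++ zs) →
  let s = ⟨ false , bits (4 * x ∷ xs) , bits (4 * y ∷ ys) , bits (4 * z ∷ zs) ⟩ in
  ∃[ t ] (s ⟶ t × Star t × δ + weight cost t ≤ weight cost s)
star-take x xs y ys z zs {δ} (r , i , p , h) with ∈-++₃ xs ys i
... | inj₁ j with take-run j p
...   | xs′ , m , e = _ , arm₁ (there (prefix-⇝ (4 * x) m)) , star x xs′ y ys z zs ,
  drop-arm₁ δ (weigh cost 0 (bits (4 * y ∷ ys))) (weigh cost 0 (bits (4 * z ∷ zs))) (taken-drop-∷ {r = r} (4 * x) xs xs′ e h)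
star-take x xs y ys z zs {δ} (r , i , p , h) | inj₂ (inj₁ j) with take-run j p
...   | ys′ , m , e = _ , arm₂ (there (prefix-⇝ (4 * y) m)) , star x xs y ys′ z zs ,
  drop-arm₂ δ (weigh cost 0 (bits (4 * x ∷ xs))) (weigh cost 0 (bits (4 * z ∷ zs))) (taken-drop-∷ {r = r} (4 * y) ys ys′ e h)
star-take x xs y ys z zs {δ} (r , i , p , h) | inj₂ (inj₂ j) with take-run j p
...   | zs′ , m , e = _ , arm₃ (there (prefix-⇝ (4 * z) m)) , star x xs y ys z zs′ ,
  drop-arm₃ δ (weigh cost 0 (bits (4 * x ∷ xs))) (weigh cost 0 (bits (4 * y ∷ ys))) (taken-drop-∷ {r = r} (4 * z) zs zs′ e h)

star-move : ∀ b {s} → Star s → weight cost s + 4 ≤ 4 * b + 3 →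
  weight cost s + 4 ≤ 4 * b ⊎ ∃[ t ] (s ⟶ t × Star t × weight cost t + 4 + 4 ≤ 4 * b)
star-move b (star x xs y ys z zs) h = pick (best (xs ++ ys ++ zs))
  where
  s = ⟨ false , bits (4 * x ∷ xs) , bits (4 * y ∷ ys) , bits (4 * z ∷ zs) ⟩
  tails = sum (map cost (xs ++ ys ++ zs))
  w-sum : tails + 4 * (1 + 2 * (x + y + z)) ≡ weight cost s + 4
  w-sum rewrite sum-map-++₃ cost xs ys zs | bits-cost (4 * x ∷ xs) | bits-cost (4 * y ∷ ys) | bits-cost (4 * z ∷ zs)
              | cost-4* x | cost-4* y | cost-4* z = lemma (sum (map cost xs)) (sum (map cost ys)) (sum (map cost zs)) x y z
    where
    lemma : ∀ a b c x y z → a + b + c + 4 * (1 + 2 * (x + y + z)) ≡ 8 * x + a + (8 * y + b) + (8 * z + c) + 4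
    lemma = solve-∀
  divisible : 4 ∣ tails → 4 ∣ weight cost s + 4
  divisible e = subst (4 ∣_) w-sum (∣m∣n⇒∣m+n e (m∣m*n (1 + 2 * (x + y + z))))
  even : 2 ∣ tails → 2 ∣ weight cost s + 4
  even e = subst (2 ∣_) w-sum (∣m∣n⇒∣m+n e (∣-trans (divides 2 refl) (m∣m*n (1 + 2 * (x + y + z)))))
  pick : Best (xs ++ ys ++ zs) → weight cost s + 4 ≤ 4 * b ⊎ ∃[ t ] (s ⟶ t × Star t × weight cost t + 4 + 4 ≤ 4 * b)
  pick (seven d) with star-take x xs y ys z zs d
  ... | t , m , T , k = inj₂ (t , m , T , drop7 b (+-monoˡ-≤ 4 k) h)
  pick (six e d) with star-take x xs y ys z zs d
  ... | t , m , T , k = inj₂ (t , m , T , drop6 b (+-monoˡ-≤ 4 k) (even-bound b (even e) h))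
  pick (four e d) = inj₁ (quad-bound b (divisible e) h)
  pick (none e)   = inj₁ (quad-bound b (divisible (subst (4 ∣_) (sym e) (4 ∣0))) h)

flat-cover : ∀ {c X Y Z} → Padded₃ ⟨ c , X , Y , Z ⟩ → Flat ⟨ true , cover X , cover Y , cover Z ⟩
flat-cover {X = X} {Y} {Z} (padded₃ x y z) = refl , padded₃ (padded-cover X x) (padded-cover Y y) (padded-cover Z z)

starD : ∀ b {s} → Star s → weight cost s + 4 ≤ 4 * b + 3 → AtMostD b s
starS : ∀ b {s} → Star s → weight cost s + 4 ≤ 4 * b → AtMostS b s
-- The bound is on the charge before Staller's move, so that her loss and the gain of Dominator's
-- reply are counted together.
star-reply : ∀ b x xs y ys z zs {X′} →
  let s = ⟨ false , bits (4 * x ∷ xs) , bits (4 * y ∷ ys) , bits (4 * z ∷ zs) ⟩ in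
  bits (4 * x ∷ xs) ⇝ X′ → weight cost s ≤ 4 * b →
  AtMostD b ⟨ false , X′ , bits (4 * y ∷ ys) , bits (4 * z ∷ zs) ⟩

starD b {s} S h with star-move b S h
starD b S h | inj₂ (t , m , T , k) with four-pos b k
... | b , refl = inj₂ (t , m , starS b T (four-suc b k))
-- No tail offers a drop of 7 or 6, so the total is a multiple of 4 and rounds down. The extra
-- charge 4 pays for playing the centre.
starD b S@(star x xs y ys z zs) h | inj₁ k with four-pos b k
... | b , refl = inj₂ (_ , m , flatS b (flat-cover (star-padded S)) (≤-trans (cost-step m) (four-suc b k)))
  where
  m : ⟨ false , bits (4 * x ∷ xs) , bits (4 * y ∷ ys) , bits (4 * z ∷ zs) ⟩ ⟶ _
  m = centre refl

starS zero    S h = ⊥-elim (n≮0 (≤-trans (≤-trans (s≤s z≤n) (m≤n+m 4 _)) h))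
starS (suc b) S@(star x xs y ys z zs) h _ = go
  where
  s = ⟨ false , bits (4 * x ∷ xs) , bits (4 * y ∷ ys) , bits (4 * z ∷ zs) ⟩
  k : weight cost s ≤ 4 * b
  k = four-suc b h
  u = weigh cost 0 (bits (4 * x ∷ xs))
  v = weigh cost 0 (bits (4 * y ∷ ys))
  w = weigh cost 0 (bits (4 * z ∷ zs))
  flat : ∀ {t} → s ⟶ t → Flat t → AtMostD b t
  flat m F = flatD b F (≤-trans (cost-step {s} m) (≤-trans k (m≤m+n _ 3)))
  swapped₁₂ : ∀ u v w → u + v + w ≡ v + u + w
  swapped₁₂ u v w = cong (_+ w) (+-comm u v)
  swapped₁₃ : ∀ u v w → u + v + w ≡ w + v + u
  swapped₁₃ = solve-∀
  go : ∀ {t} → s ⟶ t → AtMostD b t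
  go m@(centre _) = flat m (refl , padded₃-step m (star-padded S))
  go m@(arm₁ n) with arm-move n
  ... | inj₁ (refl , _)   = flat m (refl , padded₃-step m (star-padded S))
  ... | inj₂ (refl , n) = star-reply b x xs y ys z zs n k
  go m@(arm₂ n) with arm-move n
  ... | inj₁ (refl , _)   = flat m (refl , padded₃-step m (star-padded S))
  ... | inj₂ (refl , n) = Swap₁₂.σ-AtMostD b (star-reply b y ys x xs z zs n (subst (_≤ 4 * b) (swapped₁₂ u v w) k))
  go m@(arm₃ n) with arm-move n
  ... | inj₁ (refl , _)   = flat m (refl , padded₃-step m (star-padded S))
  ... | inj₂ (refl , n) = Swap₁₃.σ-AtMostD b (star-reply b z zs y ys x xs n (subst (_≤ 4 * b) (swapped₁₃ u v w) k))

star-reply b x xs y ys z zs {X′} m k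
  with proj₂ (parse X′) (padded-⇝ m (padded-bits-∷ false (4 * x) xs)) | cost-⇝ m 0 | shorten m 0 x (lead-bits (4 * x) xs)
... | l , ls , refl | lt | short rewrite lead-bits l ls = reply short
  where
  Y = bits (4 * y ∷ ys)
  Z = bits (4 * z ∷ zs)
  u = weigh cost 0 Y
  v = weigh cost 0 Z
  reply : Shortened l (weigh cost 0 (bits (4 * x ∷ xs))) (weigh cost 0 (bits (l ∷ ls))) → AtMostD b ⟨ false , bits (l ∷ ls) , Y , Z ⟩
  reply (whole m refl) = starD b (star m ls y ys z zs) (≤-trans (≤-reflexive (lemma (weigh cost 0 (bits (l ∷ ls)) + u + v)))
    (+-monoˡ-≤ 3 (≤-trans (drop-arm₁ 1 u v lt) k)))
    where
    lemma : ∀ w → w + 4 ≡ 1 + w + 3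
    lemma = solve-∀
  -- Dominator takes the three vertices nearest to the centre, leaving a run of length 0 beside it.
  -- The 7 gained and Staller's 1 are worth two moves.
  reply (bitten m refl) = finish (four-pos {weight cost t + 4} b bound)
    where
    t = ⟨ false , bits (0 ∷ 0 ∷ 0 ∷ 4 * m ∷ ls) , Y , Z ⟩
    seven-off : 7 + weigh cost 0 (bits (0 ∷ 0 ∷ 0 ∷ 4 * m ∷ ls)) ≤ weigh cost 0 (bits (3 + 4 * m ∷ ls))
    seven-off rewrite bits-cost (3 + 4 * m ∷ ls) | bits-cost (4 * m ∷ ls) | cost-3+4* m | cost-4* m = ≤-refl
    bound : weight cost t + 4 + 4 ≤ 4 * b
    bound = ≤-trans (≤-reflexive (lemma (weight cost t)))
      (≤-trans (s≤s (drop-arm₁ 7 u v seven-off)) (≤-trans (drop-arm₁ 1 u v lt) k))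
      where
      lemma : ∀ w → w + 4 + 4 ≡ 1 + (7 + w)
      lemma = solve-∀
    finish : ∃[ b′ ] b ≡ suc b′ → AtMostD b ⟨ false , bits (3 + 4 * m ∷ ls) , Y , Z ⟩
    finish (b′ , refl) = inj₂ (t , arm₁ (there (here refl)) , starS b′ (star 0 (0 ∷ 0 ∷ 4 * m ∷ ls) y ys z zs) (four-suc b′ bound))
  reply (broken h) = finish (four-pos {weight cost t} b bound)
    where
    X₁ = bits (l ∷ ls)
    t = ⟨ true , cover X₁ , cover Y , cover Z ⟩
    covered : weigh cost 0 (cover X₁) + cost l ≡ weigh cost 0 X₁ + cost (l ∸ 1)
    covered = subst (λ i → weigh cost 0 (cover X₁) + cost i ≡ weigh cost 0 X₁ + cost (i ∸ 1)) (lead-bits l ls) (weigh-cover cost refl X₁)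
    four-off : 4 + weigh cost 0 (cover X₁) ≤ weigh cost 0 (bits (4 * x ∷ xs))
    four-off = +-cancelʳ-≤ (cost l) _ _ (≤-trans (≤-reflexive (trans (cong (4 +_) covered) (+-comm 4 _))) h)
    bound : weight cost t + 4 ≤ 4 * b
    bound = ≤-trans (≤-reflexive (+-comm _ 4)) (≤-trans (drop-arm₁ 4 (weigh cost 0 (cover Y)) (weigh cost 0 (cover Z)) four-off)
      (≤-trans (+-mono-≤ (+-monoʳ-≤ (weigh cost 0 (bits (4 * x ∷ xs))) (cost-cover Y)) (cost-cover Z)) k))
    finish : ∃[ b′ ] b ≡ suc b′ → AtMostD b ⟨ false , X₁ , Y , Z ⟩
    finish (b′ , refl) = inj₂ (t , centre refl , flatS b′
      (flat-cover {false} (padded₃ (padded-bits (l ∷ ls)) (padded-bits (4 * y ∷ ys)) (padded-bits (4 * z ∷ zs)))) (four-suc b′ bound))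

-- Upper bounds for the whole tree and for one predominated vertex

cost-1+4* : ∀ x → cost (1 + 4 * x) ≡ 4 + 8 * x
cost-1+4* zero = refl
cost-1+4* (suc x) = trans (cong (λ m → cost (1 + m)) (*-suc 4 x)) (trans (cong (8 +_) (cost-1+4* x)) (cong (4 +_) (sym (*-suc 8 x))))

cost-2+4* : ∀ x → cost (2 + 4 * x) ≡ 6 + 8 * x
cost-2+4* zero = refl
cost-2+4* (suc x) = trans (cong (λ m → cost (2 + m)) (*-suc 4 x)) (trans (cong (8 +_) (cost-2+4* x)) (cong (6 +_) (sym (*-suc 8 x))))

freshArm : ℕ → List Bool
freshArm p = bits (4 * p ∷ [])

cost-freshArm : ∀ p → weigh cost 0 (freshArm p) ≡ 8 * p
cost-freshArm p = trans (bits-cost (4 * p ∷ [])) (trans (+-identityʳ (cost (4 * p))) (cost-4* p))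

cost-cover-freshArm : ∀ p → weigh cost 0 (cover (freshArm (suc p))) ≡ 7 + 8 * p
cost-cover-freshArm p = trans (cong (λ n → weigh cost 0 (cover (bits (n ∷ [])))) (*-suc 4 p))
  (trans (bits-cost (3 + 4 * p ∷ [])) (trans (+-identityʳ (cost (3 + 4 * p))) (cost-3+4* p)))

fresh-AtMostD : ∀ p q r → AtMostD (suc (2 * (p + q + r))) ⟨ false , freshArm p , freshArm q , freshArm r ⟩
fresh-AtMostD p q r = starD (suc (2 * (p + q + r))) (star p [] q [] r []) bound
  where
  bound : weight cost ⟨ false , freshArm p , freshArm q , freshArm r ⟩ + 4 ≤ 4 * suc (2 * (p + q + r)) + 3
  bound rewrite cost-freshArm p | cost-freshArm q | cost-freshArm r = ≤-trans (≤-reflexive (lemma p q r)) (m≤m+n _ 3)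
    where
    lemma : ∀ p q r → 8 * p + 8 * q + 8 * r + 4 ≡ 4 * suc (2 * (p + q + r))
    lemma = solve-∀

centre-AtMostD : ∀ p q r → AtMostD (2 * (p + q + r)) ⟨ true , freshArm p , freshArm q , freshArm r ⟩
centre-AtMostD p q r = flatD (2 * (p + q + r)) (refl , padded₃ (padded-bits (4 * p ∷ [])) (padded-bits (4 * q ∷ [])) (padded-bits (4 * r ∷ []))) bound
  where
  bound : weight cost ⟨ true , freshArm p , freshArm q , freshArm r ⟩ ≤ 4 * (2 * (p + q + r)) + 3
  bound rewrite cost-freshArm p | cost-freshArm q | cost-freshArm r = ≤-trans (≤-reflexive (lemma p q r)) (m≤m+n _ 3)
    where
    lemma : ∀ p q r → 8 * p + 8 * q + 8 * r ≡ 4 * (2 * (p + q + r))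
    lemma = solve-∀

-- The vertices in front of and behind the predominated one number `4 * p - 1`, so their residues
-- add up to 3.
complement : ∀ c → c ≤ 3 → ∀ a j p → c + 4 * a + suc j ≡ 4 * p → ∃[ b ] (j ≡ (3 ∸ c) + 4 * b × p ≡ suc (a + b))
complement c c≤3 zero j (suc p) e = p , +-cancelˡ-≡ (suc c) _ _ eq , refl
  where
  eq : suc c + j ≡ suc c + ((3 ∸ c) + 4 * p)
  eq = trans (trans (sym (+-suc c j)) (cong (_+ suc j) (sym (+-identityʳ c))))
         (trans e (trans (*-suc 4 p) (cong suc (trans (cong (_+ 4 * p) (sym (m+[n∸m]≡n c≤3))) (+-assoc c (3 ∸ c) _)))))
complement c c≤3 (suc a) j (suc p) e
  with complement c c≤3 a j p (+-cancelˡ-≡ 4 _ _ (trans (lemma c a j) (trans e (*-suc 4 p))))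
  where
  lemma : ∀ c a j → 4 + (c + 4 * a + suc j) ≡ c + 4 * suc a + suc j
  lemma = solve-∀
... | b , f , refl = b , f , refl
complement zero    _ zero    j zero ()
complement (suc c) _ zero    j zero ()
complement zero    _ (suc a) j zero ()
complement (suc c) _ (suc a) j zero ()

data Mod4 : ℕ → Set where
  mod0 : ∀ a → Mod4 (4 * a)
  mod1 : ∀ a → Mod4 (1 + 4 * a)
  mod2 : ∀ a → Mod4 (2 + 4 * a)
  mod3 : ∀ a → Mod4 (3 + 4 * a)

mod4 : ∀ i → Mod4 i
mod4 0 = mod0 0
mod4 1 = mod1 0
mod4 2 = mod2 0
mod4 3 = mod3 0
mod4 (suc (suc (suc (suc i)))) with mod4 i
... | mod0 a = subst Mod4 (*-suc 4 a) (mod0 (suc a))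
... | mod1 a = subst Mod4 (cong suc (*-suc 4 a)) (mod1 (suc a))
... | mod2 a = subst Mod4 (cong (2 +_) (*-suc 4 a)) (mod2 (suc a))
... | mod3 a = subst Mod4 (cong (3 +_) (*-suc 4 a)) (mod3 (suc a))

cost-vertexArm : ∀ i j → weigh cost 0 (bits (i ∷ j ∷ [])) ≡ cost i + cost j
cost-vertexArm i j = trans (bits-cost (i ∷ j ∷ [])) (cong (cost i +_) (+-identityʳ (cost j)))

-- The distance from the centre is `i + 1`. In all four cases the charge after the chosen opening
-- meets the budget with equality.
vertex-AtMostD : ∀ p q r i j → i + suc j ≡ 4 * p →
  AtMostD (2 * (p + suc q + suc r)) ⟨ false , bits (i ∷ j ∷ []) , freshArm (suc q) , freshArm (suc r) ⟩
vertex-AtMostD p q′ r′ i j e with mod4 i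
... | mod0 a with complement 0 z≤n a j p e
...   | b , refl , refl = starD _ (star a (3 + 4 * b ∷ []) (suc q′) [] (suc r′) []) bound
  where
  bound : weigh cost 0 (bits (4 * a ∷ 3 + 4 * b ∷ [])) + weigh cost 0 (freshArm (suc q′)) + weigh cost 0 (freshArm (suc r′)) + 4
          ≤ 4 * (2 * (suc (a + b) + suc q′ + suc r′)) + 3
  bound rewrite cost-vertexArm (4 * a) (3 + 4 * b) | cost-4* a | cost-3+4* b | cost-freshArm (suc q′) | cost-freshArm (suc r′) =
    ≤-reflexive (lemma a b (suc q′) (suc r′))
    where
    lemma : ∀ a b q r → 8 * a + (7 + 8 * b) + 8 * q + 8 * r + 4 ≡ 4 * (2 * (suc (a + b) + q + r)) + 3
    lemma = solve-∀
vertex-AtMostD p q′ r′ i j e | mod1 a with complement 1 (s≤s z≤n) a j p e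
-- The argument of `flatS` is the predecessor of `2 * (suc (a + b) + suc q′ + suc r′)` in the form
-- to which it unfolds.
...   | b , refl , refl = inj₂ (_ , centre refl , flatS (a + b + suc q′ + suc r′ + suc (a + b + suc q′ + suc r′ + 0))
  (flat-cover {false} (padded₃ (padded-bits (1 + 4 * a ∷ 2 + 4 * b ∷ [])) (padded-bits (4 * suc q′ ∷ [])) (padded-bits (4 * suc r′ ∷ [])))) bound)
  where
  bound : weigh cost 0 (bits (4 * a ∷ 2 + 4 * b ∷ [])) + weigh cost 0 (cover (freshArm (suc q′))) + weigh cost 0 (cover (freshArm (suc r′)))
          ≤ 4 * (a + b + suc q′ + suc r′ + suc (a + b + suc q′ + suc r′ + 0))
  bound rewrite cost-vertexArm (4 * a) (2 + 4 * b) | cost-4* a | cost-2+4* b | cost-cover-freshArm q′ | cost-cover-freshArm r′ =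
    ≤-reflexive (lemma a b q′ r′)
    where
    lemma : ∀ a b q r → 8 * a + (6 + 8 * b) + (7 + 8 * q) + (7 + 8 * r) ≡ 4 * (a + b + suc q + suc r + suc (a + b + suc q + suc r + 0))
    lemma = solve-∀
vertex-AtMostD p q′ r′ i j e | mod2 a with complement 2 (s≤s (s≤s z≤n)) a j p e
...   | b , refl , refl = inj₂ (_ , arm₁ (here refl) , flatS (a + b + suc q′ + suc r′ + suc (a + b + suc q′ + suc r′ + 0))
  (refl , padded₃ (padded-bits (4 * a ∷ 1 + 4 * b ∷ [])) (padded-bits (4 * suc q′ ∷ [])) (padded-bits (4 * suc r′ ∷ []))) bound)
  where
  bound : weigh cost 0 (bits (4 * a ∷ 1 + 4 * b ∷ [])) + weigh cost 0 (freshArm (suc q′)) + weigh cost 0 (freshArm (suc r′))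
          ≤ 4 * (a + b + suc q′ + suc r′ + suc (a + b + suc q′ + suc r′ + 0))
  bound rewrite cost-vertexArm (4 * a) (1 + 4 * b) | cost-4* a | cost-1+4* b | cost-freshArm (suc q′) | cost-freshArm (suc r′) =
    ≤-reflexive (lemma a b q′ r′)
    where
    lemma : ∀ a b q r → 8 * a + (4 + 8 * b) + 8 * suc q + 8 * suc r ≡ 4 * (a + b + suc q + suc r + suc (a + b + suc q + suc r + 0))
    lemma = solve-∀
vertex-AtMostD p q′ r′ i j e | mod3 a with complement 3 ≤-refl a j p e
...   | b , refl , refl = inj₂ (_ , centre refl , flatS (a + b + suc q′ + suc r′ + suc (a + b + suc q′ + suc r′ + 0))
  (flat-cover {false} {bits (3 + 4 * a ∷ 4 * b ∷ [])} (padded₃ (padded-bits (3 + 4 * a ∷ 4 * b ∷ [])) (padded-bits (4 * suc q′ ∷ [])) (padded-bits (4 * suc r′ ∷ [])))) bound)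
  where
  bound : weigh cost 0 (bits (2 + 4 * a ∷ 4 * b ∷ [])) + weigh cost 0 (cover (freshArm (suc q′))) + weigh cost 0 (cover (freshArm (suc r′)))
          ≤ 4 * (a + b + suc q′ + suc r′ + suc (a + b + suc q′ + suc r′ + 0))
  bound rewrite cost-vertexArm (2 + 4 * a) (4 * b) | cost-2+4* a | cost-4* b | cost-cover-freshArm q′ | cost-cover-freshArm r′ =
    ≤-reflexive (lemma a b q′ r′)
    where
    lemma : ∀ a b q r → 6 + 8 * a + 8 * b + (7 + 8 * q) + (7 + 8 * r) ≡ 4 * (a + b + suc q + suc r + suc (a + b + suc q + suc r + 0))
    lemma = solve-∀

-- Lower bound

falses : List Bool → ℕ
falses []           = 0
falses (true ∷ xs)  = falses xs
falses (false ∷ xs) = suc (falses xs)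

size : Position → ℕ
size ⟨ c , X , Y , Z ⟩ = falses (c ∷ X) + falses Y + falses Z

size-swap₁₂ : ∀ s → size s ≡ size (swap₁₂ s)
size-swap₁₂ ⟨ true , X , Y , Z ⟩  = cong (_+ falses Z) (+-comm (falses X) (falses Y))
size-swap₁₂ ⟨ false , X , Y , Z ⟩ = cong (λ n → suc n + falses Z) (+-comm (falses X) (falses Y))

size-swap₁₃ : ∀ s → size s ≡ size (swap₁₃ s)
size-swap₁₃ ⟨ true , X , Y , Z ⟩  = lemma (falses X) (falses Y) (falses Z)
  where
  lemma : ∀ a b c → a + b + c ≡ c + b + a
  lemma = solve-∀
size-swap₁₃ ⟨ false , X , Y , Z ⟩ = lemma (falses X) (falses Y) (falses Z)
  where
  lemma : ∀ a b c → suc a + b + c ≡ suc c + b + a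
  lemma = solve-∀

falses-⇝< : ∀ {xs ys} → xs ⇝ ys → falses ys < falses xs
falses-⇝< (here {false} {false} {false} _) = s≤s (m≤n+m _ 2)
falses-⇝< (here {false} {false} {true} _)  = s≤s (m≤n+m _ 1)
falses-⇝< (here {false} {true} {false} _)  = s≤s (m≤n+m _ 1)
falses-⇝< (here {false} {true} {true} _)   = ≤-refl
falses-⇝< (here {true} {false} {false} _)  = s≤s (m≤n+m _ 1)
falses-⇝< (here {true} {false} {true} _)   = ≤-refl
falses-⇝< (here {true} {true} {false} _)   = ≤-refl
falses-⇝< (there {false} m)                = s≤s (falses-⇝< m)
falses-⇝< (there {true} m)                 = falses-⇝< m

gap : Bool → ℕ
gap true  = 0
gap false = 1

falses-∷ : ∀ c X → falses (c ∷ X) ≡ gap c + falses X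
falses-∷ true  X = refl
falses-∷ false X = refl

falses-cover : ∀ X → falses X ≡ gap (top X) + falses (cover X)
falses-cover []          = refl
falses-cover (true ∷ X)  = refl
falses-cover (false ∷ X) = refl

size-centre : ∀ c X Y Z → size ⟨ c , X , Y , Z ⟩ ≡
  gap c + gap (top X) + gap (top Y) + gap (top Z) + size ⟨ true , cover X , cover Y , cover Z ⟩
size-centre c X Y Z = trans (cong₂ _+_ (cong₂ _+_ (trans (falses-∷ c X) (cong (gap c +_) (falses-cover X))) (falses-cover Y)) (falses-cover Z))
  (lemma (gap c) (gap (top X)) (gap (top Y)) (gap (top Z)) (falses (cover X)) (falses (cover Y)) (falses (cover Z)))
  where
  lemma : ∀ c x y z a b d → c + (x + a) + (y + b) + (z + d) ≡ c + x + y + z + (a + b + d)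
  lemma = solve-∀

gaps-pos : ∀ c x y z → c ∧ x ∧ y ∧ z ≡ false → 1 ≤ gap c + gap x + gap y + gap z
gaps-pos false x y z _                = s≤s z≤n
gaps-pos true false y z _             = s≤s z≤n
gaps-pos true true false z _          = s≤s z≤n
gaps-pos true true true false _       = s≤s z≤n

gap≤1 : ∀ b → gap b ≤ 1
gap≤1 true  = z≤n
gap≤1 false = ≤-refl

gaps≤3 : ∀ c x y z → c ≡ true ⊎ x ≡ true ⊎ y ≡ true ⊎ z ≡ true → gap c + gap x + gap y + gap z ≤ 3
gaps≤3 c x y z (inj₁ refl)               = +-mono-≤ (+-mono-≤ (gap≤1 x) (gap≤1 y)) (gap≤1 z)
gaps≤3 c x y z (inj₂ (inj₁ refl))        = +-mono-≤ (+-mono-≤ (+-monoˡ-≤ 0 (gap≤1 c)) (gap≤1 y)) (gap≤1 z)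
gaps≤3 c x y z (inj₂ (inj₂ (inj₁ refl))) = +-mono-≤ (+-monoˡ-≤ 0 (+-mono-≤ (gap≤1 c) (gap≤1 x))) (gap≤1 z)
gaps≤3 c x y z (inj₂ (inj₂ (inj₂ refl))) = +-monoˡ-≤ 0 (+-mono-≤ (+-mono-≤ (gap≤1 c) (gap≤1 x)) (gap≤1 y))

size-step< : ∀ {s t} → s ⟶ t → size t < size s
size-step< (centre {c} {X} {Y} {Z} e) rewrite size-centre c X Y Z =
  +-monoˡ-≤ (size ⟨ true , cover X , cover Y , cover Z ⟩) (gaps-pos c (top X) (top Y) (top Z) e)
size-step< (arm₁ {Y = Y} {Z} m) = +-monoˡ-< (falses Z) (+-monoˡ-< (falses Y) (falses-⇝< m))
size-step< {s} {t} (arm₂ {X = X} {Z = Z} m) rewrite size-swap₁₂ s | size-swap₁₂ t =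
  +-monoˡ-< (falses Z) (+-monoˡ-< (falses X) (falses-⇝< m))
size-step< {s} {t} (arm₃ {X = X} {Y = Y} m) rewrite size-swap₁₃ s | size-swap₁₃ t =
  +-monoˡ-< (falses X) (+-monoˡ-< (falses Y) (falses-⇝< m))

falses-⇝≤3 : ∀ {xs ys} → xs ⇝ ys → falses xs ≤ 3 + falses ys
falses-⇝≤3 (here {false} {false} {false} _) = ≤-refl
falses-⇝≤3 (here {false} {false} {true} _)  = m≤n+m _ 1
falses-⇝≤3 (here {false} {true} {false} _)  = m≤n+m _ 1
falses-⇝≤3 (here {false} {true} {true} _)   = m≤n+m _ 2
falses-⇝≤3 (here {true} {false} {false} _)  = m≤n+m _ 1
falses-⇝≤3 (here {true} {false} {true} _)   = m≤n+m _ 2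
falses-⇝≤3 (here {true} {true} {false} _)   = m≤n+m _ 2
falses-⇝≤3 (there {false} m)                = s≤s (falses-⇝≤3 m)
falses-⇝≤3 (there {true} m)                 = falses-⇝≤3 m

Blocked : Position → Set
Blocked ⟨ c , X , Y , Z ⟩ = c ≡ true ⊎ top X ≡ true ⊎ top Y ≡ true ⊎ top Z ≡ true

top-⇝ : ∀ {xs ys} → xs ⇝ ys → top xs ≡ true → top ys ≡ true
top-⇝ (here _)  e = refl
top-⇝ (there _) e = e

size-arm≤ : ∀ {c c′ X X′} Y Z → c ∷ X ⇝ c′ ∷ X′ → size ⟨ c , X , Y , Z ⟩ ≤ 3 + size ⟨ c′ , X′ , Y , Z ⟩
size-arm≤ Y Z m = +-monoˡ-≤ (falses Z) (+-monoˡ-≤ (falses Y) (falses-⇝≤3 m))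

size-step≤ : ∀ {s t} → s ⟶ t → size s ≤ 3 + size t ⊎ (centreOf t ≡ true × size s ≤ 4 + size t)
size-step≤ (centre {c} {X} {Y} {Z} e) rewrite size-centre c X Y Z =
  inj₂ (refl , +-monoˡ-≤ (size ⟨ true , cover X , cover Y , cover Z ⟩)
    (+-mono-≤ (+-mono-≤ (+-mono-≤ (gap≤1 c) (gap≤1 (top X))) (gap≤1 (top Y))) (gap≤1 (top Z))))
size-step≤ (arm₁ {Y = Y} {Z} m) = inj₁ (size-arm≤ Y Z m)
size-step≤ {s} {t} (arm₂ {X = X} {Z = Z} m) rewrite size-swap₁₂ s | size-swap₁₂ t = inj₁ (size-arm≤ X Z m)
size-step≤ {s} {t} (arm₃ {X = X} {Y = Y} m) rewrite size-swap₁₃ s | size-swap₁₃ t = inj₁ (size-arm≤ Y X m)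

blocked-size : ∀ {s t} → Blocked s → s ⟶ t → size s ≤ 3 + size t
blocked-size B (centre {c} {X} {Y} {Z} e) rewrite size-centre c X Y Z =
  +-monoˡ-≤ (size ⟨ true , cover X , cover Y , cover Z ⟩) (gaps≤3 c (top X) (top Y) (top Z) B)
blocked-size B (arm₁ {Y = Y} {Z} m) = size-arm≤ Y Z m
blocked-size {s} {t} B (arm₂ {X = X} {Z = Z} m) rewrite size-swap₁₂ s | size-swap₁₂ t = size-arm≤ X Z m
blocked-size {s} {t} B (arm₃ {X = X} {Y = Y} m) rewrite size-swap₁₃ s | size-swap₁₃ t = size-arm≤ Y X m

centre-arm : ∀ {c c′ X X′} → c ∷ X ⇝ c′ ∷ X′ → c ≡ true → c′ ≡ true
centre-arm (here _)  e = refl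
centre-arm (there _) e = e

top-arm : ∀ {c c′ X X′} → c ∷ X ⇝ c′ ∷ X′ → top X ≡ true → top X′ ≡ true
top-arm (here _)  e = refl
top-arm (there m) e = top-⇝ m e

blocked-step : ∀ {s t} → s ⟶ t → Blocked s → Blocked t
blocked-step (centre _) B = inj₁ refl
blocked-step (arm₁ m) (inj₁ e)                   = inj₁ (centre-arm m e)
blocked-step (arm₁ m) (inj₂ (inj₁ e))            = inj₂ (inj₁ (top-arm m e))
blocked-step (arm₁ m) (inj₂ (inj₂ e))            = inj₂ (inj₂ e)
blocked-step (arm₂ m) (inj₁ e)                   = inj₁ (centre-arm m e)
blocked-step (arm₂ m) (inj₂ (inj₁ e))            = inj₂ (inj₁ e)
blocked-step (arm₂ m) (inj₂ (inj₂ (inj₁ e)))     = inj₂ (inj₂ (inj₁ (top-arm m e)))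
blocked-step (arm₂ m) (inj₂ (inj₂ (inj₂ e)))     = inj₂ (inj₂ (inj₂ e))
blocked-step (arm₃ m) (inj₁ e)                   = inj₁ (centre-arm m e)
blocked-step (arm₃ m) (inj₂ (inj₁ e))            = inj₂ (inj₁ e)
blocked-step (arm₃ m) (inj₂ (inj₂ (inj₁ e)))     = inj₂ (inj₂ (inj₁ e))
blocked-step (arm₃ m) (inj₂ (inj₂ (inj₂ e)))     = inj₂ (inj₂ (inj₂ (top-arm m e)))

-- Positions that arise in play, and Staller's short moves

-- No dominated vertex is isolated among undominated ones. The three
-- predicates differ in what precedes the list: an undominated vertex, a
-- dominated vertex still in need of a dominated neighbour, or a dominated
-- vertex that needs none.
Clear Fresh Solid : List Bool → Set
Clear []           = ⊤
Clear (false ∷ xs) = Clear xs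
Clear (true ∷ xs)  = Fresh xs
Fresh []           = ⊤
Fresh (false ∷ xs) = ⊥
Fresh (true ∷ xs)  = Solid xs
Solid []           = ⊤
Solid (false ∷ xs) = Clear xs
Solid (true ∷ xs)  = Solid xs

fresh⇒solid : ∀ xs → Fresh xs → Solid xs
fresh⇒solid []          _ = tt
fresh⇒solid (true ∷ xs) s = s

clear⇒solid : ∀ xs → Clear xs → Solid xs
clear⇒solid []           _ = tt
clear⇒solid (false ∷ xs) c = c
clear⇒solid (true ∷ xs)  f = fresh⇒solid xs f

solid-tail : ∀ x xs → Solid (x ∷ xs) → Solid xs
solid-tail true  xs s = s
solid-tail false xs c = clear⇒solid xs c

-- The three entries written by a move support one another, so what follows them only has to satisfy
-- `Solid`, the weakest of the three conditions.
solid-⇝ : ∀ {xs ys} → xs ⇝ ys → Solid xs → Solid ys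
clear-⇝ : ∀ {xs ys} → xs ⇝ ys → Clear xs → Clear ys
fresh-⇝ : ∀ {xs ys} → xs ⇝ ys → Fresh xs → Fresh ys
solid-⇝ (here {a} {b} {d} {xs} _) s = solid-tail d xs (solid-tail b (d ∷ xs) (solid-tail a (b ∷ d ∷ xs) s))
solid-⇝ (there {false} m) s = clear-⇝ m s
solid-⇝ (there {true} m)  s = solid-⇝ m s
clear-⇝ m@(here {a} {b} {d} {xs} _) c = solid-⇝ m (clear⇒solid (a ∷ b ∷ d ∷ xs) c)
clear-⇝ (there {false} m) c = clear-⇝ m c
clear-⇝ (there {true} m)  f = fresh-⇝ m f
fresh-⇝ m@(here {a} {b} {d} {xs} _) f = solid-⇝ m (fresh⇒solid (a ∷ b ∷ d ∷ xs) f)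
fresh-⇝ (there {true} m)  s = solid-⇝ m s

Wide : Bool → List Bool → Set
Wide true  = Solid
Wide false = Clear

wide⇒solid : ∀ c xs → Wide c xs → Solid xs
wide⇒solid true  xs s = s
wide⇒solid false xs c = clear⇒solid xs c

-- The length includes the padding, so `order` says that the number of vertices is a positive
-- multiple of 4.
record Arm (c : Bool) (X : List Bool) : Set where
  constructor arm
  field
    padded : Padded true X
    wide   : Wide c X
    order  : ∃[ m ] length X ≡ 5 + 4 * m
open Arm

length-⇝ : ∀ {xs ys} → xs ⇝ ys → length ys ≡ length xs
length-⇝ (here _)  = refl
length-⇝ (there m) = cong suc (length-⇝ m)

arm-⇝ : ∀ {c c′ X X′} → c ∷ X ⇝ c′ ∷ X′ → Arm c X → Arm c′ X′
arm-⇝ {c} m@(here {b = b} {d} {xs} _) (arm p w (k , l)) =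
  arm (padded-true xs p) (solid-tail d xs (solid-tail b (d ∷ xs) (wide⇒solid c (b ∷ d ∷ xs) w))) (k , l)
arm-⇝ {true}  (there m) (arm p w (k , l)) = arm (padded-⇝ m p) (solid-⇝ m w) (k , trans (length-⇝ m) l)
arm-⇝ {false} (there m) (arm p w (k , l)) = arm (padded-⇝ m p) (clear-⇝ m w) (k , trans (length-⇝ m) l)

arm-true : ∀ {c X} → Arm c X → Arm true X
arm-true {c} {X} (arm p w l) = arm p (wide⇒solid c X w) l

arm-beside : ∀ {c c′ X X′ Y} → c ∷ X ⇝ c′ ∷ X′ → Arm c Y → Arm c′ Y
arm-beside (here _)  A = arm-true A
arm-beside (there _) A = A

arm-cover : ∀ {c X} → Arm c X → Arm true (cover X)
arm-cover {X = []}    A = arm-true A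
arm-cover {c} {X = x ∷ xs} (arm p w l) = arm (padded-true xs p) (solid-tail x xs (wide⇒solid c (x ∷ xs) w)) l

top-cover : ∀ X → top (cover X) ≡ true
top-cover []      = refl
top-cover (_ ∷ _) = refl

-- The field `supported` extends the ban on isolated dominated vertices to the centre, whose
-- neighbours lie in three different lists.
record Reachable (s : Position) : Set where
  constructor reachable
  open Position s renaming (centreOf to c; armOf₁ to X; armOf₂ to Y; armOf₃ to Z)
  field
    first     : Arm c X
    second    : Arm c Y
    third     : Arm c Z
    supported : c ≡ true → top X ≡ true ⊎ top Y ≡ true ⊎ top Z ≡ true
open Reachable

supported-arm : ∀ {c c′ X X′} {P : Set} → c ∷ X ⇝ c′ ∷ X′ → (c ≡ true → top X ≡ true ⊎ P) → c′ ≡ true → top X′ ≡ true ⊎ P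
supported-arm (here _)  h e = inj₁ refl
supported-arm (there m) h e with h e
... | inj₁ f = inj₁ (top-⇝ m f)
... | inj₂ p = inj₂ p

rotate : {P Q R : Set} → P ⊎ Q ⊎ R → Q ⊎ R ⊎ P
rotate (inj₁ p)        = inj₂ (inj₂ p)
rotate (inj₂ (inj₁ q)) = inj₁ q
rotate (inj₂ (inj₂ r)) = inj₂ (inj₁ r)

reachable-step : ∀ {s t} → s ⟶ t → Reachable s → Reachable t
reachable-step (centre {X = X} _) R =
  reachable (arm-cover (first R)) (arm-cover (second R)) (arm-cover (third R)) λ _ → inj₁ (top-cover X)
reachable-step (arm₁ m) R =
  reachable (arm-⇝ m (first R)) (arm-beside m (second R)) (arm-beside m (third R)) (supported-arm m (supported R))
reachable-step (arm₂ m) R =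
  reachable (arm-beside m (first R)) (arm-⇝ m (second R)) (arm-beside m (third R))
    λ e → rotate (rotate (supported-arm m (λ f → rotate (supported R f)) e))
reachable-step (arm₃ m) R =
  reachable (arm-beside m (first R)) (arm-beside m (second R)) (arm-⇝ m (third R))
    λ e → rotate (supported-arm m (λ f → rotate (rotate (supported R f))) e)

data ArmCase (c : Bool) (X : List Bool) : Set where
  single : ∀ {X′} → c ∷ X ⇝ c ∷ X′ → falses X ≡ suc (falses X′) → ArmCase c X
  full   : top X ≡ true → falses X ≡ 0 → ArmCase c X
  empty  : ∀ m → top X ≡ false → falses X ≡ 4 * m → ArmCase c X

solid-case : ∀ X → (∃[ X′ ] (true ∷ true ∷ X ⇝ true ∷ true ∷ X′ × falses X ≡ suc (falses X′))) ⊎ falses X ≡ 0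
solid-case []          = inj₂ refl
solid-case (false ∷ X) = inj₁ (true ∷ X , here refl , refl)
solid-case (true ∷ X) with solid-case X
... | inj₁ (X′ , m , e) = inj₁ (true ∷ X′ , there m , e)
... | inj₂ e            = inj₂ e

-- The first dominated entry is followed by another one, unless it is the padding. A window on this
-- pair and the entry before it takes just the last vertex of the run.
clear-case : ∀ X → Clear X → Padded false X →
  (∃[ X′ ] (false ∷ X ⇝ X′ × falses X ≡ falses X′)) ⊎ suc (falses X) ≡ length X
clear-case (false ∷ X) w p with clear-case X w p
... | inj₁ (X′ , m , e) = inj₁ (false ∷ X′ , there m , cong suc e)
... | inj₂ e            = inj₂ (cong suc e)
clear-case (true ∷ [])       w p = inj₂ refl
clear-case (true ∷ true ∷ X) w p = inj₁ (true ∷ true ∷ true ∷ X , here refl , refl)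

arm-case : ∀ {c X} → Arm c X → ArmCase c X
arm-case {c} {false ∷ X} (arm p w (k , l)) with clear-case X (clear c w) p
  where
  clear : ∀ c → Wide c (false ∷ X) → Clear X
  clear true  w = w
  clear false w = w
... | inj₁ (X′ , m , e) = single (there m) (cong suc e)
... | inj₂ e            = empty (suc k) refl (suc-injective (trans (cong suc e) (trans l (cong suc (sym (*-suc 4 k))))))
arm-case {true} {true ∷ X} A with solid-case X
... | inj₁ (X′ , m , e) = single m e
... | inj₂ e            = full refl e
arm-case {false} {true ∷ []} A = full refl refl
arm-case {false} {true ∷ true ∷ X} A with solid-case X
... | inj₁ (X′ , m , e) = single (there m) e
... | inj₂ e            = full refl e
arm-case {false} {true ∷ false ∷ X} (arm p () l)
arm-case {X = []} (arm p w (k , ()))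

Single Double : Position → Set
Single s = ∃[ t ] (s ⟶ t × size s ≡ suc (size t))
Double s = ∃[ t ] (s ⟶ t × size s ≡ 2 + size t × ∃[ m ] size s ≡ 4 * m)

single-arm₁ : ∀ {c c′ X X′} Y Z → c ∷ X ⇝ c′ ∷ X′ → falses (c ∷ X) ≡ suc (falses (c′ ∷ X′)) → Single ⟨ c , X , Y , Z ⟩
single-arm₁ Y Z m e = _ , arm₁ m , cong (λ n → n + falses Y + falses Z) e

single-swap₁₂ : ∀ {s} → Single s → Single (swap₁₂ s)
single-swap₁₂ {s} (t , m , e) = swap₁₂ t , swap₁₂-step m , trans (sym (size-swap₁₂ s)) (trans e (cong suc (size-swap₁₂ t)))

single-swap₁₃ : ∀ {s} → Single s → Single (swap₁₃ s)
single-swap₁₃ {s} (t , m , e) = swap₁₃ t , swap₁₃-step m , trans (sym (size-swap₁₃ s)) (trans e (cong suc (size-swap₁₃ t)))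

single-arm₂ : ∀ {c c′ Y Y′} X Z → c ∷ Y ⇝ c′ ∷ Y′ → falses (c ∷ Y) ≡ suc (falses (c′ ∷ Y′)) → Single ⟨ c , X , Y , Z ⟩
single-arm₂ X Z m e = single-swap₁₂ (single-arm₁ X Z m e)

single-arm₃ : ∀ {c c′ Z Z′} X Y → c ∷ Z ⇝ c′ ∷ Z′ → falses (c ∷ Z) ≡ suc (falses (c′ ∷ Z′)) → Single ⟨ c , X , Y , Z ⟩
single-arm₃ X Y m e = single-swap₁₃ (single-arm₁ Y X m e)

falses-cong : ∀ c {X X′} → falses X ≡ suc (falses X′) → falses (c ∷ X) ≡ suc (falses (c ∷ X′))
falses-cong true  e = e
falses-cong false e = cong suc e

full-move : ∀ {X} → Arm false X → top X ≡ true → falses X ≡ 0 →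
            ∃[ X′ ] (false ∷ X ⇝ true ∷ X′ × falses (false ∷ X) ≡ suc (falses (true ∷ X′)))
full-move {true ∷ true ∷ X} A t e = true ∷ true ∷ X , here refl , refl
full-move {true ∷ []} (arm p w (k , ())) t e
full-move {[]} (arm p w (k , ())) t e
full-move {true ∷ false ∷ X} A t ()

module _ {X Y Z x y z} (ex : top X ≡ x) (ey : top Y ≡ y) (ez : top Z ≡ z) (nontrivial : x ∧ y ∧ z ≡ false) where

  private
    move : ⟨ true , X , Y , Z ⟩ ⟶ ⟨ true , cover X , cover Y , cover Z ⟩
    move = centre (trans (cong₂ _∧_ ex (cong₂ _∧_ ey ez)) nontrivial)

    drop : size ⟨ true , X , Y , Z ⟩ ≡ gap x + gap y + gap z + size ⟨ true , cover X , cover Y , cover Z ⟩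
    drop = trans (size-centre true X Y Z)
      (cong₂ (λ g h → g + h + size ⟨ true , cover X , cover Y , cover Z ⟩)
        {gap (top X) + gap (top Y)} {gap x + gap y} (cong₂ (λ a b → gap a + gap b) ex ey) (cong gap ez))

  centre-single : gap x + gap y + gap z ≡ 1 → Single ⟨ true , X , Y , Z ⟩
  centre-single g = _ , move , trans drop (cong (_+ size ⟨ true , cover X , cover Y , cover Z ⟩) g)

  centre-double : gap x + gap y + gap z ≡ 2 → ∀ m → size ⟨ true , X , Y , Z ⟩ ≡ 4 * m → Double ⟨ true , X , Y , Z ⟩
  centre-double g m h = _ , move , trans drop (cong (_+ size ⟨ true , cover X , cover Y , cover Z ⟩) g) , m , h

-- If no arm offers a single vertex, each is full or untouched. With the centre undominated, a full
-- arm gives a move that gains only the centre. With the centre dominated, playing it gains one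
-- vertex per untouched arm; three such arms contradict `supported`, and two occur at a size
-- divisible by 4.
blocked-move : ∀ {s} → Reachable s → Blocked s → size s ≡ 0 ⊎ Single s ⊎ Double s
blocked-move {⟨ c , X , Y , Z ⟩} R B = go c refl (arm-case (first R)) (arm-case (second R)) (arm-case (third R))
  where
  go : ∀ d → c ≡ d → ArmCase c X → ArmCase c Y → ArmCase c Z →
       size ⟨ c , X , Y , Z ⟩ ≡ 0 ⊎ Single ⟨ c , X , Y , Z ⟩ ⊎ Double ⟨ c , X , Y , Z ⟩
  go d _ (single m e) _ _ = inj₂ (inj₁ (single-arm₁ Y Z m (falses-cong c e)))
  go d _ _ (single m e) _ = inj₂ (inj₁ (single-arm₂ X Z m (falses-cong c e)))
  go d _ _ _ (single m e) = inj₂ (inj₁ (single-arm₃ X Y m (falses-cong c e)))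
  go false refl (full t e) _ _ = let _ , m , f = full-move (first R) t e in inj₂ (inj₁ (single-arm₁ Y Z m f))
  go false refl _ (full t e) _ = let _ , m , f = full-move (second R) t e in inj₂ (inj₁ (single-arm₂ X Z m f))
  go false refl _ _ (full t e) = let _ , m , f = full-move (third R) t e in inj₂ (inj₁ (single-arm₃ X Y m f))
  go false refl (empty _ a _) (empty _ b _) (empty _ d _) = ⊥-elim (absurd B)
    where
    clash : ∀ {x} → x ≡ false → x ≡ true → ⊥
    clash refl ()
    absurd : Blocked ⟨ false , X , Y , Z ⟩ → ⊥
    absurd (inj₂ (inj₁ e))        = clash a e
    absurd (inj₂ (inj₂ (inj₁ e))) = clash b e
    absurd (inj₂ (inj₂ (inj₂ e))) = clash d e
  go true refl (empty _ a _) (empty _ b _) (empty _ d _) = ⊥-elim (absurd (supported R refl))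
    where
    clash : ∀ {x} → x ≡ false → x ≡ true → ⊥
    clash refl ()
    absurd : top X ≡ true ⊎ top Y ≡ true ⊎ top Z ≡ true → ⊥
    absurd (inj₁ e)        = clash a e
    absurd (inj₂ (inj₁ e)) = clash b e
    absurd (inj₂ (inj₂ e)) = clash d e
  go true refl (full _ e) (full _ f) (full _ g) rewrite e | f | g = inj₁ refl
  go true refl (empty _ a _) (full b _) (full d _) = inj₂ (inj₁ (centre-single a b d refl refl))
  go true refl (full a _) (empty _ b _) (full d _) = inj₂ (inj₁ (centre-single a b d refl refl))
  go true refl (full a _) (full b _) (empty _ d _) = inj₂ (inj₁ (centre-single a b d refl refl))
  go true refl (full a e) (empty k b f) (empty l d g) =
    inj₂ (inj₂ (centre-double a b d refl refl (k + l) sizes))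
    where
    sizes : falses X + falses Y + falses Z ≡ 4 * (k + l)
    sizes rewrite e | f | g = sym (*-distribˡ-+ 4 k l)
  go true refl (empty k a e) (full b f) (empty l d g) =
    inj₂ (inj₂ (centre-double a b d refl refl (k + l) sizes))
    where
    sizes : falses X + falses Y + falses Z ≡ 4 * (k + l)
    sizes rewrite e | f | g | +-identityʳ (4 * k) = sym (*-distribˡ-+ 4 k l)
  go true refl (empty k a e) (empty l b f) (full d g) =
    inj₂ (inj₂ (centre-double a b d refl refl (k + l) sizes))
    where
    sizes : falses X + falses Y + falses Z ≡ 4 * (k + l)
    sizes rewrite e | f | g = trans (+-identityʳ _) (sym (*-distribˡ-+ 4 k l))

-- Tempo bounds once the centre or a neighbour is dominated

-- The number of remaining moves when Dominator always dominates three new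
-- vertices and Staller one, with n vertices left to dominate.
tempoD tempoS : ℕ → ℕ
tempoD 0 = 0
tempoD 1 = 1
tempoD 2 = 1
tempoD 3 = 1
tempoD (suc (suc (suc (suc n)))) = 2 + tempoD n
tempoS zero    = 0
tempoS (suc n) = suc (tempoD n)

tempoD-suc : ∀ n → tempoD n ≤ tempoD (suc n)
tempoD-suc 0 = z≤n
tempoD-suc 1 = ≤-refl
tempoD-suc 2 = ≤-refl
tempoD-suc 3 = s≤s z≤n
tempoD-suc (suc (suc (suc (suc n)))) = s≤s (s≤s (tempoD-suc n))

tempoD-mono : ∀ {m n} → m ≤ n → tempoD m ≤ tempoD n
tempoD-mono {m} {n} h = subst (λ i → tempoD m ≤ tempoD i) (m+[n∸m]≡n h) (go (n ∸ m))
  where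
  go : ∀ k → tempoD m ≤ tempoD (m + k)
  go zero rewrite +-identityʳ m = ≤-refl
  go (suc k) rewrite +-suc m k  = ≤-trans (go k) (tempoD-suc (m + k))

tempoS-mono : ∀ {m n} → m ≤ n → tempoS m ≤ tempoS n
tempoS-mono z≤n     = z≤n
tempoS-mono (s≤s h) = s≤s (tempoD-mono h)

tempoD-tempoS : ∀ n → tempoD n ≤ suc (tempoS (n ∸ 3))
tempoD-tempoS 0 = z≤n
tempoD-tempoS 1 = ≤-refl
tempoD-tempoS 2 = ≤-refl
tempoD-tempoS 3 = ≤-refl
tempoD-tempoS (suc (suc (suc (suc n)))) = ≤-refl

tempo-reply : ∀ {b m n} → suc b ≤ tempoD m → m ≤ 3 + n → b ≤ tempoS n
tempo-reply {b} {m} {n} h k = ≤-trans (≤-pred (≤-trans h (tempoD-tempoS m))) (tempoS-mono (m≤n+o⇒m∸n≤o m 3 k))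

tempoD-4* : ∀ m → tempoD (4 * m) ≡ 2 * m
tempoD-4* zero = refl
tempoD-4* (suc m) = trans (cong tempoD (*-suc 4 m)) (trans (cong (2 +_) (tempoD-4* m)) (sym (*-suc 2 m)))

-- This makes Staller's double move free: at size `4 + 4 * m` it leaves `2 + 4 * m` vertices instead
-- of `3 + 4 * m`.
tempoD-2≡3 : ∀ m → tempoD (3 + 4 * m) ≡ tempoD (2 + 4 * m)
tempoD-2≡3 zero = refl
tempoD-2≡3 (suc m) = trans (cong (λ n → tempoD (3 + n)) (*-suc 4 m))
  (trans (cong (2 +_) (tempoD-2≡3 m)) (cong (λ n → tempoD (2 + n)) (sym (*-suc 4 m))))

blockedD : ∀ b {s} → Reachable s → Blocked s → b ≤ tempoD (size s) → AtLeastD b s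
blockedS : ∀ b {s} → Reachable s → Blocked s → b ≤ tempoS (size s) → AtLeastS b s
blockedD zero    R B h = tt
blockedD (suc b) {s} R B h = exists (blocked-move R B) , λ t m →
  blockedS b (reachable-step m R) (blocked-step m B) (tempo-reply h (blocked-size B m))
  where
  exists : size s ≡ 0 ⊎ Single s ⊎ Double s → ∃[ t ] s ⟶ t
  exists (inj₁ e)                  = ⊥-elim (n≮0 (subst (λ n → suc b ≤ tempoD n) e h))
  exists (inj₂ (inj₁ (t , m , _))) = t , m
  exists (inj₂ (inj₂ (t , m , _))) = t , m
blockedS zero    R B h = tt
blockedS (suc b) {s} R B h with blocked-move R B
... | inj₁ e = ⊥-elim (n≮0 (subst (λ n → suc b ≤ tempoS n) e h))
... | inj₂ (inj₁ (t , m , e)) = t , m , blockedD b (reachable-step m R) (blocked-step m B)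
  (≤-pred (subst (λ n → suc b ≤ tempoS n) e h))
... | inj₂ (inj₂ (t , m , e , zero , f)) = ⊥-elim (n≮0 (subst (λ n → suc b ≤ tempoS n) f h))
... | inj₂ (inj₂ (t , m , e , suc k , f)) = t , m , blockedD b (reachable-step m R) (blocked-step m B)
  (≤-trans (≤-pred (subst (λ n → suc b ≤ tempoS n) (trans f (*-suc 4 k)) h))
    (≤-reflexive (trans (tempoD-2≡3 k) (cong tempoD (sym size-t)))))
  where
  size-t : size t ≡ 2 + 4 * k
  size-t = +-cancelˡ-≡ 2 _ _ (trans (sym e) (trans f (*-suc 4 k)))

-- Residues of the runs after the centre has been played

quarter three : ℕ → ℕ
quarter 0 = 0
quarter 1 = 0
quarter 2 = 0
quarter 3 = 0
quarter (suc (suc (suc (suc n)))) = suc (quarter n)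
three 0 = 0
three 1 = 0
three 2 = 0
three 3 = 1
three (suc (suc (suc (suc n)))) = three n

-- If the sum of the quarters did not drop, the three vertices taken would all come out of the
-- residue of the run, which must then be 3.
quarter-split : ∀ i j → suc (quarter i + quarter j) ≤ quarter (3 + i + j) + three (3 + i + j)
quarter-split 0 0 = ≤ᵇ⇒≤ _ _ tt
quarter-split 0 1 = ≤ᵇ⇒≤ _ _ tt
quarter-split 0 2 = ≤ᵇ⇒≤ _ _ tt
quarter-split 0 3 = ≤ᵇ⇒≤ _ _ tt
quarter-split 1 0 = ≤ᵇ⇒≤ _ _ tt
quarter-split 1 1 = ≤ᵇ⇒≤ _ _ tt
quarter-split 1 2 = ≤ᵇ⇒≤ _ _ tt
quarter-split 1 3 = ≤ᵇ⇒≤ _ _ tt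
quarter-split 2 0 = ≤ᵇ⇒≤ _ _ tt
quarter-split 2 1 = ≤ᵇ⇒≤ _ _ tt
quarter-split 2 2 = ≤ᵇ⇒≤ _ _ tt
quarter-split 2 3 = ≤ᵇ⇒≤ _ _ tt
quarter-split 3 0 = ≤ᵇ⇒≤ _ _ tt
quarter-split 3 1 = ≤ᵇ⇒≤ _ _ tt
quarter-split 3 2 = ≤ᵇ⇒≤ _ _ tt
quarter-split 3 3 = ≤ᵇ⇒≤ _ _ tt
quarter-split 0 (suc (suc (suc (suc j)))) = s≤s (quarter-split 0 j)
quarter-split 1 (suc (suc (suc (suc j)))) = s≤s (quarter-split 1 j)
quarter-split 2 (suc (suc (suc (suc j)))) = s≤s (quarter-split 2 j)
quarter-split 3 (suc (suc (suc (suc j)))) = s≤s (quarter-split 3 j)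
quarter-split (suc (suc (suc (suc i)))) j = s≤s (quarter-split i j)

three≤1 : ∀ n → three n ≤ 1
three≤1 0 = z≤n
three≤1 1 = z≤n
three≤1 2 = z≤n
three≤1 3 = ≤-refl
three≤1 (suc (suc (suc (suc n)))) = three≤1 n

quarter-split≤ : ∀ i j → quarter i + quarter j ≤ quarter (3 + i + j)
quarter-split≤ i j = ≤-pred (≤-trans (quarter-split i j)
  (≤-trans (+-monoʳ-≤ (quarter (3 + i + j)) (three≤1 (3 + i + j))) (≤-reflexive (+-comm _ 1))))

quarter-three : ∀ n → 4 * quarter n + 3 * three n ≤ n
quarter-three 0 = z≤n
quarter-three 1 = z≤n
quarter-three 2 = z≤n
quarter-three 3 = ≤-refl
quarter-three (suc (suc (suc (suc n)))) =
  ≤-trans (≤-reflexive (cong (_+ 3 * three n) (*-suc 4 (quarter n)))) (+-monoʳ-≤ 4 (quarter-three n))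

quarter-three-falses : ∀ k X → 4 * weigh quarter k X + 3 * weigh three k X ≤ k + falses X
quarter-three-falses k []          = ≤-trans (quarter-three k) (m≤m+n k 0)
quarter-three-falses k (false ∷ X) = ≤-trans (quarter-three-falses (suc k) X) (≤-reflexive (sym (+-suc k (falses X))))
quarter-three-falses k (true ∷ X)  =
  ≤-trans (≤-reflexive (lemma (quarter k) (weigh quarter 0 X) (three k) (weigh three 0 X)))
          (+-mono-≤ (quarter-three k) (quarter-three-falses 0 X))
  where
  lemma : ∀ a b c d → 4 * (a + b) + 3 * (c + d) ≡ (4 * a + 3 * c) + (4 * b + 3 * d)
  lemma = solve-∀

quarter-falses : ∀ X → 4 * weigh quarter 0 X ≤ falses X
quarter-falses X = ≤-trans (m≤m+n _ _) (quarter-three-falses 0 X)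

-- A move gaining at most two vertices already gives Staller the extra move; the quarters matter
-- only for moves gaining exactly three.
Bite : List Bool → List Bool → ℕ → Set
Bite xs ys k = falses xs ≤ 2 + falses ys ⊎
  (falses xs ≡ 3 + falses ys × weigh quarter k ys ≤ weigh quarter k xs ×
   suc (weigh quarter k ys) ≤ weigh quarter k xs + weigh three k xs)

bite : ∀ {xs ys} → xs ⇝ ys → ∀ k → Bite xs ys k
bite (here {false} {false} {true} _) k  = inj₁ ≤-refl
bite (here {false} {true} {false} _) k  = inj₁ ≤-refl
bite (here {false} {true} {true} _) k   = inj₁ (m≤n+m _ 1)
bite (here {true} {false} {false} _) k  = inj₁ ≤-refl
bite (here {true} {false} {true} _) k   = inj₁ (m≤n+m _ 1)
bite (here {true} {true} {false} _) k   = inj₁ (m≤n+m _ 1)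
bite (here {false} {false} {false} {xs} _) k with weigh-lead xs
... | C , e rewrite e quarter 0 | e quarter (3 + k) | e three (3 + k) = inj₂ (refl ,
  ≤-trans (≤-reflexive (sym (+-assoc (quarter k) _ _))) (+-monoˡ-≤ (C quarter) (quarter-split≤ k (lead xs))) ,
  ≤-trans (≤-reflexive (cong suc (sym (+-assoc (quarter k) _ _))))
    (≤-trans (+-monoˡ-≤ (C quarter) (quarter-split k (lead xs)))
      (≤-trans (m≤m+n _ (C three)) (≤-reflexive (lemma (quarter (3 + k + lead xs)) (three (3 + k + lead xs)) (C quarter) (C three))))))
  where
  lemma : ∀ a b c d → a + b + c + d ≡ (a + c) + (b + d)
  lemma = solve-∀
bite (there {false} m) k with bite m (suc k)
... | inj₁ h       = inj₁ (s≤s h)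
... | inj₂ (e , h) = inj₂ (cong suc e , h)
bite (there {true} {xs} {ys} m) k with bite m 0
... | inj₁ h           = inj₁ h
... | inj₂ (e , h , g) = inj₂ (e , +-monoʳ-≤ (quarter k) h ,
  ≤-trans (≤-reflexive (sym (+-suc (quarter k) (weigh quarter 0 ys))))
    (≤-trans (+-monoʳ-≤ (quarter k) g)
      (≤-trans (m≤m+n _ (three k)) (≤-reflexive (lemma (quarter k) (three k) (weigh quarter 0 xs) (weigh three 0 xs))))))
  where
  lemma : ∀ a b c d → a + (c + d) + b ≡ (a + c) + (b + d)
  lemma = solve-∀

weight-swap₁₂ : ∀ φ s → weight φ s ≡ weight φ (swap₁₂ s)
weight-swap₁₂ φ ⟨ _ , X , Y , Z ⟩ = cong (_+ weigh φ 0 Z) (+-comm (weigh φ 0 X) (weigh φ 0 Y))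

weight-swap₁₃ : ∀ φ s → weight φ s ≡ weight φ (swap₁₃ s)
weight-swap₁₃ φ ⟨ _ , X , Y , Z ⟩ = lemma (weigh φ 0 X) (weigh φ 0 Y) (weigh φ 0 Z)
  where
  lemma : ∀ a b c → a + b + c ≡ c + b + a
  lemma = solve-∀

Bite₃ : Position → Position → Set
Bite₃ s t = size s ≤ 2 + size t ⊎
  (size s ≡ 3 + size t × weight quarter t ≤ weight quarter s × suc (weight quarter t) ≤ weight quarter s + weight three s)

bite₃-arm : ∀ {X X′} Y Z → Bite X X′ 0 → Bite₃ ⟨ true , X , Y , Z ⟩ ⟨ true , X′ , Y , Z ⟩
bite₃-arm Y Z (inj₁ h) = inj₁ (+-monoˡ-≤ (falses Z) (+-monoˡ-≤ (falses Y) h))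
bite₃-arm {X} Y Z (inj₂ (e , h , g)) = inj₂ (cong (λ n → n + falses Y + falses Z) e ,
  +-monoˡ-≤ (weigh quarter 0 Z) (+-monoˡ-≤ (weigh quarter 0 Y) h) ,
  ≤-trans (+-monoˡ-≤ (weigh quarter 0 Z) (+-monoˡ-≤ (weigh quarter 0 Y) g))
    (≤-trans (m≤m+n _ (weigh three 0 Y + weigh three 0 Z))
      (≤-reflexive (lemma (weigh quarter 0 X) (weigh three 0 X) (weigh quarter 0 Y) (weigh three 0 Y) (weigh quarter 0 Z) (weigh three 0 Z)))))
  where
  lemma : ∀ a a′ b b′ c c′ → a + a′ + b + c + (b′ + c′) ≡ a + b + c + (a′ + b′ + c′)
  lemma = solve-∀

bite₃-swap₁₂ : ∀ {s t} → Bite₃ s t → Bite₃ (swap₁₂ s) (swap₁₂ t)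
bite₃-swap₁₂ {s} {t} h
  rewrite size-swap₁₂ s | size-swap₁₂ t | weight-swap₁₂ quarter s | weight-swap₁₂ quarter t | weight-swap₁₂ three s = h

bite₃-swap₁₃ : ∀ {s t} → Bite₃ s t → Bite₃ (swap₁₃ s) (swap₁₃ t)
bite₃-swap₁₃ {s} {t} h
  rewrite size-swap₁₃ s | size-swap₁₃ t | weight-swap₁₃ quarter s | weight-swap₁₃ quarter t | weight-swap₁₃ three s = h

Played Open : Position → Set
Played ⟨ c , X , Y , Z ⟩ = c ≡ true × top X ≡ true × top Y ≡ true × top Z ≡ true
Open ⟨ c , X , Y , Z ⟩   = c ≡ false × top X ≡ false × top Y ≡ false × top Z ≡ false

played-bite : ∀ {s t} → Played s → s ⟶ t → Played t × Bite₃ s t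
played-bite (refl , x , y , z) (centre e) with () ← trans (sym (cong₂ _∧_ x (cong₂ _∧_ y z))) e
played-bite (refl , x , y , z) (arm₁ {X = X} {X′} {Y} {Z} m) with centre-arm m refl
... | refl = (refl , top-arm m x , y , z) , bite₃-arm {X} {X′} Y Z (bite m 0)
played-bite (refl , x , y , z) (arm₂ {X = X} {Y} {Y′} {Z} m) with centre-arm m refl
... | refl = (refl , x , top-arm m y , z) , bite₃-swap₁₂ {⟨ true , Y , X , Z ⟩} {⟨ true , Y′ , X , Z ⟩} (bite₃-arm {Y} {Y′} X Z (bite m 0))
played-bite (refl , x , y , z) (arm₃ {X = X} {Y} {Z} {Z′} m) with centre-arm m refl
... | refl = (refl , x , y , top-arm m z) , bite₃-swap₁₃ {⟨ true , Z , Y , X ⟩} {⟨ true , Z′ , Y , X ⟩} (bite₃-arm {Z} {Z′} Y X (bite m 0))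

-- Quantifying over `φ` lets one move be measured by size, `quarter` and `three` alike. The term
-- `φ 0` is the empty run in front of the newly dominated vertex.
Trimmed : ℕ → List ℕ → List ℕ → Set
Trimmed r ls ls′ = ∀ φ → sum (map φ ls′) + φ r ≡ φ 0 + sum (map φ ls) + φ (r ∸ 1)

clear-run : ∀ l xs → Clear (replicate l false ++ true ∷ xs) → Fresh xs
clear-run zero    xs w = w
clear-run (suc l) xs w = clear-run l xs w

cons-trimmed : ∀ {r} l ls ls′ → Trimmed r ls ls′ → Trimmed r (l ∷ ls) (l ∷ ls′)
cons-trimmed {r} l ls ls′ e φ =
  trans (+-assoc (φ l) _ _) (trans (cong (φ l +_) (e φ)) (lemma (φ l) (φ 0) (sum (map φ ls)) (φ (r ∸ 1))))
  where
  lemma : ∀ a z s b → a + (z + s + b) ≡ z + (a + s) + b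
  lemma = solve-∀

-- The near end of the run is taken by a window whose other two entries are dominated. A nonempty
-- run passed on the way ends in a dominated pair, so the next length in the list is 0.
trim : ∀ {r ls} → r ∈ ls → 1 ≤ r → Solid (bits ls) → ∃[ ls′ ] (true ∷ true ∷ bits ls ⇝ true ∷ true ∷ bits ls′ × Trimmed r ls ls′)
trim {suc m} {_ ∷ ls} (here refl) _ w = 0 ∷ m ∷ ls , here refl , λ φ → lemma (φ 0) (φ m) (sum (map φ ls)) (φ (suc m))
  where
  lemma : ∀ z a s b → z + (a + s) + b ≡ z + (b + s) + a
  lemma = solve-∀
trim {r} {zero ∷ ls} (there i) p w with trim i p w
... | ls′ , m , e = 0 ∷ ls′ , there m , cons-trimmed {r} 0 ls ls′ e
trim {ls = suc l ∷ ls} (there i) p w with ls | i | clear-run l (bits ls) w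
... | 0 ∷ ls₂     | here refl | _ = ⊥-elim (n≮0 p)
... | suc _ ∷ ls₂ | _         | ()
trim {r} {suc l ∷ ls} (there i) p w | 0 ∷ ls₂ | there j | w₂ with trim j p w₂
... | ls₂′ , m , e = suc l ∷ 0 ∷ ls₂′ , there (there (prefix-⇝ (suc l) m)) ,
  cons-trimmed {r} (suc l) (0 ∷ ls₂) (0 ∷ ls₂′) (cons-trimmed {r} 0 ls₂ ls₂′ e)

weigh-id : ∀ k X → weigh id k X ≡ k + falses X
weigh-id k []          = sym (+-identityʳ k)
weigh-id k (false ∷ X) = trans (weigh-id (suc k) X) (sym (+-suc k (falses X)))
weigh-id k (true ∷ X)  = cong (k +_) (weigh-id 0 X)

falses-bits : ∀ ls → falses (bits ls) ≡ sum (map id ls)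
falses-bits ls = trans (sym (weigh-id 0 (bits ls))) (weigh-bits id refl ls)

weigh-played : ∀ φ → φ 0 ≡ 0 → ∀ ls → weigh φ 0 (true ∷ bits ls) ≡ sum (map φ ls)
weigh-played φ z ls = trans (cong (_+ weigh φ 0 (bits ls)) z) (weigh-bits φ z ls)

record TrimMove (r : ℕ) (s t : Position) : Set where
  field
    move         : s ⟶ t
    dominatesOne : size s ≡ suc (size t)
    effect       : ∀ φ → φ 0 ≡ 0 → weight φ t + φ r ≡ weight φ s + φ (r ∸ 1)

trim-move₁ : ∀ {r xs} Y Z → r ∈ xs → 1 ≤ r → Solid (bits xs) →
             ∃[ t ] TrimMove r ⟨ true , true ∷ bits xs , Y , Z ⟩ t
trim-move₁ {suc r} {xs} Y Z i p w with trim i p w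
... | xs′ , m , e = ⟨ true , true ∷ bits xs′ , Y , Z ⟩ , record
  { move = arm₁ m ; dominatesOne = cong (λ n → n + falses Y + falses Z) one ; effect = eff }
  where
  one : falses (bits xs) ≡ suc (falses (bits xs′))
  one = trans (falses-bits xs) (trans (+-cancelʳ-≡ r _ _ (trans (sym (e id)) (+-suc (sum (map id xs′)) r)))
    (cong suc (sym (falses-bits xs′))))
  eff : ∀ φ → φ 0 ≡ 0 → weight φ ⟨ true , true ∷ bits xs′ , Y , Z ⟩ + φ (suc r) ≡ weight φ ⟨ true , true ∷ bits xs , Y , Z ⟩ + φ r
  eff φ z =
    trans (lemma (weigh φ 0 (true ∷ bits xs′)) (weigh φ 0 Y) (weigh φ 0 Z) (φ (suc r)))
      (trans (cong (λ n → n + weigh φ 0 Y + weigh φ 0 Z) (trans (cong (_+ φ (suc r)) (weigh-played φ z xs′))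
          (trans (e φ) (cong (_+ φ r) (trans (cong (_+ sum (map φ xs)) z) (sym (weigh-played φ z xs)))))))
        (sym (lemma (weigh φ 0 (true ∷ bits xs)) (weigh φ 0 Y) (weigh φ 0 Z) (φ r))))
    where
    lemma : ∀ a b c d → a + b + c + d ≡ a + d + b + c
    lemma = solve-∀

trim-swap₁₂ : ∀ {r s t} → TrimMove r s t → TrimMove r (swap₁₂ s) (swap₁₂ t)
trim-swap₁₂ {r} {s} {t} M = record
  { move = swap₁₂-step move ; dominatesOne = trans (sym (size-swap₁₂ s)) (trans dominatesOne (cong suc (size-swap₁₂ t)))
  ; effect = λ φ z → subst₂ (λ u v → u + φ r ≡ v + φ (r ∸ 1)) (weight-swap₁₂ φ t) (weight-swap₁₂ φ s) (effect φ z) }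
  where open TrimMove M

trim-swap₁₃ : ∀ {r s t} → TrimMove r s t → TrimMove r (swap₁₃ s) (swap₁₃ t)
trim-swap₁₃ {r} {s} {t} M = record
  { move = swap₁₃-step move ; dominatesOne = trans (sym (size-swap₁₃ s)) (trans dominatesOne (cong suc (size-swap₁₃ t)))
  ; effect = λ φ z → subst₂ (λ u v → u + φ r ≡ v + φ (r ∸ 1)) (weight-swap₁₃ φ t) (weight-swap₁₃ φ s) (effect φ z) }
  where open TrimMove M

trim-move : ∀ {r} xs ys zs → Solid (bits xs) → Solid (bits ys) → Solid (bits zs) → r ∈ xs ++ ys ++ zs → 1 ≤ r →
            ∃[ t ] TrimMove r ⟨ true , true ∷ bits xs , true ∷ bits ys , true ∷ bits zs ⟩ t
trim-move xs ys zs wx wy wz i p with ∈-++₃ xs ys i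
... | inj₁ j        = trim-move₁ (true ∷ bits ys) (true ∷ bits zs) j p wx
... | inj₂ (inj₁ j) = let t , M = trim-move₁ (true ∷ bits xs) (true ∷ bits zs) j p wy in swap₁₂ t , trim-swap₁₂ M
... | inj₂ (inj₂ j) = let t , M = trim-move₁ (true ∷ bits ys) (true ∷ bits xs) j p wz in swap₁₃ t , trim-swap₁₃ M

data TrimClass (r : ℕ) : Set where
  lower : 1 ≤ r → suc (quarter (r ∸ 1)) ≡ quarter r → TrimClass r
  ternary : 1 ≤ r → quarter (r ∸ 1) ≡ quarter r → three r ≡ 1 → three (r ∸ 1) ≡ 0 → TrimClass r
  plain : 1 ≤ r → quarter (r ∸ 1) ≡ quarter r → three r ≡ 0 → three (r ∸ 1) ≡ 0 → TrimClass r
  none  : r ≡ 0 → TrimClass r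

trim-class : ∀ r → TrimClass r
trim-class 0 = none refl
trim-class 1 = plain (s≤s z≤n) refl refl refl
trim-class 2 = plain (s≤s z≤n) refl refl refl
trim-class 3 = ternary (s≤s z≤n) refl refl refl
trim-class 4 = lower (s≤s z≤n) refl
trim-class (suc (suc (suc (suc (suc r))))) with trim-class (suc r)
... | lower _ e     = lower (s≤s z≤n) (cong suc e)
... | ternary _ e f g = ternary (s≤s z≤n) (cong suc e) f g
... | plain _ e f g = plain (s≤s z≤n) (cong suc e) f g

-- In order of preference: lower the sum of the quarters, destroy a run of length
-- 3 mod 4 (where Dominator could take three vertices without lowering that sum),
-- or shorten any other run.
data TrimChoice (R : List ℕ) : Set where
  lower : ∀ {r} → r ∈ R → 1 ≤ r → suc (quarter (r ∸ 1)) ≡ quarter r → TrimChoice R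
  ternary : ∀ {r} → r ∈ R → 1 ≤ r → quarter (r ∸ 1) ≡ quarter r → three r ≡ 1 → three (r ∸ 1) ≡ 0 → TrimChoice R
  plain : ∀ {r} → sum (map three R) ≡ 0 → r ∈ R → 1 ≤ r → quarter (r ∸ 1) ≡ quarter r → three r ≡ 0 → three (r ∸ 1) ≡ 0 → TrimChoice R
  none  : sum (map id R) ≡ 0 → sum (map three R) ≡ 0 → TrimChoice R

trim-choice : ∀ R → TrimChoice R
trim-choice [] = none refl refl
trim-choice (r ∷ R) = combine (trim-class r) (trim-choice R)
  where
  combine : TrimClass r → TrimChoice R → TrimChoice (r ∷ R)
  combine (lower p e)     _                   = lower (here refl) p e
  combine _               (lower i p e)       = lower (there i) p e
  combine (ternary p e f g) _                   = ternary (here refl) p e f g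
  combine _               (ternary i p e f g)   = ternary (there i) p e f g
  combine (plain p e f g) (plain z _ _ _ _ _) = plain (cong₂ _+_ f z) (here refl) p e f g
  combine (plain p e f g) (none _ z)          = plain (cong₂ _+_ f z) (here refl) p e f g
  combine (none refl)     (plain z i p e f g) = plain z (there i) p e f g
  combine (none refl)     (none y z)          = none y z

-- A move of at most two vertices at size `4 * m` leaves `2 * m` moves, one more than a move of
-- three would.
tempoS-4* : ∀ {n} m → 4 * m ≤ 2 + n → 2 * m ≤ tempoS n
tempoS-4* zero    h = z≤n
tempoS-4* {n} (suc m) h = ≤-trans (≤-reflexive (trans (*-suc 2 m) (cong (2 +_) (sym (tempoD-4* m)))))
  (≤-trans (s≤s (lemma m)) (tempoS-mono {suc (suc (4 * m))} (+-cancelˡ-≤ 2 _ _ (≤-trans (≤-reflexive (sym (*-suc 4 m))) h))))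
  where
  lemma : ∀ m → suc (tempoD (4 * m)) ≤ tempoD (suc (4 * m))
  lemma zero = ≤-refl
  lemma (suc m) rewrite *-suc 4 m = s≤s (s≤s (lemma m))

blocked-exists : ∀ {s n} → Reachable s → Blocked s → size s ≡ suc n → ∃[ t ] s ⟶ t
blocked-exists R B e with blocked-move R B
... | inj₁ z with () ← trans (sym z) e
... | inj₂ (inj₁ (t , m , _)) = t , m
... | inj₂ (inj₂ (t , m , _)) = t , m

weight-played : ∀ φ → φ 0 ≡ 0 → ∀ xs ys zs →
  weight φ ⟨ true , true ∷ bits xs , true ∷ bits ys , true ∷ bits zs ⟩ ≡ sum (map φ (xs ++ ys ++ zs))
weight-played φ z xs ys zs = trans
  (cong₂ _+_ (cong₂ _+_ (weigh-played φ z xs) (weigh-played φ z ys)) (weigh-played φ z zs)) (sym (sum-map-++₃ φ xs ys zs))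

size-played : ∀ xs ys zs → size ⟨ true , true ∷ bits xs , true ∷ bits ys , true ∷ bits zs ⟩ ≡ sum (map id (xs ++ ys ++ zs))
size-played xs ys zs = trans (cong₂ _+_ (cong₂ _+_ (falses-bits xs) (falses-bits ys)) (falses-bits zs)) (sym (sum-map-++₃ id xs ys zs))

quarter-three-size : ∀ X Y Z → let s = ⟨ true , X , Y , Z ⟩ in 4 * weight quarter s + 3 * weight three s ≤ size s
quarter-three-size X Y Z = ≤-trans
  (≤-reflexive (lemma (weigh quarter 0 X) (weigh quarter 0 Y) (weigh quarter 0 Z) (weigh three 0 X) (weigh three 0 Y) (weigh three 0 Z)))
  (+-mono-≤ (+-mono-≤ (quarter-three-falses 0 X) (quarter-three-falses 0 Y)) (quarter-three-falses 0 Z))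
  where
  lemma : ∀ a b c x y z → 4 * (a + b + c) + 3 * (x + y + z) ≡ (4 * a + 3 * x) + (4 * b + 3 * y) + (4 * c + 3 * z)
  lemma = solve-∀

-- The residues add up to 1 mod 4; two threes make the sum at least 6, hence at least 9.
two-threes : ∀ {h θ n} m → 4 * h + 3 * θ ≤ n → n ≡ 1 + 4 * m → 2 ≤ θ → 2 + h ≤ m
two-threes {h} {θ} m k refl p = *-cancelˡ-< 4 (suc h) m
  (≤-trans (≤-reflexive (lemma h)) (≤-pred (≤-trans (≤-reflexive (sym (+-suc (4 * h) 5))) (≤-trans (+-monoʳ-≤ (4 * h) (*-monoʳ-≤ 3 p)) k))))
  where
  lemma : ∀ h → suc (4 * suc h) ≡ 4 * h + 5
  lemma = solve-∀

-- The bounds exceed plain tempo by one move. The conditions say that the residues sum to at least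
-- 8, or at least 4 with no residue 3, when Dominator moves, and to at least 5 when Staller moves.
-- They fail at `m = 0`, so Dominator cannot take three every time; the first smaller move yields
-- the extra one.
playedD : ∀ b m {s} → Reachable s → Played s → size s ≡ 4 * m →
  2 + weight quarter s ≤ m ⊎ (1 + weight quarter s ≤ m × weight three s ≡ 0) → b ≤ 1 + 2 * m → AtLeastD b s
playedS : ∀ b m {s} → Reachable s → Played s → size s ≡ 1 + 4 * m → 1 + weight quarter s ≤ m → b ≤ 2 + 2 * m → AtLeastS b s

playedD zero    m       R P e c h = tt
playedD (suc b) zero    R P e (inj₁ ()) h
playedD (suc b) zero    R P e (inj₂ (() , _)) h
playedD (suc b) (suc m) {s} R P e c h = blocked-exists R (inj₁ (proj₁ P)) (trans e (*-suc 4 m)) , reply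
  where
  reply : ∀ t → s ⟶ t → AtLeastS b t
  reply t mv with played-bite P mv
  ... | P′ , inj₁ k = blockedS b (reachable-step mv R) (inj₁ (proj₁ P′))
    (≤-trans (≤-pred h) (tempoS-4* (suc m) (subst (_≤ 2 + size t) e k)))
  ... | P′ , inj₂ (k , l , g) = playedS b m (reachable-step mv R) P′
    (+-cancelˡ-≡ 3 _ _ (trans (sym k) (trans e (*-suc 4 m)))) (quarters c)
    (≤-trans (≤-pred h) (≤-reflexive (*-suc 2 m)))
    where
    quarters : 2 + weight quarter s ≤ suc m ⊎ (1 + weight quarter s ≤ suc m × weight three s ≡ 0) → 1 + weight quarter t ≤ m
    quarters (inj₁ p)       = ≤-trans (s≤s l) (≤-pred p)
    quarters (inj₂ (p , z)) = ≤-trans g (≤-trans (≤-reflexive (trans (cong (weight quarter s +_) z) (+-identityʳ _))) (≤-pred p))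

playedS zero    m R P e c h = tt
playedS (suc b) m {⟨ .true , true ∷ X , true ∷ Y , true ∷ Z ⟩} R P@(refl , _) e c h
  with proj₁ (parse X) (padded (first R)) | proj₁ (parse Y) (padded (second R)) | proj₁ (parse Z) (padded (third R))
... | xs , refl | ys , refl | zs , refl = choose (trim-choice (xs ++ ys ++ zs))
  where
  s = ⟨ true , true ∷ bits xs , true ∷ bits ys , true ∷ bits zs ⟩
  go : ∀ {r} → r ∈ xs ++ ys ++ zs → 1 ≤ r →
       (∀ t → TrimMove r s t → 2 + weight quarter t ≤ m ⊎ (1 + weight quarter t ≤ m × weight three t ≡ 0)) → AtLeastS (suc b) s
  go i p q with trim-move xs ys zs (wide (first R)) (wide (second R)) (wide (third R)) i p
  ... | t , M = t , move , playedD b m (reachable-step move R) (proj₁ (played-bite P move))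
                  (suc-injective (trans (sym dominatesOne) e)) (q t M) (≤-pred h)
    where open TrimMove M
  same-quarter : ∀ {r t} → TrimMove r s t → quarter (r ∸ 1) ≡ quarter r → weight quarter t ≡ weight quarter s
  same-quarter {r} {t} M f = +-cancelʳ-≡ (quarter r) _ _ (trans (TrimMove.effect M quarter refl) (cong (weight quarter s +_) f))
  choose : TrimChoice (xs ++ ys ++ zs) → AtLeastS (suc b) s
  choose (lower {r} i p f) = go i p λ t M → inj₁ (≤-trans (≤-reflexive (cong suc (+-cancelʳ-≡ (quarter (r ∸ 1)) _ _
    (trans (sym (+-suc (weight quarter t) (quarter (r ∸ 1)))) (trans (cong (weight quarter t +_) f) (TrimMove.effect M quarter refl)))))) c)
  choose (plain {r} z i p f g k) = go i p λ t M → inj₂ (≤-trans (≤-reflexive (cong suc (same-quarter M f))) c ,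
    n≤0⇒n≡0 (≤-trans (m≤m+n (weight three t) (three r)) (≤-reflexive
      (trans (TrimMove.effect M three refl) (cong₂ _+_ (trans (weight-played three refl xs ys zs) z) k)))))
  choose (ternary {r} i p f g k) = go i p λ t M → split t M (weight three t) refl
    where
    split : ∀ t → TrimMove r s t → ∀ θ → weight three t ≡ θ → 2 + weight quarter t ≤ m ⊎ (1 + weight quarter t ≤ m × weight three t ≡ 0)
    split t M zero    z = inj₂ (≤-trans (≤-reflexive (cong suc (same-quarter M f))) c , z)
    split t M (suc θ) z = inj₁ (≤-trans (≤-reflexive (cong (2 +_) (same-quarter M f)))
      (two-threes m (quarter-three-size (true ∷ bits xs) (true ∷ bits ys) (true ∷ bits zs)) e (≤-trans (s≤s (s≤s z≤n)) (≤-reflexive threes))))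
      where
      threes : 2 + θ ≡ weight three s
      threes = trans (trans (trans (+-comm 1 (suc θ)) (cong (_+ 1) (sym z))) (cong (weight three t +_) (sym g)))
        (trans (TrimMove.effect M three refl) (trans (cong (weight three s +_) k) (+-identityʳ _)))
  choose (none z _) with () ← trans (sym (trans (size-played xs ys zs) z)) e
playedS (suc b) m {⟨ _ , [] , _ , _ ⟩} R P e c h with () ← proj₂ (order (first R))
playedS (suc b) m {⟨ _ , _ , [] , _ ⟩} R P e c h with () ← proj₂ (order (second R))
playedS (suc b) m {⟨ _ , _ , _ , [] ⟩} R P e c h with () ← proj₂ (order (third R))
playedS (suc b) m {⟨ _ , false ∷ _ , _ , _ ⟩} R (_ , () , _) e c h
playedS (suc b) m {⟨ _ , _ , false ∷ _ , _ ⟩} R (_ , _ , () , _) e c h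
playedS (suc b) m {⟨ _ , _ , _ , false ∷ _ ⟩} R (_ , _ , _ , ()) e c h

-- Play while the centre and its neighbours are undominated

hc : List Bool → ℕ
hc X = weigh quarter 0 (cover X)

-- The run in front of `X` has `suc k` vertices, counted as if the centre had been played. In
-- `neutral` the quarters stay the same, but the last field records a vertex that belongs to a
-- residue.
data Scan (k : ℕ) (X : List Bool) : Set where
  untouched : suc (falses X) ≡ length X → Scan k X
  good      : ∀ {X′} → false ∷ X ⇝ X′ → falses X ≡ falses X′ → weigh quarter k X′ < weigh quarter (suc k) X → Scan k X
  neutral   : ∀ {X′} → false ∷ X ⇝ X′ → falses X ≡ falses X′ → weigh quarter k X′ ≡ weigh quarter (suc k) X →
              suc (4 * weigh quarter (suc k) X) ≤ suc k + falses X → Scan k X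

quarter-step : ∀ k → quarter k < quarter (suc k) ⊎ (quarter k ≡ quarter (suc k) × suc (4 * quarter (suc k)) ≤ suc k)
quarter-step 0 = inj₂ (refl , ≤ᵇ⇒≤ _ _ tt)
quarter-step 1 = inj₂ (refl , ≤ᵇ⇒≤ _ _ tt)
quarter-step 2 = inj₂ (refl , ≤ᵇ⇒≤ _ _ tt)
quarter-step 3 = inj₁ ≤-refl
quarter-step (suc (suc (suc (suc k)))) with quarter-step k
... | inj₁ h       = inj₁ (s≤s h)
... | inj₂ (e , h) = inj₂ (cong suc e , ≤-trans (≤-reflexive (cong suc (*-suc 4 (quarter (suc k))))) (+-monoʳ-≤ 4 h))

scan : ∀ k X → Clear X → Padded false X → Scan k X
scan k (true ∷ [])       w p = untouched refl
scan k (true ∷ true ∷ X) w p with quarter-step k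
... | inj₁ h       = good (here refl) refl (+-monoˡ-< (weigh quarter 0 X) h)
... | inj₂ (e , h) = neutral (here refl) refl (cong (_+ weigh quarter 0 X) e)
  (≤-trans (≤-reflexive (cong suc (*-distribˡ-+ 4 (quarter (suc k)) (weigh quarter 0 X)))) (+-mono-≤ h (quarter-falses X)))
scan k (false ∷ X) w p with scan (suc k) X w p
... | untouched e     = untouched (cong suc e)
... | good m e h      = good (there m) (cong suc e) h
... | neutral m e h c = neutral (there m) (cong suc e) h (≤-trans c (≤-reflexive (sym (+-suc (suc k) (falses X)))))

data Idle (X : List Bool) : Set where
  neutral   : ∀ {X′} → X ⇝ X′ → falses X ≡ suc (falses X′) → top X′ ≡ false → hc X′ ≤ hc X → Idle X
  untouched : ∀ {X′} m → falses X ≡ 4 * suc m → false ∷ X ⇝ true ∷ X′ → falses (false ∷ X) ≡ 3 + falses (true ∷ X′) → Idle X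

data ArmMove (X : List Bool) : Set where
  good : ∀ {X′} → X ⇝ X′ → falses X ≡ suc (falses X′) → top X′ ≡ true ⊎ (top X′ ≡ false × hc X′ < hc X) → ArmMove X
  idle : 2 + 4 * hc X ≤ falses X → Idle X → ArmMove X

arm-scan : ∀ {X} → Arm false X → top X ≡ false → ArmMove X
arm-scan {false ∷ true ∷ true ∷ X} (arm p w l) e = good (here refl) refl (inj₁ refl)
arm-scan {false ∷ true ∷ []} (arm p w (k , ())) e
arm-scan {false ∷ true ∷ false ∷ X} (arm p () l) e
arm-scan {false ∷ []} (arm p w (k , ())) e
arm-scan {false ∷ false ∷ X} (arm p w (k , l)) e with scan 0 X w p
... | good {true ∷ X′} m f h     = good (there m) (cong (2 +_) f) (inj₂ (refl , h))
... | good {false ∷ X′} m f h    = good (there m) (cong (2 +_) f) (inj₂ (refl , h))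
... | good {[]} () f h
... | neutral {X′} m f h c = idle (s≤s c) (neutral (there m) (cong (2 +_) f) refl (≤-reflexive h))
... | untouched f = idle credit (untouched {X′ = true ∷ true ∷ X} k size-X (here refl) refl)
  where
  size-X : 2 + falses X ≡ 4 * suc k
  size-X = trans (cong suc f) (trans (suc-injective l) (sym (*-suc 4 k)))
  credit : 2 + 4 * weigh quarter 1 X ≤ 2 + falses X
  credit = ≤-trans (+-monoʳ-≤ 2 (*-monoʳ-≤ 4 {weigh quarter 1 X} {k} (≤-pred (*-cancelˡ-< 4 _ (suc k)
      (≤-trans (s≤s (quarter-bound 1 X)) (≤-reflexive size-X))))))
    (≤-trans (m≤m+n _ 2) (≤-reflexive (trans (+-comm (2 + 4 * k) 2) (trans (sym (*-suc 4 k)) (sym size-X)))))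
    where
    quarter-bound : ∀ k X → 4 * weigh quarter k X ≤ k + falses X
    quarter-bound k X = ≤-trans (m≤m+n _ _) (quarter-three-falses k X)

-- The 7 in `neutral` is the centre plus two vertices per arm: the one that playing the centre would
-- take and one in a residue. It is available because `neutral` is chosen only when all three arms
-- are idle. In `untouched` nothing has been dominated, so the size is 1 mod 4.
data OpenMove (s : Position) : Set where
  good      : ∀ t → s ⟶ t → size s ≡ suc (size t) →
              Blocked t ⊎ (Open t × weight quarter (play-centre t) < weight quarter (play-centre s)) → OpenMove s
  neutral   : ∀ t → s ⟶ t → size s ≡ suc (size t) → Open t →
              weight quarter (play-centre t) ≤ weight quarter (play-centre s) →
              7 + 4 * weight quarter (play-centre s) ≤ size s → OpenMove s
  untouched : ∀ t m → s ⟶ t → Blocked t → size s ≡ 3 + size t → size s ≡ 5 + 4 * m → OpenMove s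

open-move : ∀ {s} → Reachable s → Open s → OpenMove s
open-move {⟨ .false , X , Y , Z ⟩} R (refl , x , y , z) = go (arm-scan (first R) x) (arm-scan (second R) y) (arm-scan (third R) z)
  where
  s = ⟨ false , X , Y , Z ⟩
  credits : 2 + 4 * hc X ≤ falses X → 2 + 4 * hc Y ≤ falses Y → 2 + 4 * hc Z ≤ falses Z → 7 + 4 * weight quarter (play-centre s) ≤ size s
  credits a b c = ≤-trans (≤-reflexive (lemma (hc X) (hc Y) (hc Z))) (s≤s (+-mono-≤ (+-mono-≤ a b) c))
    where
    lemma : ∀ a b c → 7 + 4 * (a + b + c) ≡ suc ((2 + 4 * a) + (2 + 4 * b) + (2 + 4 * c))
    lemma = solve-∀
  go : ArmMove X → ArmMove Y → ArmMove Z → OpenMove s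
  go (good {X′} m e h) _ _ = good ⟨ false , X′ , Y , Z ⟩ (arm₁ (there m)) (cong (λ n → suc (n + falses Y + falses Z)) e) (status h)
    where
    status : top X′ ≡ true ⊎ (top X′ ≡ false × hc X′ < hc X) → Blocked ⟨ false , X′ , Y , Z ⟩ ⊎ (Open ⟨ false , X′ , Y , Z ⟩ × weight quarter (play-centre ⟨ false , X′ , Y , Z ⟩) < weight quarter (play-centre s))
    status (inj₁ f)       = inj₁ (inj₂ (inj₁ f))
    status (inj₂ (f , h)) = inj₂ ((refl , f , y , z) , +-monoˡ-< (hc Z) (+-monoˡ-< (hc Y) h))
  go _ (good {Y′} m e h) _ = good ⟨ false , X , Y′ , Z ⟩ (arm₂ (there m))
    (cong suc (trans (cong (λ n → falses X + n + falses Z) e) (cong (_+ falses Z) (+-suc (falses X) (falses Y′))))) (status h)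
    where
    status : top Y′ ≡ true ⊎ (top Y′ ≡ false × hc Y′ < hc Y) → Blocked ⟨ false , X , Y′ , Z ⟩ ⊎ (Open ⟨ false , X , Y′ , Z ⟩ × weight quarter (play-centre ⟨ false , X , Y′ , Z ⟩) < weight quarter (play-centre s))
    status (inj₁ f)       = inj₁ (inj₂ (inj₂ (inj₁ f)))
    status (inj₂ (f , h)) = inj₂ ((refl , x , f , z) , +-monoˡ-< (hc Z) (+-monoʳ-< (hc X) h))
  go _ _ (good {Z′} m e h) = good ⟨ false , X , Y , Z′ ⟩ (arm₃ (there m))
    (cong suc (trans (cong (falses X + falses Y +_) e) (+-suc (falses X + falses Y) (falses Z′)))) (status h)
    where
    status : top Z′ ≡ true ⊎ (top Z′ ≡ false × hc Z′ < hc Z) → Blocked ⟨ false , X , Y , Z′ ⟩ ⊎ (Open ⟨ false , X , Y , Z′ ⟩ × weight quarter (play-centre ⟨ false , X , Y , Z′ ⟩) < weight quarter (play-centre s))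
    status (inj₁ f)       = inj₁ (inj₂ (inj₂ (inj₂ f)))
    status (inj₂ (f , h)) = inj₂ ((refl , x , y , f) , +-monoʳ-< (hc X + hc Y) h)
  go (idle a (neutral {X′} m e f h)) (idle b _) (idle c _) =
    neutral ⟨ false , X′ , Y , Z ⟩ (arm₁ (there m)) (cong (λ n → suc (n + falses Y + falses Z)) e)
      (refl , f , y , z) (+-monoˡ-≤ (hc Z) (+-monoˡ-≤ (hc Y) h)) (credits a b c)
  go (idle a _) (idle b (neutral {Y′} m e f h)) (idle c _) =
    neutral ⟨ false , X , Y′ , Z ⟩ (arm₂ (there m))
      (cong suc (trans (cong (λ n → falses X + n + falses Z) e) (cong (_+ falses Z) (+-suc (falses X) (falses Y′)))))
      (refl , x , f , z) (+-monoˡ-≤ (hc Z) (+-monoʳ-≤ (hc X) h)) (credits a b c)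
  go (idle a _) (idle b _) (idle c (neutral {Z′} m e f h)) =
    neutral ⟨ false , X , Y , Z′ ⟩ (arm₃ (there m))
      (cong suc (trans (cong (falses X + falses Y +_) e) (+-suc (falses X + falses Y) (falses Z′))))
      (refl , x , y , f) (+-monoʳ-≤ (hc X + hc Y) h) (credits a b c)
  go (idle _ (untouched {X′} i e m f)) (idle _ (untouched j e′ _ _)) (idle _ (untouched k e″ _ _)) =
    untouched ⟨ true , X′ , Y , Z ⟩ (i + j + k + 2) (arm₁ m) (inj₁ refl) (cong (λ n → n + falses Y + falses Z) f) total
    where
    total : suc (falses X) + falses Y + falses Z ≡ 5 + 4 * (i + j + k + 2)
    total rewrite e | e′ | e″ = lemma i j k
      where
      lemma : ∀ i j k → suc (4 * suc i) + 4 * suc j + 4 * suc k ≡ 5 + 4 * (i + j + k + 2)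
      lemma = solve-∀

pred-≤3 : ∀ {m n} → m ≤ 3 + n → m ∸ 1 ≤ 3 + (n ∸ 1)
pred-≤3 {n = zero}  h = ≤-trans (m∸n≤m _ 1) h
pred-≤3 {n = suc n} h = ∸-monoˡ-≤ 1 h

status : ∀ s → Blocked s ⊎ Open s
status ⟨ true , X , Y , Z ⟩ = inj₁ (inj₁ refl)
status ⟨ false , X , Y , Z ⟩ with top X in x | top Y in y | top Z in z
... | true  | _     | _     = inj₁ (inj₂ (inj₁ refl))
... | false | true  | _     = inj₁ (inj₂ (inj₂ (inj₁ refl)))
... | false | false | true  = inj₁ (inj₂ (inj₂ (inj₂ refl)))
... | false | false | false = inj₂ (refl , refl , refl , refl)

play-centre-step : ∀ {s} → Open s → s ⟶ play-centre s
play-centre-step (refl , _) = centre refl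

tempoS-pred : ∀ {b n} → suc b ≤ tempoS n → b ≤ tempoD (n ∸ 1)
tempoS-pred {n = suc n} h = ≤-pred h

-- If playing the centre still dominates four vertices, one vertex is given up.
slackD : ∀ b {s} → Reachable s → b ≤ tempoD (size s ∸ 1) → AtLeastD b s
slackS : ∀ b {s} → Reachable s → b ≤ tempoS (size s ∸ 1) → AtLeastS b s
slackD zero    R h = tt
slackD (suc b) {s} R h with status s
... | inj₁ B = blockedD (suc b) R B (≤-trans h (tempoD-mono (m∸n≤m (size s) 1)))
... | inj₂ O = (play-centre s , play-centre-step O) , reply
  where
  reply : ∀ t → s ⟶ t → AtLeastS b t
  reply t m with size-step≤ m
  ... | inj₁ k       = slackS b (reachable-step m R) (tempo-reply h (pred-≤3 k))
  ... | inj₂ (e , k) = blockedS b (reachable-step m R) (inj₁ e) (tempo-reply h (∸-monoˡ-≤ 1 k))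
slackS zero    R h = tt
slackS (suc b) {s} R h with status s
... | inj₁ B = blockedS (suc b) R B (≤-trans h (tempoS-mono (m∸n≤m (size s) 1)))
... | inj₂ O with open-move R O
...   | good t m e _        = t , m , slackD b (reachable-step m R) (tempoS-pred (subst (λ n → suc b ≤ tempoS (n ∸ 1)) e h))
...   | neutral t m e _ _ _ = t , m , slackD b (reachable-step m R) (tempoS-pred (subst (λ n → suc b ≤ tempoS (n ∸ 1)) e h))
-- One of the `5 + 4 * k` vertices is written off as slack, and the `2 + 4 * k` left after Staller's
-- three are worth as many moves as `3 + 4 * k`.
...   | untouched t k m B e f = t , m , blockedD b (reachable-step m R) B
  (≤-trans (≤-pred (subst (λ n → suc b ≤ tempoS (n ∸ 1)) f h))
    (≤-reflexive (trans (tempoD-2≡3 k) (cong tempoD (+-cancelˡ-≡ 3 _ _ (trans (sym f) e))))))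

module _ {K : ℕ} where

  4K≤ : ∀ {n m} → n ≡ 1 + 4 * K → n ≤ 3 + m → 4 * K ≤ 2 + m
  4K≤ refl h = ≤-pred h

  4K≤-pred : ∀ {n m} → n ≡ 1 + 4 * K → n ≤ 2 + m → 4 * K ≤ 2 + (m ∸ 1)
  4K≤-pred {m = zero}  refl h = ≤-trans (≤-pred h) (n≤1+n 1)
  4K≤-pred {m = suc m} refl h = ≤-pred h

Shut : Position → Position → Set
Shut s t = Blocked t × size s ≤ 3 + size t

Inner : Position → Position → Set
Inner s t = Open t × (size s ≤ 2 + size t ⊎ (size s ≡ 3 + size t × weight quarter (play-centre t) ≤ weight quarter (play-centre s)))

open-arm₁ : ∀ {c c′ X X′} Y Z → Open ⟨ c , X , Y , Z ⟩ → c ∷ X ⇝ c′ ∷ X′ →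
            Shut ⟨ c , X , Y , Z ⟩ ⟨ c′ , X′ , Y , Z ⟩ ⊎ Inner ⟨ c , X , Y , Z ⟩ ⟨ c′ , X′ , Y , Z ⟩
open-arm₁ {X = X} {X′} Y Z (refl , x , y , z) m with arm-move m
... | inj₁ (e , _) = inj₁ (inj₁ e , size-arm≤ {X = X} {X′} Y Z m)
open-arm₁ Y Z (refl , x , y , z) m | inj₂ (refl , here {a} {b} {d} {xs} _) = inj₁ (inj₂ (inj₁ refl) , size-arm≤ Y Z m)
open-arm₁ Y Z (refl , refl , y , z) m | inj₂ (refl , there {false} n) with bite n 0
... | inj₁ h           = inj₂ ((refl , refl , y , z) , inj₁ (s≤s (s≤s (+-monoˡ-≤ (falses Z) (+-monoˡ-≤ (falses Y) h)))))
... | inj₂ (e , h , _) = inj₂ ((refl , refl , y , z) , inj₂ (cong (λ n → 2 + (n + falses Y + falses Z)) e ,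
  +-monoˡ-≤ (hc Z) (+-monoˡ-≤ (hc Y) h)))

shut-or-inner-swap₁₂ : ∀ {s t} → Shut s t ⊎ Inner s t → Shut (swap₁₂ s) (swap₁₂ t) ⊎ Inner (swap₁₂ s) (swap₁₂ t)
shut-or-inner-swap₁₂ {s} {t} h rewrite size-swap₁₂ s | size-swap₁₂ t
  | weight-swap₁₂ quarter (play-centre s) | weight-swap₁₂ quarter (play-centre t) with h
... | inj₁ (inj₁ e , k)               = inj₁ (inj₁ e , k)
... | inj₁ (inj₂ (inj₁ e) , k)        = inj₁ (inj₂ (inj₂ (inj₁ e)) , k)
... | inj₁ (inj₂ (inj₂ (inj₁ e)) , k) = inj₁ (inj₂ (inj₁ e) , k)
... | inj₁ (inj₂ (inj₂ (inj₂ e)) , k) = inj₁ (inj₂ (inj₂ (inj₂ e)) , k)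
... | inj₂ ((c , x , y , z) , k)      = inj₂ ((c , y , x , z) , k)

shut-or-inner-swap₁₃ : ∀ {s t} → Shut s t ⊎ Inner s t → Shut (swap₁₃ s) (swap₁₃ t) ⊎ Inner (swap₁₃ s) (swap₁₃ t)
shut-or-inner-swap₁₃ {s} {t} h rewrite size-swap₁₃ s | size-swap₁₃ t
  | weight-swap₁₃ quarter (play-centre s) | weight-swap₁₃ quarter (play-centre t) with h
... | inj₁ (inj₁ e , k)               = inj₁ (inj₁ e , k)
... | inj₁ (inj₂ (inj₁ e) , k)        = inj₁ (inj₂ (inj₂ (inj₂ e)) , k)
... | inj₁ (inj₂ (inj₂ (inj₁ e)) , k) = inj₁ (inj₂ (inj₂ (inj₁ e)) , k)
... | inj₁ (inj₂ (inj₂ (inj₂ e)) , k) = inj₁ (inj₂ (inj₁ e) , k)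
... | inj₂ ((c , x , y , z) , k)      = inj₂ ((c , z , y , x) , k)

open-step : ∀ {s t} → Open s → s ⟶ t → t ≡ play-centre s ⊎ Shut s t ⊎ Inner s t
open-step O (centre _) = inj₁ refl
open-step O (arm₁ {Y = Y} {Z} m) = inj₂ (open-arm₁ Y Z O m)
open-step {⟨ c , X , Y , Z ⟩} {⟨ c′ , _ , Y′ , _ ⟩} (e , x , y , z) (arm₂ m) =
  inj₂ (shut-or-inner-swap₁₂ {⟨ c , Y , X , Z ⟩} {⟨ c′ , Y′ , X , Z ⟩} (open-arm₁ X Z (e , y , x , z) m))
open-step {⟨ c , X , Y , Z ⟩} {⟨ c′ , _ , _ , Z′ ⟩} (e , x , y , z) (arm₃ m) =
  inj₂ (shut-or-inner-swap₁₃ {⟨ c , Z , Y , X ⟩} {⟨ c′ , Z′ , Y , X ⟩} (open-arm₁ Y X (e , z , y , x) m))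

size-play-centre : ∀ s → Open s → size s ≡ 4 + size (play-centre s)
size-play-centre ⟨ _ , X , Y , Z ⟩ (refl , x , y , z) = trans (size-centre false X Y Z)
  (cong (_+ size ⟨ true , cover X , cover Y , cover Z ⟩) (cong₂ (λ g h → suc g + h)
    {gap (top X) + gap (top Y)} {2} (cong₂ (λ a b → gap a + gap b) x y) (cong gap z)))

played-centre : ∀ s → Played (play-centre s)
played-centre ⟨ _ , X , Y , Z ⟩ = refl , top-cover X , top-cover Y , top-cover Z

tempoD-1+4* : ∀ m → tempoD (1 + 4 * m) ≡ 1 + 2 * m
tempoD-1+4* zero = refl
tempoD-1+4* (suc m) = trans (cong (λ n → tempoD (1 + n)) (*-suc 4 m))
  (trans (cong (2 +_) (tempoD-1+4* m)) (cong suc (sym (*-suc 2 m))))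

-- The condition on the quarters says that, once the centre is played, the run
-- lengths reduced mod 4 sum up to at least 5.
openD : ∀ b K {s} → Reachable s → Open s → size s ≡ 1 + 4 * K → 2 + weight quarter (play-centre s) ≤ K →
        b ≤ 1 + 2 * K → AtLeastD b s
openS : ∀ b K {s} → Reachable s → Open s → size s ≡ 2 + 4 * K → 1 + weight quarter (play-centre s) ≤ K →
        b ≤ 2 + 2 * K → AtLeastS b s
openD zero    K       R O e h k = tt
openD (suc b) (suc K) {s} R O e (s≤s h) k = (play-centre s , play-centre-step O) , reply
  where
  k′ : b ≤ 2 + 2 * K
  k′ = ≤-trans (≤-pred k) (≤-reflexive (*-suc 2 K))
  reply : ∀ t → s ⟶ t → AtLeastS b t
  reply t m with open-step O m
  ... | inj₁ refl = playedS b K (reachable-step m R) (played-centre s)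
    (+-cancelˡ-≡ 4 _ _ (trans (sym (size-play-centre s O)) (trans e (cong suc (*-suc 4 K))))) h k′
  ... | inj₂ (inj₁ (B , l)) = blockedS b (reachable-step m R) B
    (≤-trans (≤-pred k) (tempoS-4* (suc K) (4K≤ {suc K} e l)))
  -- After a move of at most two there is a vertex to spare, which covers the one given up by
  -- `slackS`.
  ... | inj₂ (inj₂ (O′ , inj₁ l)) = slackS b (reachable-step m R)
    (≤-trans (≤-pred k) (tempoS-4* (suc K) (4K≤-pred {suc K} e l)))
  ... | inj₂ (inj₂ (O′ , inj₂ (l , g))) = openS b K (reachable-step m R) O′
    (+-cancelˡ-≡ 3 _ _ (trans (sym l) (trans e (cong suc (*-suc 4 K))))) (≤-trans (s≤s g) h) k′
openS zero    K R O e h k = tt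
openS (suc b) K {s} R O e h k with open-move R O
... | good t m f (inj₁ B) = t , m , blockedD b (reachable-step m R) B
  (≤-trans (≤-pred k) (≤-reflexive (trans (sym (tempoD-1+4* K)) (cong tempoD (suc-injective (trans (sym e) f))))))
... | good t m f (inj₂ (O′ , g)) = t , m , openD b K (reachable-step m R) O′ (suc-injective (trans (sym f) e))
  (≤-trans (s≤s g) h) (≤-pred k)
-- With `q` the sum of the quarters, the credit reads `7 + 4 * q ≤ 2 + 4 * K`; as these are
-- integers, `q` is at most `K - 2`.
... | neutral t m f O′ g c = t , m , openD b K (reachable-step m R) O′ (suc-injective (trans (sym f) e))
  (*-cancelˡ-< 4 (suc (weight quarter (play-centre t))) K
    (≤-pred (≤-pred (≤-trans (≤-trans (≤-reflexive (lemma (weight quarter (play-centre t)))) (+-monoʳ-≤ 7 (*-monoʳ-≤ 4 g)))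
      (≤-trans c (≤-reflexive e)))))) (≤-pred k)
  where
  lemma : ∀ h → 2 + suc (4 * suc h) ≡ 7 + 4 * h
  lemma = solve-∀
... | untouched t m mv B f g = ⊥-elim (parity m K (trans (sym g) e))
  where
  parity : ∀ m K → 5 + 4 * m ≡ 2 + 4 * K → ⊥
  parity m       zero    ()
  parity zero    (suc K) h with () ← suc-injective (suc-injective (suc-injective (suc-injective (suc-injective (trans h (cong (2 +_) (*-suc 4 K)))))))
  parity (suc m) (suc K) h = parity m K (+-cancelˡ-≡ 4 _ _
    (trans (cong (5 +_) (sym (*-suc 4 m))) (trans h (cong (2 +_) (*-suc 4 K)))))

falses-run : ∀ l xs → falses (replicate l false ++ xs) ≡ l + falses xs
falses-run zero    xs = refl
falses-run (suc l) xs = cong suc (falses-run l xs)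

falses-freshArm : ∀ p → falses (freshArm p) ≡ 4 * p
falses-freshArm p = trans (falses-run (4 * p) (true ∷ [])) (+-identityʳ (4 * p))

hc-freshArm : ∀ p → hc (freshArm (suc p)) ≡ p
hc-freshArm p = trans (cong (λ n → hc (bits (n ∷ []))) (*-suc 4 p))
  (trans (weigh-false quarter (3 + 4 * p) (true ∷ []) 0) (trans (+-identityʳ _) (trans (cong quarter (+-identityʳ (3 + 4 * p))) (go p))))
  where
  go : ∀ p → quarter (3 + 4 * p) ≡ p
  go zero = refl
  go (suc p) = trans (cong (λ n → quarter (3 + n)) (*-suc 4 p)) (cong suc (go p))

arm-fresh : ∀ p → Arm false (freshArm (suc p))
arm-fresh p = arm (padded-bits (4 * suc p ∷ [])) (clear-fresh (4 * suc p))
  (p , trans (length-run (4 * suc p)) (trans (+-comm (4 * suc p) 1) (cong suc (*-suc 4 p))))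
  where
  clear-fresh : ∀ l → Clear (replicate l false ++ true ∷ [])
  clear-fresh zero    = tt
  clear-fresh (suc l) = clear-fresh l
  length-run : ∀ l → length (replicate l false ++ true ∷ []) ≡ l + 1
  length-run zero    = refl
  length-run (suc l) = cong suc (length-run l)

-- Playing the centre at the start leaves three runs of residue 3, with sum 9, well above the
-- required 5.
fresh-AtLeastD : ∀ p q r → AtLeastD (suc (2 * (suc p + suc q + suc r))) ⟨ false , freshArm (suc p) , freshArm (suc q) , freshArm (suc r) ⟩
fresh-AtLeastD p q r = openD _ (suc p + suc q + suc r) (reachable (arm-fresh p) (arm-fresh q) (arm-fresh r) λ ())
  (refl , refl , refl , refl) sizes quarters ≤-refl
  where
  sizes : suc (falses (freshArm (suc p)) + falses (freshArm (suc q)) + falses (freshArm (suc r))) ≡ 1 + 4 * (suc p + suc q + suc r)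
  sizes = trans (cong suc (cong₂ _+_ (cong₂ _+_ (falses-freshArm (suc p)) (falses-freshArm (suc q))) (falses-freshArm (suc r))))
    (lemma (suc p) (suc q) (suc r))
    where
    lemma : ∀ p q r → suc (4 * p + 4 * q + 4 * r) ≡ 1 + 4 * (p + q + r)
    lemma = solve-∀
  quarters : 2 + (hc (freshArm (suc p)) + hc (freshArm (suc q)) + hc (freshArm (suc r))) ≤ suc p + suc q + suc r
  quarters = ≤-trans (≤-reflexive (cong (2 +_) (cong₂ _+_ (cong₂ _+_ (hc-freshArm p) (hc-freshArm q)) (hc-freshArm r))))
    (≤-trans (n≤1+n _) (≤-reflexive (lemma p q r)))
    where
    lemma : ∀ p q r → 3 + (p + q + r) ≡ suc p + suc q + suc r
    lemma = solve-∀

-- The game on the graph and the game on positions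

≡ᵇ-false : ∀ {m n} → ¬ m ≡ n → (m ≡ᵇ n) ≡ false
≡ᵇ-false {zero}  {zero}  h = ⊥-elim (h refl)
≡ᵇ-false {zero}  {suc n} h = refl
≡ᵇ-false {suc m} {zero}  h = refl
≡ᵇ-false {suc m} {suc n} h = ≡ᵇ-false (λ e → h (cong suc e))

≡ᵇ-refl : ∀ n → (n ≡ᵇ n) ≡ true
≡ᵇ-refl zero    = refl
≡ᵇ-refl (suc n) = ≡ᵇ-refl n

≡ᵇ-+ : ∀ k m n → (k + m ≡ᵇ k + n) ≡ (m ≡ᵇ n)
≡ᵇ-+ zero    m n = refl
≡ᵇ-+ (suc k) m n = ≡ᵇ-+ k m n

≟-toℕ : ∀ {n} (i j : Fin n) → ⌊ i Fin.≟ j ⌋ ≡ (toℕ i ≡ᵇ toℕ j)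
≟-toℕ i j with i Fin.≟ j
... | yes refl = sym (≡ᵇ-refl (toℕ i))
... | no h     = sym (≡ᵇ-false (λ e → h (toℕ-injective e)))

near : ℕ → ℕ → Bool
near zero    zero    = true
near zero    (suc j) = j ≡ᵇ 0
near (suc i) zero    = i ≡ᵇ 0
near (suc i) (suc j) = near i j

pad : ∀ {n} → (Fin n → Bool) → List Bool
pad f = tabulate f ++ true ∷ []

pad-cong : ∀ {n} {f g : Fin n → Bool} → (∀ i → f i ≡ g i) → pad f ≡ pad g
pad-cong {zero}  h = refl
pad-cong {suc n} h = cong₂ _∷_ (h zero) (pad-cong (h ∘ suc))

pad-injective : ∀ {n} {f g : Fin n → Bool} → pad f ≡ pad g → ∀ i → f i ≡ g i
pad-injective e zero    = ∷-injectiveˡ e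
pad-injective e (suc i) = pad-injective (∷-injectiveʳ e) i

pad-∨-false : ∀ {n} (f : Fin n → Bool) {g : Fin n → Bool} → (∀ i → g i ≡ false) → pad (λ i → f i ∨ g i) ≡ pad f
pad-∨-false f h = pad-cong (λ i → trans (cong (f i ∨_) (h i)) (∨-identityʳ (f i)))

pad-cover : ∀ {n} (f : Fin n → Bool) → pad (λ i → f i ∨ (toℕ i ≡ᵇ 0)) ≡ cover (pad f)
pad-cover {zero}  f = refl
pad-cover {suc n} f = cong₂ _∷_ (∨-zeroʳ (f zero)) (pad-∨-false (f ∘ suc) (λ _ → refl))

armPlay : ∀ {n} → Bool → (Fin n → Bool) → Fin n → List Bool
armPlay c f i = (c ∨ (toℕ i ≡ᵇ 0)) ∷ pad (λ j → f j ∨ near (toℕ i) (toℕ j))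

armPlay-zero₁ : ∀ c (f : Fin 1 → Bool) → armPlay c f zero ≡ true ∷ true ∷ true ∷ []
armPlay-zero₁ c f = cong₂ _∷_ (∨-zeroʳ c) (cong (_∷ true ∷ []) (∨-zeroʳ (f zero)))

armPlay-zero : ∀ {n} c (f : Fin (2 + n) → Bool) → armPlay c f zero ≡ true ∷ true ∷ true ∷ pad (λ i → f (suc (suc i)))
armPlay-zero c f = cong₂ _∷_ (∨-zeroʳ c) (cong₂ _∷_ (∨-zeroʳ (f zero)) (cong₂ _∷_ (∨-zeroʳ (f (suc zero)))
  (pad-∨-false (λ i → f (suc (suc i))) (λ _ → refl))))

armPlay-suc : ∀ {n} c (f : Fin (suc n) → Bool) i → armPlay c f (suc i) ≡ c ∷ armPlay (f zero) (f ∘ suc) i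
armPlay-suc c f i = cong (_∷ _) (∨-identityʳ c)

window-or-same : ∀ a b d xs → a ∷ b ∷ d ∷ xs ⇝ true ∷ true ∷ true ∷ xs ⊎ a ∷ b ∷ d ∷ xs ≡ true ∷ true ∷ true ∷ xs
window-or-same true  true  true  xs = inj₂ refl
window-or-same true  true  false xs = inj₁ (here refl)
window-or-same true  false d     xs = inj₁ (here refl)
window-or-same false b     d     xs = inj₁ (here refl)

-- The equality is the case of a vertex whose closed neighbourhood is already dominated; the padding
-- stands in for the missing outer neighbour of the leaf.
armPlay-⇝ : ∀ {n} c (f : Fin n → Bool) i → c ∷ pad f ⇝ armPlay c f i ⊎ c ∷ pad f ≡ armPlay c f i
armPlay-⇝ {suc zero} c f zero rewrite armPlay-zero₁ c f = window-or-same c (f zero) true []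
armPlay-⇝ {suc (suc n)} c f zero rewrite armPlay-zero c f = window-or-same c (f zero) (f (suc zero)) _
armPlay-⇝ {suc n} c f (suc i) rewrite armPlay-suc c f i with armPlay-⇝ (f zero) (f ∘ suc) i
... | inj₁ m = inj₁ (there m)
... | inj₂ e = inj₂ (cong (c ∷_) e)

⇝-armPlay : ∀ {n} c (f : Fin n → Bool) {L} → c ∷ pad f ⇝ L → ∃[ i ] L ≡ armPlay c f i
⇝-armPlay {zero} c f (there (there ()))
⇝-armPlay {suc zero} c f (here _) = zero , sym (armPlay-zero₁ c f)
⇝-armPlay {suc (suc n)} c f (here _) = zero , sym (armPlay-zero c f)
⇝-armPlay {suc n} c f (there m) with ⇝-armPlay (f zero) (f ∘ suc) m
... | i , e = suc i , trans (cong (c ∷_) e) (sym (armPlay-suc c f i))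

child : ℕ → ℕ → Bool
child zero    j = false
child (suc i) j = i ≡ᵇ j

near-child : ∀ i j → (i ≡ᵇ j) ∨ child i j ∨ child j i ≡ near i j
near-child zero zero = refl
near-child zero (suc j) = refl
near-child (suc i) zero = ∨-identityʳ (i ≡ᵇ 0)
near-child (suc zero) (suc zero) = refl
near-child (suc zero) (suc (suc j)) = refl
near-child (suc (suc i)) (suc zero) = ∨-identityʳ (i ≡ᵇ 0)
near-child (suc (suc i)) (suc (suc j)) = near-child (suc i) (suc j)

-- The tree as a centre with three arms

module Spider (p q r : ℕ) where

  G = T p q r
  open Values G

  e₁ : Fin (4 * p) → Fin (n G)
  e₁ i = suc ((i ↑ˡ 4 * q) ↑ˡ 4 * r)
  e₂ : Fin (4 * q) → Fin (n G)
  e₂ i = suc ((4 * p ↑ʳ i) ↑ˡ 4 * r)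
  e₃ : Fin (4 * r) → Fin (n G)
  e₃ i = suc ((4 * p + 4 * q) ↑ʳ i)

  data Vertex : Fin (n G) → Set where
    centre : Vertex zero
    on₁    : ∀ i → Vertex (e₁ i)
    on₂    : ∀ i → Vertex (e₂ i)
    on₃    : ∀ i → Vertex (e₃ i)

  vertex : ∀ v → Vertex v
  vertex zero = centre
  vertex (suc v) with splitAt (4 * p + 4 * q) v in e
  ... | inj₂ i = subst (Vertex ∘ suc) (splitAt⁻¹-↑ʳ {4 * p + 4 * q} e) (on₃ i)
  ... | inj₁ w with splitAt (4 * p) w in e′
  ...   | inj₁ i = subst (Vertex ∘ suc) (trans (cong (_↑ˡ 4 * r) (splitAt⁻¹-↑ˡ {4 * p} e′)) (splitAt⁻¹-↑ˡ e)) (on₁ i)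
  ...   | inj₂ i = subst (Vertex ∘ suc) (trans (cong (_↑ˡ 4 * r) (splitAt⁻¹-↑ʳ {4 * p} e′)) (splitAt⁻¹-↑ˡ e)) (on₂ i)

  toℕ-e₁ : ∀ i → toℕ (e₁ i) ≡ suc (0 + toℕ i)
  toℕ-e₁ i = cong suc (trans (toℕ-↑ˡ (i ↑ˡ 4 * q) (4 * r)) (toℕ-↑ˡ i (4 * q)))
  toℕ-e₂ : ∀ i → toℕ (e₂ i) ≡ suc (4 * p + toℕ i)
  toℕ-e₂ i = cong suc (trans (toℕ-↑ˡ (4 * p ↑ʳ i) (4 * r)) (toℕ-↑ʳ (4 * p) i))
  toℕ-e₃ : ∀ i → toℕ (e₃ i) ≡ suc (4 * p + 4 * q + toℕ i)
  toℕ-e₃ i = cong suc (toℕ-↑ʳ (4 * p + 4 * q) i)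

  nbr : ℕ → ℕ → Bool
  nbr a b = (a ≡ᵇ b) ∨ childOf p q a b ∨ childOf p q b a

  closedNbr-nbr : ∀ v u → closedNbr G v u ≡ nbr (toℕ v) (toℕ u)
  closedNbr-nbr v u = cong (_∨ (childOf p q (toℕ v) (toℕ u) ∨ childOf p q (toℕ u) (toℕ v))) (≟-toℕ v u)

  -- The `i`-th vertex of a branch, counted from 0, has label `suc (off + i)`; with this offset one
  -- set of adjacency lemmas serves all three branches.
  record Branch (off len : ℕ) : Set where
    field
      root : parentT p q (suc (off + 0)) ≡ 0
      next : ∀ i → suc i < len → parentT p q (suc (off + suc i)) ≡ suc (off + i)
  open Branch

  private
    parent : ∀ m → ¬ m ≡ 0 → ¬ m ≡ 4 * p → ¬ m ≡ 4 * p + 4 * q → parentT p q (suc m) ≡ m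
    parent m a b c rewrite ≡ᵇ-false a | ≡ᵇ-false b | ≡ᵇ-false c = refl

    beyond : ∀ k i → ¬ k + suc i ≡ k
    beyond k i e = m≢1+m+n k (sym (trans (sym (+-suc k i)) e))

  branch₁ : Branch 0 (4 * p)
  branch₁ = record { root = refl ; next = λ i h → parent (suc i) (λ ()) (λ e → <⇒≢ h e)
    (λ e → <⇒≢ (≤-trans h (m≤m+n _ _)) e) }

  branch₂ : Branch (4 * p) (4 * q)
  branch₂ = record { root = rt ; next = λ i h → trans (parent (4 * p + suc i)
      (λ e → n≮0 (subst (suc i ≤_) e (m≤n+m (suc i) (4 * p))))
      (beyond (4 * p) i) (λ e → <⇒≢ h (+-cancelˡ-≡ (4 * p) _ _ e))) (+-suc (4 * p) i) }
    where
    rt : parentT p q (suc (4 * p + 0)) ≡ 0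
    rt rewrite +-identityʳ (4 * p) | ≡ᵇ-refl (4 * p) | ∨-zeroʳ (4 * p ≡ᵇ 0) = refl

  branch₃ : Branch (4 * p + 4 * q) (4 * r)
  branch₃ = record { root = rt ; next = λ i h → trans (parent (4 * p + 4 * q + suc i)
      (λ e → n≮0 (subst (suc i ≤_) e (m≤n+m (suc i) (4 * p + 4 * q))))
      (λ e → beyond (4 * p) (4 * q + i) (trans (lemma (4 * p) (4 * q) i) e)) (beyond (4 * p + 4 * q) i)) (+-suc (4 * p + 4 * q) i) }
    where
    lemma : ∀ a b i → a + suc (b + i) ≡ a + b + suc i
    lemma = solve-∀
    rt : parentT p q (suc (4 * p + 4 * q + 0)) ≡ 0
    rt rewrite +-identityʳ (4 * p + 4 * q) | ≡ᵇ-refl (4 * p + 4 * q) | ∨-zeroʳ (4 * p + 4 * q ≡ᵇ 4 * p)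
             | ∨-zeroʳ (4 * p + 4 * q ≡ᵇ 0) = refl

  childOf-same : ∀ {off len} → Branch off len → ∀ i j → i < len → childOf p q (suc (off + i)) (suc (off + j)) ≡ child i j
  childOf-same B zero j h rewrite root B = refl
  childOf-same {off} B (suc i) j h rewrite next B i h = ≡ᵇ-+ off i j

  childOf-centre : ∀ {off len} → Branch off len → ∀ i → i < len → childOf p q (suc (off + i)) 0 ≡ (i ≡ᵇ 0)
  childOf-centre B zero h rewrite root B = refl
  childOf-centre B (suc i) h rewrite next B i h = refl

  childOf-other : ∀ {off len x} → Branch off len → (∀ i → i < len → ¬ off + i ≡ x) →
                  ∀ i → i < len → childOf p q (suc (off + i)) (suc x) ≡ false
  childOf-other B ne zero    h rewrite root B = refl
  childOf-other B ne (suc i) h rewrite next B i h = ≡ᵇ-false (ne i (<-trans (n<1+n i) h))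

  nbr-same : ∀ {off len} → Branch off len → ∀ i j → i < len → j < len → nbr (suc (off + i)) (suc (off + j)) ≡ near i j
  nbr-same {off} B i j h k = trans
    (cong₂ _∨_ (≡ᵇ-+ off i j) (cong₂ _∨_ (childOf-same B i j h) (childOf-same B j i k))) (near-child i j)

  nbr-from-centre : ∀ {off len} → Branch off len → ∀ j → j < len → nbr 0 (suc (off + j)) ≡ (j ≡ᵇ 0)
  nbr-from-centre B j h = childOf-centre B j h

  nbr-to-centre : ∀ {off len} → Branch off len → ∀ i → i < len → nbr (suc (off + i)) 0 ≡ (i ≡ᵇ 0)
  nbr-to-centre B i h = trans (∨-identityʳ _) (childOf-centre B i h)

  nbr-other : ∀ {off len off′ len′} → Branch off len → Branch off′ len′ →
              (∀ i j → i < len → j < len′ → ¬ off + i ≡ off′ + j) →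
              ∀ i j → i < len → j < len′ → nbr (suc (off + i)) (suc (off′ + j)) ≡ false
  nbr-other B B′ ne i j h k = cong₂ _∨_ (≡ᵇ-false (ne i j h k)) (cong₂ _∨_
    (childOf-other B (λ i h → ne i j h k) i h) (childOf-other B′ (λ j k e → ne i j h k (sym e)) j k))

  disjoint₁₂ : ∀ i j → i < 4 * p → j < 4 * q → ¬ i ≡ 4 * p + j
  disjoint₁₂ i j h k = <⇒≢ (≤-trans h (m≤m+n (4 * p) j))
  disjoint₁₃ : ∀ i j → i < 4 * p → j < 4 * r → ¬ i ≡ 4 * p + 4 * q + j
  disjoint₁₃ i j h k = <⇒≢ (≤-trans h (≤-trans (m≤m+n (4 * p) (4 * q)) (m≤m+n _ j)))
  disjoint₂₃ : ∀ i j → i < 4 * q → j < 4 * r → ¬ 4 * p + i ≡ 4 * p + 4 * q + j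
  disjoint₂₃ i j h k = <⇒≢ (≤-trans (+-monoʳ-< (4 * p) h) (m≤m+n _ j))

  position : VSet G → Position
  position D = ⟨ D zero , pad (D ∘ e₁) , pad (D ∘ e₂) , pad (D ∘ e₃) ⟩

  position-cong : ∀ {D D′} → (∀ u → D u ≡ D′ u) → position D ≡ position D′
  position-cong h rewrite h zero | pad-cong (h ∘ e₁) | pad-cong (h ∘ e₂) | pad-cong (h ∘ e₃) = refl

  position-injective : ∀ {D D′} → position D ≡ position D′ → ∀ u → D u ≡ D′ u
  position-injective {D} {D′} e u = go (vertex u)
    where
    go : ∀ {u} → Vertex u → D u ≡ D′ u
    go centre = cong Position.centreOf e
    go (on₁ i) = pad-injective (cong Position.armOf₁ e) i
    go (on₂ i) = pad-injective (cong Position.armOf₂ e) i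
    go (on₃ i) = pad-injective (cong Position.armOf₃ e) i

  replace₁ replace₂ replace₃ : List Bool → Position → Position
  replace₁ []       s                   = s
  replace₁ (c ∷ X′) ⟨ _ , X , Y , Z ⟩ = ⟨ c , X′ , Y , Z ⟩
  replace₂ []       s                   = s
  replace₂ (c ∷ Y′) ⟨ _ , X , Y , Z ⟩ = ⟨ c , X , Y′ , Z ⟩
  replace₃ []       s                   = s
  replace₃ (c ∷ Z′) ⟨ _ , X , Y , Z ⟩ = ⟨ c , X , Y , Z′ ⟩

  ⟨⟩-cong : ∀ {c c′ X X′ Y Y′ Z Z′} → c ≡ c′ → X ≡ X′ → Y ≡ Y′ → Z ≡ Z′ → ⟨ c , X , Y , Z ⟩ ≡ ⟨ c′ , X′ , Y′ , Z′ ⟩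
  ⟨⟩-cong refl refl refl refl = refl

  private
    nbr-of : ∀ {v u a b} → toℕ v ≡ a → toℕ u ≡ b → closedNbr G v u ≡ nbr a b
    nbr-of {v} {u} refl refl = closedNbr-nbr v u

  play-centre-position : ∀ D → position (play G D zero) ≡
    ⟨ true , cover (pad (D ∘ e₁)) , cover (pad (D ∘ e₂)) , cover (pad (D ∘ e₃)) ⟩
  play-centre-position D = ⟨⟩-cong (∨-zeroʳ (D zero)) (arm-of e₁ toℕ-e₁ branch₁) (arm-of e₂ toℕ-e₂ branch₂) (arm-of e₃ toℕ-e₃ branch₃)
    where
    arm-of : ∀ {off m} (e : Fin m → Fin (n G)) → (∀ i → toℕ (e i) ≡ suc (off + toℕ i)) → Branch off m →
             pad (λ j → play G D zero (e j)) ≡ cover (pad (D ∘ e))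
    arm-of e te B = trans (pad-cong (λ j → cong (D (e j) ∨_) (trans (nbr-of {zero} refl (te j)) (nbr-from-centre B (toℕ j) (toℕ<n j)))))
      (pad-cover (D ∘ e))

  module _ {off m} (e : Fin m → Fin (n G)) (te : ∀ i → toℕ (e i) ≡ suc (off + toℕ i)) (B : Branch off m) (D : VSet G) (i : Fin m) where

    play-on-centre : play G D (e i) zero ≡ D zero ∨ (toℕ i ≡ᵇ 0)
    play-on-centre = cong (D zero ∨_) (trans (nbr-of {e i} {zero} (te i) refl) (nbr-to-centre B (toℕ i) (toℕ<n i)))

    play-on-own : pad (λ j → play G D (e i) (e j)) ≡ pad (λ j → D (e j) ∨ near (toℕ i) (toℕ j))
    play-on-own = pad-cong (λ j → cong (D (e j) ∨_) (trans (nbr-of (te i) (te j)) (nbr-same B (toℕ i) (toℕ j) (toℕ<n i) (toℕ<n j))))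

    play-on-other : ∀ {off′ m′} (e′ : Fin m′ → Fin (n G)) → (∀ i → toℕ (e′ i) ≡ suc (off′ + toℕ i)) → Branch off′ m′ →
      (∀ i j → i < m → j < m′ → ¬ off + i ≡ off′ + j) → pad (λ j → play G D (e i) (e′ j)) ≡ pad (D ∘ e′)
    play-on-other e′ te′ B′ ne = pad-∨-false (D ∘ e′)
      (λ j → trans (nbr-of (te i) (te′ j)) (nbr-other B B′ ne (toℕ i) (toℕ j) (toℕ<n i) (toℕ<n j)))

  play₁ : ∀ D i → position (play G D (e₁ i)) ≡ replace₁ (armPlay (D zero) (D ∘ e₁) i) (position D)
  play₁ D i = ⟨⟩-cong (play-on-centre e₁ toℕ-e₁ branch₁ D i) (play-on-own e₁ toℕ-e₁ branch₁ D i)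
    (play-on-other e₁ toℕ-e₁ branch₁ D i e₂ toℕ-e₂ branch₂ disjoint₁₂)
    (play-on-other e₁ toℕ-e₁ branch₁ D i e₃ toℕ-e₃ branch₃ disjoint₁₃)

  play₂ : ∀ D i → position (play G D (e₂ i)) ≡ replace₂ (armPlay (D zero) (D ∘ e₂) i) (position D)
  play₂ D i = ⟨⟩-cong (play-on-centre e₂ toℕ-e₂ branch₂ D i)
    (play-on-other e₂ toℕ-e₂ branch₂ D i e₁ toℕ-e₁ branch₁ (λ i j h k e → disjoint₁₂ j i k h (sym e)))
    (play-on-own e₂ toℕ-e₂ branch₂ D i)
    (play-on-other e₂ toℕ-e₂ branch₂ D i e₃ toℕ-e₃ branch₃ disjoint₂₃)

  play₃ : ∀ D i → position (play G D (e₃ i)) ≡ replace₃ (armPlay (D zero) (D ∘ e₃) i) (position D)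
  play₃ D i = ⟨⟩-cong (play-on-centre e₃ toℕ-e₃ branch₃ D i)
    (play-on-other e₃ toℕ-e₃ branch₃ D i e₁ toℕ-e₁ branch₁ (λ i j h k e → disjoint₁₃ j i k h (sym e)))
    (play-on-other e₃ toℕ-e₃ branch₃ D i e₂ toℕ-e₂ branch₂ (λ i j h k e → disjoint₂₃ j i k h (sym e)))
    (play-on-own e₃ toℕ-e₃ branch₃ D i)

  -- If the move were vacuous on the lists, `position-injective` would make it vacuous on the vertex
  -- set, against legality.
  legal⇒step : ∀ D v → Legal D v → position D ⟶ position (play G D v)
  legal⇒step D v l = go (vertex v) l
    where
    same : ∀ v → Legal D v → position D ≡ position (play G D v) → position D ⟶ position (play G D v)
    same v l e = ⊥-elim (legal⇒changed {D} {v} l (λ u → sym (position-injective {D} {play G D v} e u)))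
    go : ∀ {v} → Vertex v → Legal D v → position D ⟶ position (play G D v)
    go centre l = at (D zero ∧ top (pad (D ∘ e₁)) ∧ top (pad (D ∘ e₂)) ∧ top (pad (D ∘ e₃))) refl
      where
      all-true : ∀ c X Y Z → c ∧ top X ∧ top Y ∧ top Z ≡ true →
                 ⟨ c , X , Y , Z ⟩ ≡ ⟨ true , cover X , cover Y , cover Z ⟩
      all-true true X Y Z e = ⟨⟩-cong refl (covered X (∧-left e)) (covered Y (∧-left (∧-right (top X) e)))
        (covered Z (∧-right (top Y) (∧-right (top X) e)))
        where
        ∧-left : ∀ {a b} → a ∧ b ≡ true → a ≡ true
        ∧-left {true} _ = refl
        ∧-right : ∀ a {b} → a ∧ b ≡ true → b ≡ true
        ∧-right true e = e
        covered : ∀ X → top X ≡ true → X ≡ cover X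
        covered []         _ = refl
        covered (true ∷ X) _ = refl
      at : ∀ b → D zero ∧ top (pad (D ∘ e₁)) ∧ top (pad (D ∘ e₂)) ∧ top (pad (D ∘ e₃)) ≡ b → position D ⟶ position (play G D zero)
      at false e = subst (position D ⟶_) (sym (play-centre-position D)) (centre e)
      at true  e = same zero l (trans (all-true (D zero) (pad (D ∘ e₁)) (pad (D ∘ e₂)) (pad (D ∘ e₃)) e) (sym (play-centre-position D)))
    go (on₁ i) l with armPlay-⇝ (D zero) (D ∘ e₁) i
    ... | inj₁ m = subst (position D ⟶_) (sym (play₁ D i)) (arm₁ m)
    ... | inj₂ e = same (e₁ i) l (trans (cong (λ L → replace₁ L (position D)) e) (sym (play₁ D i)))
    go (on₂ i) l with armPlay-⇝ (D zero) (D ∘ e₂) i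
    ... | inj₁ m = subst (position D ⟶_) (sym (play₂ D i)) (arm₂ m)
    ... | inj₂ e = same (e₂ i) l (trans (cong (λ L → replace₂ L (position D)) e) (sym (play₂ D i)))
    go (on₃ i) l with armPlay-⇝ (D zero) (D ∘ e₃) i
    ... | inj₁ m = subst (position D ⟶_) (sym (play₃ D i)) (arm₃ m)
    ... | inj₂ e = same (e₃ i) l (trans (cong (λ L → replace₃ L (position D)) e) (sym (play₃ D i)))

  -- An illegal vertex changes nothing, whereas every step lowers `size`.
  step⇒legal : ∀ {D t} → position D ⟶ t → ∃[ v ] (Legal D v × position (play G D v) ≡ t)
  step⇒legal {D} {t} m = let v , e = play-of m in v , is-legal v e (legal G D v) refl , e
    where
    play-of : ∀ {t} → position D ⟶ t → ∃[ v ] position (play G D v) ≡ t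
    play-of (centre _) = zero , play-centre-position D
    play-of (arm₁ m) = let i , e = ⇝-armPlay (D zero) (D ∘ e₁) m in
      e₁ i , trans (play₁ D i) (cong (λ L → replace₁ L (position D)) (sym e))
    play-of (arm₂ m) = let i , e = ⇝-armPlay (D zero) (D ∘ e₂) m in
      e₂ i , trans (play₂ D i) (cong (λ L → replace₂ L (position D)) (sym e))
    play-of (arm₃ m) = let i , e = ⇝-armPlay (D zero) (D ∘ e₃) m in
      e₃ i , trans (play₃ D i) (cong (λ L → replace₃ L (position D)) (sym e))
    is-legal : ∀ v → position (play G D v) ≡ t → ∀ b → legal G D v ≡ b → Legal D v
    is-legal v e true  l = l
    is-legal v e false l = ⊥-elim (<-irrefl (cong size (trans (sym e) (position-cong {play G D v} {D} (illegal⇒unchanged {D} {v} l)))) (size-step< m))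

  AtMostD⇒≤ : ∀ f b {D} → AtMostD b (position D) → value G f dominator D ≤ b
  AtMostS⇒≤ : ∀ f b {D} → AtMostS b (position D) → value G f staller D ≤ b
  AtMostD⇒≤ zero    b       h = z≤n
  AtMostD⇒≤ (suc f) zero    {D} h = dominator-end {suc f} (λ v l → h _ (legal⇒step D v l))
  AtMostD⇒≤ (suc f) (suc b) {D} (inj₁ h) = ≤-trans (dominator-end {suc f} (λ v l → h _ (legal⇒step D v l))) z≤n
  AtMostD⇒≤ (suc f) (suc b) {D} (inj₂ (t , m , h)) with step⇒legal {D} m
  ... | v , l , e = dominator-≤ v l (AtMostS⇒≤ f b (subst (AtMostS b) (sym e) h))
  AtMostS⇒≤ zero    b       h = z≤n
  AtMostS⇒≤ (suc f) zero    {D} h = staller-end {suc f} (λ v l → h _ (legal⇒step D v l))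
  AtMostS⇒≤ (suc f) (suc b) {D} h = staller-≤ (λ v l → AtMostD⇒≤ f b (h _ (legal⇒step D v l)))

  -- Running out of fuel gives the value 0, which is harmless for upper bounds, while a lower bound
  -- `b` has to be backed by at least `b` units.
  AtLeastD⇒≥ : ∀ f b {D} → b ≤ f → AtLeastD b (position D) → b ≤ value G f dominator D
  AtLeastS⇒≥ : ∀ f b {D} → b ≤ f → AtLeastS b (position D) → b ≤ value G f staller D
  AtLeastD⇒≥ f zero k h = z≤n
  AtLeastD⇒≥ (suc f) (suc b) {D} (s≤s k) ((t , m) , h) with step⇒legal {D} m
  ... | v , l , _ = dominator-≥ v l (λ v l → AtLeastS⇒≥ f b k (h _ (legal⇒step D v l)))
  AtLeastS⇒≥ f zero k h = z≤n
  AtLeastS⇒≥ (suc f) (suc b) {D} (s≤s k) (t , m , h) with step⇒legal {D} m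
  ... | v , l , e = staller-≥ v l (AtLeastD⇒≥ f b k (subst (AtLeastD b) (sym e) h))

-- The start positions and the conclusion

pad-fresh : ∀ m → pad {m} (λ _ → false) ≡ bits (m ∷ [])
pad-fresh zero    = refl
pad-fresh (suc m) = cong (false ∷_) (pad-fresh m)

pad-single : ∀ {m} (i : Fin m) → ∃[ j ] (toℕ i + suc j ≡ m × pad {m} (λ k → toℕ k ≡ᵇ toℕ i) ≡ bits (toℕ i ∷ j ∷ []))
pad-single {suc m} zero    = m , refl , cong (true ∷_) (pad-fresh m)
pad-single {suc m} (suc i) = let j , e , f = pad-single i in j , cong suc e , cong (false ∷_) f

module Endgame (p q r : ℕ) where

  open Spider (suc p) (suc q) (suc r)

  k = 2 * (suc p + suc q + suc r)

  marked : Fin (n G) → VSet G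
  marked v u = ⌊ u Fin.≟ v ⌋

  start-position : position (λ _ → false) ≡ ⟨ false , freshArm (suc p) , freshArm (suc q) , freshArm (suc r) ⟩
  start-position = ⟨⟩-cong refl (pad-fresh (4 * suc p)) (pad-fresh (4 * suc q)) (pad-fresh (4 * suc r))

  private
    marked-toℕ : ∀ {u v a b} → toℕ u ≡ a → toℕ v ≡ b → marked v u ≡ (a ≡ᵇ b)
    marked-toℕ {u} {v} refl refl = ≟-toℕ u v

  module _ {off m} (e : Fin m → Fin (n G)) (te : ∀ i → toℕ (e i) ≡ suc (off + toℕ i)) (i : Fin m) where

    marked-own : ∃[ j ] (toℕ i + suc j ≡ m × pad (λ u → marked (e i) (e u)) ≡ bits (toℕ i ∷ j ∷ []))
    marked-own = let j , f , g = pad-single i in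
      j , f , trans (pad-cong (λ u → trans (marked-toℕ (te u) (te i)) (≡ᵇ-+ off (toℕ u) (toℕ i)))) g

    marked-other : ∀ {off′ m′} (e′ : Fin m′ → Fin (n G)) → (∀ i → toℕ (e′ i) ≡ suc (off′ + toℕ i)) →
      (∀ i j → i < m → j < m′ → ¬ off + i ≡ off′ + j) → pad (λ u → marked (e i) (e′ u)) ≡ bits (m′ ∷ [])
    marked-other {m′ = m′} e′ te′ ne = trans (pad-cong (λ u → trans (marked-toℕ (te′ u) (te i))
      (≡ᵇ-false (λ eq → ne (toℕ i) (toℕ u) (toℕ<n i) (toℕ<n u) (sym eq))))) (pad-fresh m′)

  γg-lower : suc k ≤ γg G
  -- The fuel suffices because `n G` is `1 + 4 * (p + q + r)` for the arm parameters, against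
  -- `1 + 2 * (p + q + r)` moves.
  γg-lower = AtLeastD⇒≥ (n G) (suc k) {λ _ → false} (≤-trans (s≤s (*-monoˡ-≤ (suc p + suc q + suc r) {2} {4} (s≤s (s≤s z≤n))))
    (≤-reflexive (cong suc (lemma (suc p) (suc q) (suc r)))))
    (subst (AtLeastD (suc k)) (sym start-position) (fresh-AtLeastD p q r))
    where
    lemma : ∀ p q r → 4 * (p + q + r) ≡ 4 * p + 4 * q + 4 * r
    lemma = solve-∀

  γg-upper : γg G ≤ suc k
  γg-upper = AtMostD⇒≤ (n G) (suc k) {λ _ → false} (subst (AtMostD (suc k)) (sym start-position) (fresh-AtMostD (suc p) (suc q) (suc r)))

  marked-AtMostD : ∀ v → AtMostD k (position (marked v))
  marked-AtMostD v = go (vertex v)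
    where
    via : ∀ {s b} v → position (marked v) ≡ s → b ≡ k → AtMostD b s → AtMostD k (position (marked v))
    via v e refl h = subst (AtMostD k) (sym e) h
    go : ∀ {v} → Vertex v → AtMostD k (position (marked v))
    go centre = via zero (⟨⟩-cong refl (pad-fresh (4 * suc p)) (pad-fresh (4 * suc q)) (pad-fresh (4 * suc r))) refl (centre-AtMostD (suc p) (suc q) (suc r))
    go (on₁ i) = let j , f , g = marked-own e₁ toℕ-e₁ i in
      via (e₁ i) (⟨⟩-cong refl g (marked-other e₁ toℕ-e₁ i e₂ toℕ-e₂ disjoint₁₂) (marked-other e₁ toℕ-e₁ i e₃ toℕ-e₃ disjoint₁₃))
        refl (vertex-AtMostD (suc p) q r (toℕ i) j f)
    go (on₂ i) = let j , f , g = marked-own e₂ toℕ-e₂ i in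
      via (e₂ i) (⟨⟩-cong refl (marked-other e₂ toℕ-e₂ i e₁ toℕ-e₁ (λ i j h k e → disjoint₁₂ j i k h (sym e))) g
          (marked-other e₂ toℕ-e₂ i e₃ toℕ-e₃ disjoint₂₃))
        (cong (λ s → 2 * (s + suc r)) (+-comm (suc q) (suc p)))
        (Swap₁₂.σ-AtMostD (2 * (suc q + suc p + suc r)) (vertex-AtMostD (suc q) p r (toℕ i) j f))
    go (on₃ i) = let j , f , g = marked-own e₃ toℕ-e₃ i in
      via (e₃ i) (⟨⟩-cong refl (marked-other e₃ toℕ-e₃ i e₁ toℕ-e₁ (λ i j h k e → disjoint₁₃ j i k h (sym e)))
          (marked-other e₃ toℕ-e₃ i e₂ toℕ-e₂ (λ i j h k e → disjoint₂₃ j i k h (sym e))) g)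
        (cong (2 *_) (lemma (suc p) (suc q) (suc r)))
        (Swap₁₃.σ-AtMostD (2 * (suc r + suc q + suc p)) (vertex-AtMostD (suc r) q p (toℕ i) j f))
      where
      lemma : ∀ p q r → r + q + p ≡ p + q + r
      lemma = solve-∀

  marked-upper : ∀ v → γg∣ G v ≤ k
  marked-upper v = AtMostD⇒≤ (n G) k {marked v} (marked-AtMostD v)

theorem4p1 : (p q r : ℕ) → p ≥ 1 → q ≥ 1 → r ≥ 1 →
    (γg (T p q r) ≡ suc (2 * (p + q + r)))
    × ((v : Fin (n (T p q r))) → γg∣ (T p q r) v < γg (T p q r))
theorem4p1 (suc p) (suc q) (suc r) _ _ _ = ≤-antisym γg-upper γg-lower , λ v → ≤-trans (s≤s (marked-upper v)) γg-lower
  where open Endgame p q r
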